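{- Let $q\equiv1\pmod4$ be a prime power, $n\ge3$ odd, $\beta\in\mathbb{F}_q^*$ and $Q=(q^n-1)/(q-1)$. Write the product of the distinct prime divisors of $q^n-1$ as $k\,p_1\cdots p_s$, where $s\ge0$ and $p_1,\dots,p_s$ are distinct primes not dividing $k$, ordered so that $p_i\mid Q$ for $1\le i\le r$ and $p_i\nmid Q$ for $r<i\le s$. Let $\delta=1-\sum_{i=1}^s 1/p_i$ (with $\delta=1$ if $s=0$), $\delta_Q=1-\sum_{i=1}^r1/p_i$, and let $k_Q$ be the product of the primes dividing $k$ that divide $Q$. Assume $\delta>0$ and $$q^{\frac{n-1}{2}}>2\sqrt2\Big(\frac{s-1}{\delta}+2\Big)W(k)-\sqrt2\Big(\frac{r-1+\delta_Q}{\delta}+1\Big)W(k_Q).$$ Then $\mathcal{N}_\beta(q^n-1)>0$.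
   Context: For a divisor $m$ of $q^n-1$, an element $\xi\in\mathbb{F}_{q^n}^*$ is $m$-free if $\xi=\zeta^d$ with $d\mid m$ and $\zeta\in\mathbb{F}_{q^n}^*$ implies $d=1$. $\mathcal{N}_\beta(m)$ is the number of $m$-free $\xi\in\mathbb{F}_{q^n}^*$ with $\mathrm{Tr}(\xi^2)=\beta$, where $\mathrm{Tr}(\xi)=\sum_{i=0}^{n-1}\xi^{q^i}$. $W(t)$ is the number of square-free divisors of $t$. -}

module Defs where

open import Level using (0ℓ)
open import Data.Nat as ℕ using (ℕ; zero; suc; _∸_)
open import Data.Nat.Divisibility using (_∣_; _∣?_)
open import Data.Nat.Primality using (Prime; prime?)
open import Data.Integer as ℤ using (+_; -_)
open import Data.Rational as ℚ using (ℚ; 0ℚ; 1ℚ; _÷_; _-_; _*_; _<_; _≤_; _>_; ≢-nonZero)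
open import Data.Rational.Properties using (_≟_)
open import Data.List using (List; []; _∷_; filter; length; map; foldr; upTo)
open import Data.Nat.ListAction using (product)
open import Data.List.Relation.Unary.Unique.Propositional using (Unique)
open import Data.List.Relation.Unary.All using (All; all?)
open import Data.Product using (_×_; Σ; ∃; _,_)
open import Data.Sum using (_⊎_)
open import Data.Fin using (Fin)
open import Relation.Nullary using (¬_; yes; no; Dec; ¬?)
open import Relation.Nullary.Decidable using (_×-dec_)
open import Relation.Binary.PropositionalEquality using (_≡_; _≢_)
open import Function.Bundles using (_↔_)
open import Algebra.Structures using (IsCommutativeRing)

record FiniteField : Set₁ where
  infixl 6 _+F_
  infixl 7 _*F_
  field
    Carrier : Set
    _+F_ _*F_ : Carrier → Carrier → Carrier
    -F_ : Carrier → Carrier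
    0F 1F : Carrier
    isCommutativeRing : IsCommutativeRing _≡_ _+F_ _*F_ -F_ 0F 1F
    0≢1 : 0F ≢ 1F
    inverse : ∀ x → x ≢ 0F → Σ Carrier (λ y → x *F y ≡ 1F)
    card : ℕ
    enum : Fin card ↔ Carrier

  _^F_ : Carrier → ℕ → Carrier
  x ^F zero = 1F
  x ^F suc m = x *F (x ^F m)

  sumF : ℕ → (ℕ → Carrier) → Carrier
  sumF zero f = 0F
  sumF (suc n) f = sumF n f +F f n

  Tr : (q n : ℕ) → Carrier → Carrier
  Tr q n ξ = sumF n (λ i → ξ ^F (q ℕ.^ i))

  IsFree : ℕ → Carrier → Set
  IsFree m ξ = ∀ (d : ℕ) (ζ : Carrier) → d ∣ m → ζ ≢ 0F → ξ ≡ ζ ^F d → d ≡ 1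

  NPositive : (q n m : ℕ) → Carrier → Set
  NPositive q n m β = Σ Carrier (λ ξ → (ξ ≢ 0F) × IsFree m ξ × (Tr q n (ξ *F ξ) ≡ β))

IsPrimePower : ℕ → Set
IsPrimePower q = Σ ℕ (λ p → Σ ℕ (λ m → Prime p × (1 ℕ.≤ m) × (q ≡ p ℕ.^ m)))

rad : ℕ → ℕ
rad t = product (filter (λ p → prime? p ×-dec (p ∣? t)) (upTo (suc t)))

radBoth : ℕ → ℕ → ℕ
radBoth k Q = product (filter (λ p → prime? p ×-dec ((p ∣? k) ×-dec (p ∣? Q))) (upTo (suc k)))

squareFree? : ∀ d → Dec (All (λ i → ¬ ((2 ℕ.≤ i) × ((i ℕ.* i) ∣ d))) (upTo (suc d)))
squareFree? d = all? (λ i → ¬? ((2 ℕ.≤? i) ×-dec ((i ℕ.* i) ∣? d))) (upTo (suc d))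

W : ℕ → ℕ
W t = length (filter (λ d → (1 ℕ.≤? d) ×-dec ((d ∣? t) ×-dec squareFree? d)) (upTo (suc t)))

ℕ→ℚ : ℕ → ℚ
ℕ→ℚ n = (+ n) ℚ./ 1

-- 1/p for p ≠ 0 (only used for primes p)
recip : ℕ → ℚ
recip zero = 0ℚ
recip (suc m) = (+ 1) ℚ./ suc m

-- p / q (only used with q > 0, guaranteed by the hypothesis δ > 0)
divQ : ℚ → ℚ → ℚ
divQ p q with q ≟ 0ℚ
... | yes _ = 0ℚ
... | no q≢0 = _÷_ p q {{≢-nonZero q≢0}}

-- A > √2 · Z, decided exactly over ℚ (√2 irrational)
_>√2*_ : ℚ → ℚ → Set
A >√2* Z = ((0ℚ ℚ.≤ A) × ((Z ℚ.< 0ℚ) ⊎ ((ℕ→ℚ 2 ℚ.* (Z ℚ.* Z)) ℚ.< (A ℚ.* A))))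
         ⊎ ((A ℚ.< 0ℚ) × ((Z ℚ.< 0ℚ) × ((A ℚ.* A) ℚ.< (ℕ→ℚ 2 ℚ.* (Z ℚ.* Z)))))

sumℚ : List ℚ → ℚ
sumℚ = foldr ℚ._+_ 0ℚ

divℕ : ℕ → ℕ → ℕ
divℕ m zero = 0
divℕ m (suc d) = m ℕ./ suc d

Qof : ℕ → ℕ → ℕ
Qof q n = divℕ (q ℕ.^ n ∸ 1) (q ∸ 1)

psQ : ℕ → ℕ → List ℕ → List ℕ
psQ q n ps = filter (λ p → p ∣? Qof q n) ps

δ : List ℕ → ℚ
δ ps = 1ℚ ℚ.- sumℚ (map recip ps)

δQ : ℕ → ℕ → List ℕ → ℚ
δQ q n ps = δ (psQ q n ps)

-- 2((s-1)/δ + 2) W(k) - ((r-1+δ_Q)/δ + 1) W(k_Q), so that the hypothesis reads q^((n-1)/2) > √2 · bound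
bound : ℕ → ℕ → ℕ → List ℕ → ℚ
bound q n k ps =
  (ℕ→ℚ 2 ℚ.* (divQ (ℕ→ℚ (length ps) ℚ.- 1ℚ) (δ ps) ℚ.+ ℕ→ℚ 2) ℚ.* ℕ→ℚ (W k))
  ℚ.- ((divQ ((ℕ→ℚ (length (psQ q n ps)) ℚ.- 1ℚ) ℚ.+ δQ q n ps) (δ ps) ℚ.+ 1ℚ) ℚ.* ℕ→ℚ (W (radBoth k (Qof q n))))

-- Put N = q^n - 1 and R = q^((n-1)/2). The sum over d | m of the characters of order d in the usual expression for m-free
-- elements is replaced by the rational function f D (D a list of distinct primes dividing N), and E D is the sum of f D(ξ) over
-- the ξ with Tr(ξ²) = β. No characters or Gauss sums are needed:
-- f D is an idempotent for convolution up to a scalar, so E D² is at most the mean square of a ↦ ∑ f D(ξ) [Tr(a ξ²) = β], and that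
-- mean square is computed by letting β vary over 𝔽_q: Tr(a (u - u')) = 0 holds for exactly q^(n-1) values of a unless u = u'.
-- This gives |E D| ≤ 2R for D ≠ ∅. If all primes of D divide Q then f D(ξ) = f D(ξ²), hence E D = B D - B (2 ∷ D), where B is the
-- analogous linear sum over Tr(y) = β; here |B (2 ∷ D)| ≤ R, and √q |B D| ≤ R because f D is 𝔽_q*-invariant (for D = ∅ instead
-- B D = q^(n-1), the main term), so E D is within C R of its main term as soon as 3/2 + 3/q ≤ C².
-- The sieve inequality over p₁, …, p_s then excludes the absence of solutions when C ≤ √2. For q = 5 this C is slightly too
-- large, but the slack of the prime 2 (which never divides Q) suffices unless many primes divide Q. These are all ≥ 7, so then
-- q^n is so large that the sieve with all primes in the core succeeds.
module Submission where

open import Defs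
open import Level using (0ℓ)
open import Algebra.Bundles using (CommutativeRing)
import Data.Fin.Properties as Finₚ
open import Data.Empty using (⊥; ⊥-elim)
open import Data.Fin as Fin using (Fin; toℕ)
import Data.Integer as ℤ
import Data.Integer.Properties as ℤₚ
open import Data.List using (List; []; _∷_; map; filter; length; upTo; replicate; _++_)
open import Data.List.Membership.Propositional using (_∈_; _∉_; lose)
open import Data.List.Membership.Propositional.Properties
import Data.List.Properties as Listₚ
open import Data.List.Relation.Unary.All as All using (All; []; _∷_)
import Data.List.Relation.Unary.All.Properties as Allₚ
open import Data.List.Relation.Unary.Any as Any using (Any; here; there)
open import Data.List.Relation.Unary.Unique.Propositional using (Unique; []; _∷_)
import Data.List.Relation.Unary.Unique.Propositional.Properties as Uniqueₚ
open import Data.Nat as ℕ using (ℕ; zero; suc; s≤s; z≤n; _^_; _∸_)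
open import Data.Nat.Coprimality as Coprimality using (Coprime; coprime-Bézout; prime⇒coprime; coprime-divisor)
import Data.Nat.DivMod as DivMod
open import Data.Nat.Divisibility as Div using (_∣_; _∣?_; divides)
open import Data.Nat.GCD using (module Bézout)
open import Data.Nat.ListAction using (product)
open import Data.Nat.ListAction.Properties using (∈⇒∣product; product≢0)
open import Data.Nat.Primality using (Prime; prime?; prime[2]; ¬prime[0]; ¬prime[1]; euclidsLemma; prime⇒irreducible; prime⇒nonTrivial; prime⇒nonZero)
open import Data.Nat.Primality.Factorisation using (factorise; factorisationHasAllPrimeFactors)
import Data.Nat.Properties as ℕₚ
import Data.Nat.Tactic.RingSolver as ℕ-Solver
open import Data.Product using (_×_; _,_; Σ; proj₁; proj₂; ∃)
open import Data.Rational as ℚ using (ℚ; 0ℚ; 1ℚ)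
import Data.Rational.Properties as ℚₚ
open import Data.Sum using (_⊎_; inj₁; inj₂; fromInj₂; [_,_]′)
open import Relation.Binary.Definitions using (tri<; tri≈; tri>)
open import Relation.Binary.PropositionalEquality
open import Relation.Nullary using (¬_; Dec; yes; no; ¬?)
open import Relation.Nullary.Decidable using (_×-dec_; dec⇒maybe; from-no; from-yes; map′)
open import Tactic.RingSolver using (solve-∀)
open import Tactic.RingSolver.Core.AlmostCommutativeRing using (AlmostCommutativeRing; fromCommutativeRing)

-- Put `x = s - 1 + 2δ` and `y = r - 1 + δ + δ_Q`. The hypothesis times `δ` reads
-- `δ R > √2 (2 x W(k) - y W(k_Q))`, while a sieve that finds nothing yields
-- `δ R ≤ 2 x W(k) - (2 - C) y W(k_Q)`. The general bound `2R` lies well below the permitted `2√2 R`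
-- and may be crude, but lists of primes dividing `Q` are allowed only `√2 R`, and there `2R` need
-- not suffice. This is why `E D` is split: of the two linear sums one is smaller by the factor
-- `√q`, so the ideal constant would be `1 + 1/√q`. Only squares of these sums are known to be
-- bounded, and a completed square combines them at the price of the slightly larger `3/2 + 3/q` for
-- `C²`. For `q = 5` even the ideal constant 1.447 exceeds `√2`, so no sharper treatment of the
-- cross term would spare the separate argument there. The functions are chosen rational-valued so
-- that character sums, with complex values and absolute values `√q`, never appear. What remains
-- irrational is `√2`, which is replaced by a fraction.

module Arithmetic where

  open import Data.Nat
  open import Data.Nat.Combinatorics using (_C_; nC1≡n; nCk+nC[k+1]≡[n+1]C[k+1])
  open import Data.Nat.DivMod using (m*n/n≡m)
  open import Data.Nat.Divisibility
  open import Data.Nat.Properties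

  -- Square-free divisors, geometric sums and binomial coefficients

  2≤prime : ∀ {p} → Prime p → 2 ≤ p
  2≤prime {p} p-prime = nonTrivial⇒n>1 p {{prime⇒nonTrivial p-prime}}

  2≤primePower : ∀ {q} → IsPrimePower q → 2 ≤ q
  2≤primePower (p , m , p-prime , 1≤m , refl) = ≤-trans (2≤prime p-prime)
    (≤-trans (≤-reflexive (sym (^-identityʳ p))) (^-monoʳ-≤ p {{prime⇒nonZero p-prime}} 1≤m))

  unique-⊆⇒length≤ : ∀ {A : Set} {xs ys : List A} → Unique xs → (∀ {x} → x ∈ xs → x ∈ ys) → length xs ≤ length ys
  unique-⊆⇒length≤ {xs = []} _ _ = z≤n
  unique-⊆⇒length≤ {xs = x ∷ xs} (x∉ ∷ u) sub with ∈-∃++ (sub (here refl))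
  ... | ys , zs , refl = ≤-trans (s≤s (unique-⊆⇒length≤ u sub′)) (≤-reflexive (sym (Listₚ.length-++-sucʳ ys x zs)))
    where
    sub′ : ∀ {y} → y ∈ xs → y ∈ ys ++ zs
    sub′ {y} y∈ with ∈-++⁻ ys (sub (there y∈))
    ... | inj₁ l = ∈-++⁺ˡ l
    ... | inj₂ (here refl) = ⊥-elim (All.lookup x∉ y∈ refl)
    ... | inj₂ (there l) = ∈-++⁺ʳ ys l

  prime-∣-prime : ∀ {p p′} → Prime p → Prime p′ → p ∣ p′ → p ≡ p′
  prime-∣-prime h h′ d with prime⇒irreducible h′ d
  ... | inj₁ refl = ⊥-elim (¬prime[1] h)
  ... | inj₂ e = e

  ∃-prime-divisor : ∀ m → m ≢ 0 → m ≢ 1 → ∃ λ p → Prime p × p ∣ m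
  ∃-prime-divisor m m≢0 m≢1 with factorise m {{≢-nonZero m≢0}}
  ... | record { factors = [] ; isFactorisation = e } = ⊥-elim (m≢1 e)
  ... | record { factors = p ∷ ps ; isFactorisation = e ; factorsPrime = h ∷ _ } = p , h , divides (product ps) (trans e (*-comm p (product ps)))

  prime∤product : ∀ {p ps} → Prime p → All Prime ps → p ∉ ps → ¬ (p ∣ product ps)
  prime∤product p-prime ps-prime p∉ p∣ = p∉ (factorisationHasAllPrimeFactors p-prime p∣ ps-prime)

  prime∤⇒coprime : ∀ {p m} → Prime p → ¬ (p ∣ m) → Coprime p m
  prime∤⇒coprime p-prime p∤m (d∣p , d∣m) with prime⇒irreducible p-prime d∣p
  ... | inj₁ d≡1 = d≡1
  ... | inj₂ refl = ⊥-elim (p∤m d∣m)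

  product-unique-primes-∣ : ∀ {L m} → All Prime L → Unique L → All (_∣ m) L → product L ∣ m
  product-unique-primes-∣ [] [] [] = 1∣ _
  product-unique-primes-∣ {p ∷ L} {m} (hp ∷ hL) (p∉L ∷ uL) (divides c refl ∷ dL) =
    subst (p * product L ∣_) (*-comm p c) (*-monoʳ-∣ p (product-unique-primes-∣ hL uL (All.tabulate λ p′∈ →
      divides-cofactor (All.lookup hL p′∈) (All.lookup p∉L p′∈) (All.lookup dL p′∈))))
    where
    divides-cofactor : ∀ {p′} → Prime p′ → p ≢ p′ → p′ ∣ c * p → p′ ∣ c
    divides-cofactor hp′ ne d with euclidsLemma c p hp′ d
    ... | inj₁ h = h
    ... | inj₂ h = ⊥-elim (ne (sym (prime-∣-prime hp′ hp h)))

  -- The subset products of `L`. For distinct primes they are exactly the divisors of `product L`,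
  -- all of them square-free, which turns the count `W` into a power of 2.
  subproducts : List ℕ → List ℕ
  subproducts [] = 1 ∷ []
  subproducts (p ∷ L) = subproducts L ++ map (p *_) (subproducts L)

  length-subproducts : ∀ L → length (subproducts L) ≡ 2 ^ length L
  length-subproducts [] = refl
  length-subproducts (p ∷ L) = trans (Listₚ.length-++ (subproducts L)) (cong₂ _+_ (length-subproducts L)
    (trans (Listₚ.length-map (p *_) (subproducts L)) (trans (length-subproducts L) (sym (+-identityʳ _)))))

  subproducts-∣ : ∀ L {d} → d ∈ subproducts L → d ∣ product L
  subproducts-∣ [] (here refl) = 1∣ 1
  subproducts-∣ (p ∷ L) d∈ with ∈-++⁻ (subproducts L) d∈
  ... | inj₁ h = ∣n⇒∣m*n p (subproducts-∣ L h)
  ... | inj₂ h with ∈-map⁻ (p *_) h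
  ...   | e , e∈ , refl = *-monoʳ-∣ p (subproducts-∣ L e∈)

  subproducts-unique : ∀ {L} → All Prime L → Unique L → Unique (subproducts L)
  subproducts-unique [] [] = [] ∷ []
  subproducts-unique {p ∷ L} (hp ∷ hL) (p∉L ∷ uL) = Uniqueₚ.++⁺ (subproducts-unique hL uL)
    (Uniqueₚ.map⁺ (λ {x} {y} → *-cancelˡ-≡ x y p {{prime⇒nonZero hp}}) (subproducts-unique hL uL)) disjoint
    where
    disjoint : ∀ {d} → d ∈ subproducts L × d ∈ map (p *_) (subproducts L) → ⊥
    disjoint (d∈ , d∈′) with ∈-map⁻ (p *_) d∈′
    ... | e , _ , refl = prime∤product hp hL (Allₚ.All¬⇒¬Any p∉L) (∣-trans (m∣m*n e) (subproducts-∣ L d∈))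

  ∣-product⇒∈-subproducts : ∀ {L d} → All Prime L → d ∣ product L → d ∈ subproducts L
  ∣-product⇒∈-subproducts {[]} [] d∣1 = here (∣1⇒≡1 d∣1)
  ∣-product⇒∈-subproducts {p ∷ L} {d} (hp ∷ hL) d∣ with p ∣? d
  ... | yes (divides e refl) = ∈-++⁺ʳ (subproducts L) (subst (_∈ map (p *_) (subproducts L)) (*-comm p e)
          (∈-map⁺ (p *_) (∣-product⇒∈-subproducts hL (*-cancelˡ-∣ p {{prime⇒nonZero hp}} (subst (_∣ p * product L) (*-comm e p) d∣)))))
  ... | no p∤d = ∈-++⁺ˡ (∣-product⇒∈-subproducts hL (coprime-divisor (Coprimality.sym (prime∤⇒coprime hp p∤d)) d∣))

  prime²∤product : ∀ {L p} → All Prime L → Unique L → Prime p → ¬ (p * p ∣ product L)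
  prime²∤product {[]} {p} [] [] hp d = ¬prime[1] (subst Prime (∣1⇒≡1 (∣-trans (m∣m*n {p} p) d)) hp)
  prime²∤product {a ∷ L} {p} (ha ∷ hL) (a∉L ∷ uL) hp d with a ≟ p
  ... | yes refl = prime∤product ha hL (Allₚ.All¬⇒¬Any a∉L) (*-cancelˡ-∣ a {{prime⇒nonZero ha}} d)
  ... | no a≢p = prime²∤product hL uL hp (coprime-divisor (Coprimality.sym (prime∤⇒coprime ha a∤p²)) d)
    where
    a∤p² : ¬ (a ∣ p * p)
    a∤p² h with euclidsLemma p p ha h
    ... | inj₁ h′ = a≢p (prime-∣-prime ha hp h′)
    ... | inj₂ h′ = a≢p (prime-∣-prime ha hp h′)

  -- In the numerical hypothesis `W` of the core has a positive sign and `W` of its part in `Q` a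
  -- negative one, so a lower bound here and the upper bound `W-product≤2^length` suffice.
  2^length≤W : ∀ {k L} → k ≢ 0 → All Prime L → Unique L → All (_∣ k) L → 2 ^ length L ≤ W k
  2^length≤W {k} {L} k≢0 hL uL L∣k = ≤-trans (≤-reflexive (sym (length-subproducts L)))
    (unique-⊆⇒length≤ (subproducts-unique hL uL) member)
    where
    instance
      k-nonZero : NonZero k
      k-nonZero = ≢-nonZero k≢0
    member : ∀ {d} → d ∈ subproducts L → d ∈ filter (λ d → (1 ≤? d) ×-dec ((d ∣? k) ×-dec squareFree? d)) (upTo (suc k))
    member {d} d∈ = ∈-filter⁺ (λ d → (1 ≤? d) ×-dec ((d ∣? k) ×-dec squareFree? d)) (∈-upTo⁺ (s≤s (∣⇒≤ d∣k)))
      (n≢0⇒n>0 (λ { refl → k≢0 (0∣⇒≡0 d∣k) }) , d∣k , All.universal squareFree (upTo (suc d)))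
      where
      d∣k : d ∣ k
      d∣k = ∣-trans (subproducts-∣ L d∈) (product-unique-primes-∣ hL uL L∣k)
      squareFree : ∀ i → ¬ ((2 ≤ i) × (i * i ∣ d))
      squareFree i (2≤i , i²∣d) with ∃-prime-divisor i (λ { refl → case0 2≤i }) (λ { refl → case1 2≤i })
        where
        case0 : ¬ (2 ≤ 0)
        case0 ()
        case1 : ¬ (2 ≤ 1)
        case1 (s≤s ())
      ... | p , hp , p∣i = prime²∤product hL uL hp (∣-trans (*-pres-∣ p∣i p∣i) (∣-trans i²∣d (subproducts-∣ L d∈)))

  W-product≤2^length : ∀ {L} → All Prime L → W (product L) ≤ 2 ^ length L
  W-product≤2^length {L} hL = ≤-trans (unique-⊆⇒length≤ (Uniqueₚ.filter⁺ P? (Uniqueₚ.upTo⁺ (suc (product L)))) (λ d∈ →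
      ∣-product⇒∈-subproducts hL (proj₁ (proj₂ (proj₂ (∈-filter⁻ P? {xs = upTo (suc (product L))} d∈))))))
    (≤-reflexive (length-subproducts L))
    where
    P? = λ d → (1 ≤? d) ×-dec ((d ∣? product L) ×-dec squareFree? d)

  primeDivisors : ℕ → List ℕ
  primeDivisors k = filter (λ p → prime? p ×-dec (p ∣? k)) (upTo (suc k))

  primeDivisors-unique : ∀ k → Unique (primeDivisors k)
  primeDivisors-unique k = Uniqueₚ.filter⁺ (λ p → prime? p ×-dec (p ∣? k)) (Uniqueₚ.upTo⁺ (suc k))

  ∈-primeDivisors⁻ : ∀ {k p} → p ∈ primeDivisors k → Prime p × p ∣ k
  ∈-primeDivisors⁻ {k} p∈ = proj₂ (∈-filter⁻ (λ p → prime? p ×-dec (p ∣? k)) {xs = upTo (suc k)} p∈)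

  ∈-primeDivisors⁺ : ∀ {k p} → k ≢ 0 → Prime p → p ∣ k → p ∈ primeDivisors k
  ∈-primeDivisors⁺ {k} k≢0 hp d = ∈-filter⁺ (λ p → prime? p ×-dec (p ∣? k)) (∈-upTo⁺ (s≤s (∣⇒≤ {{≢-nonZero k≢0}} d))) (hp , d)

  W-radBoth≤ : ∀ k Q → W (radBoth k Q) ≤ 2 ^ length (filter (_∣? Q) (primeDivisors k))
  W-radBoth≤ k Q = ≤-trans (W-product≤2^length (All.tabulate (λ p∈ → proj₁ (property p∈))))
    (^-monoʳ-≤ 2 (unique-⊆⇒length≤ (Uniqueₚ.filter⁺ P? (Uniqueₚ.upTo⁺ (suc k))) (λ p∈ →
      ∈-filter⁺ (_∣? Q) (∈-filter⁺ (λ p → prime? p ×-dec (p ∣? k)) (proj₁ (∈-filter⁻ P? {xs = upTo (suc k)} p∈))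
        (proj₁ (property p∈) , proj₁ (proj₂ (property p∈)))) (proj₂ (proj₂ (property p∈))))))
    where
    P? = λ p → prime? p ×-dec ((p ∣? k) ×-dec (p ∣? Q))
    property : ∀ {p} → p ∈ filter P? (upTo (suc k)) → Prime p × p ∣ k × p ∣ Q
    property p∈ = proj₂ (∈-filter⁻ P? {xs = upTo (suc k)} p∈)

  -- The sum `1 + q + ... + q^(n-1)` in Horner form, which permits induction on `Qof` without
  -- division.
  geometric : ℕ → ℕ → ℕ
  geometric q zero = 0
  geometric q (suc n) = 1 + q * geometric q n

  geometric-* : ∀ a n → suc (geometric (suc a) n * a) ≡ suc a ^ n
  geometric-* a zero = refl
  geometric-* a (suc n) = trans (lem a (geometric (suc a) n)) (cong (suc a *_) (geometric-* a n))
    where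
    lem : ∀ a g → suc ((1 + suc a * g) * a) ≡ suc a * suc (g * a)
    lem = ℕ-Solver.solve-∀

  Qof≡geometric : ∀ q n → 2 ≤ q → Qof q n ≡ geometric q n
  Qof≡geometric (suc (suc a)) n _ = trans (cong (λ m → divℕ (m ∸ 1) (suc a)) (sym (geometric-* (suc a) n)))
    (m*n/n≡m (geometric (suc (suc a)) n) (suc a))
  Qof≡geometric (suc zero) n (s≤s ())

  Qof-* : ∀ q n → 2 ≤ q → Qof q n * (q ∸ 1) ≡ q ^ n ∸ 1
  Qof-* q@(suc a) n 2≤q = trans (cong (_* a) (Qof≡geometric q n 2≤q)) (cong (_∸ 1) (geometric-* a n))

  -- Modulo `p` one has `q = -1`, so the sum alternates and its odd number of terms leaves 1. Going
  -- two terms at a time, `1 + q` drops out and `q * q` is prime to `p`. Serves for `p = 2`, and for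
  -- `p = 3` when `q = 5`.
  ∤geometric : ∀ {p q} → Prime p → p ∣ 1 + q → ¬ (p ∣ q) → ∀ j → ¬ (p ∣ geometric q (1 + j * 2))
  ∤geometric {p} {q} hp p∣1+q p∤q zero d = ¬prime[1] (subst Prime (∣1⇒≡1 (subst (p ∣_) (cong suc (*-zeroʳ q)) d)) hp)
  ∤geometric {p} {q} hp p∣1+q p∤q (suc j) d with euclidsLemma q _ hp (∣m+n∣m⇒∣n (subst (p ∣_) (lem q (geometric q (1 + j * 2))) d) p∣1+q)
    where
    lem : ∀ q g → 1 + q * (1 + q * g) ≡ (1 + q) + q * (q * g)
    lem = ℕ-Solver.solve-∀
  ... | inj₁ h = p∤q h
  ... | inj₂ h with euclidsLemma q _ hp h
  ...   | inj₁ h′ = p∤q h′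
  ...   | inj₂ h′ = ∤geometric hp p∣1+q p∤q j h′

  product≥7^length : ∀ {L} → All (7 ≤_) L → 7 ^ length L ≤ product L
  product≥7^length [] = ≤-refl
  product≥7^length (h ∷ hs) = *-mono-≤ h (product≥7^length hs)

  -- The factor 20 is `16 * 5 / 4`: 16 from squaring `4 * 2 ^ m`, and `5 / 4` from `4 Q = 5 P - 1`
  -- in `16*4^<5^`. From the exponent 8 on there is ample room.
  20*4^≤7^ : ∀ m → 8 ≤ m → 20 * 4 ^ m ≤ 7 ^ m
  20*4^≤7^ m 8≤m = subst (λ m → 20 * 4 ^ m ≤ 7 ^ m) (m∸n+n≡m 8≤m) (go (m ∸ 8))
    where
    go : ∀ j → 20 * 4 ^ (j + 8) ≤ 7 ^ (j + 8)
    go zero = ≤ᵇ⇒≤ (20 * 4 ^ 8) (7 ^ 8) _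
    go (suc j) = ≤-trans (≤-reflexive (swap (4 ^ (j + 8)))) (*-mono-≤ 4≤7 (go j))
      where
      swap : ∀ x → 20 * (4 * x) ≡ 4 * (20 * x)
      swap x = trans (sym (*-assoc 20 4 x)) (*-assoc 4 20 x)
      4≤7 : 4 ≤ 7
      4≤7 = ≤ᵇ⇒≤ 4 7 _

  length-filter-all-but-one : ∀ {P : ℕ → Set} (P? : ∀ x → Dec (P x)) a {L} → Unique L → All (λ x → ¬ P x → x ≡ a) L →
    length L ≤ suc (length (filter P? L))
  length-filter-all-but-one P? a [] [] = z≤n
  length-filter-all-but-one {P} P? a {x ∷ L} (x∉L ∷ uL) (h ∷ hs) with P? x
  ... | yes _ = s≤s (length-filter-all-but-one P? a uL hs)
  ... | no ¬px = s≤s (≤-reflexive (cong length (sym (Listₚ.filter-all P? (All.zipWith (λ (ne , k) → holds ne k) (x∉L , hs))))))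
    where
    holds : ∀ {y} → x ≢ y → (¬ P y → y ≡ a) → P y
    holds {y} ne k with P? y
    ... | yes p = p
    ... | no ¬p = ⊥-elim (ne (trans (h ¬px) (sym (k ¬p))))

  prime-∣*4 : ∀ {p} Q → Prime p → p ∣ Q * 4 → p ∣ Q ⊎ p ≡ 2
  prime-∣*4 Q hp d with euclidsLemma Q 4 hp d
  ... | inj₁ d′ = inj₁ d′
  ... | inj₂ d′ with euclidsLemma 2 2 hp d′
  ...   | inj₁ d″ = inj₂ (prime-∣-prime hp prime[2] d″)
  ...   | inj₂ d″ = inj₂ (prime-∣-prime hp prime[2] d″)

  -- For `q = 5`: `P` stands for `q ^ (n - 1)` and `m` for the number of primes, all at least 7,
  -- that divide `Q`.
  16*4^<5^ : ∀ {m Q P} → 8 ≤ m → 7 ^ m ≤ Q → Q * 4 ≡ 5 * P ∸ 1 → 1 ≤ P → 16 * 4 ^ m < P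
  16*4^<5^ {m} {Q} {P} 8≤m 7^m≤Q Q*4≡ 1≤P = *-cancelˡ-< 5 (16 * 4 ^ m) P (begin-strict
    5 * (16 * 4 ^ m) ≡⟨ sym (*-assoc 5 16 (4 ^ m)) ⟩
    80 * 4 ^ m       ≡⟨ *-assoc 4 20 (4 ^ m) ⟩
    4 * (20 * 4 ^ m) ≤⟨ *-monoʳ-≤ 4 (≤-trans (20*4^≤7^ m 8≤m) 7^m≤Q) ⟩
    4 * Q            ≡⟨ trans (*-comm 4 Q) Q*4≡ ⟩
    5 * P ∸ 1        <⟨ ∸-monoʳ-< {5 * P} (s≤s z≤n) (*-mono-≤ {1} {5} (s≤s z≤n) 1≤P) ⟩
    5 * P            ∎)
    where open ≤-Reasoning

  square≤16*4^ : ∀ {a m} → a ≤ 4 * 2 ^ m → a * a ≤ 16 * 4 ^ m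
  square≤16*4^ {a} {m} h = ≤-trans (*-mono-≤ h h) (≤-reflexive (trans (square (2 ^ m)) (cong (16 *_)
    (trans (sym (^-distribˡ-+-* 2 m m)) (trans (cong (λ t → 2 ^ (m + t)) (sym (+-identityʳ m))) (sym (^-*-assoc 2 2 m)))))))
    where
    square : ∀ a → (4 * a) * (4 * a) ≡ 16 * (a * a)
    square = ℕ-Solver.solve-∀

  -- Absorption identity, from Pascal's rule. For `n + 1 = p` it shows that `p` divides a binomial
  -- coefficient times its lower index, and Euclid's lemma removes that index.
  [n+1]C[k+1]*[k+1] : ∀ n k → (suc n C suc k) * suc k ≡ suc n * (n C k)
  [n+1]C[k+1]*[k+1] zero zero = refl
  [n+1]C[k+1]*[k+1] zero (suc k) = refl
  [n+1]C[k+1]*[k+1] (suc n) zero = trans (*-identityʳ _) (trans (nC1≡n (suc (suc n))) (sym (*-identityʳ _)))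
  [n+1]C[k+1]*[k+1] (suc n) (suc k) = begin
    (suc (suc n) C suc (suc k)) * suc (suc k) ≡⟨ cong (_* suc (suc k)) (sym (nCk+nC[k+1]≡[n+1]C[k+1] (suc n) (suc k))) ⟩
    (a + b) * suc (suc k) ≡⟨ lem a b k ⟩
    a * suc k + a + b * suc (suc k) ≡⟨ cong₂ (λ u v → u + a + v) ([n+1]C[k+1]*[k+1] n k) ([n+1]C[k+1]*[k+1] n (suc k)) ⟩
    suc n * c + a + suc n * d ≡⟨ lem₂ n c d a ⟩
    suc n * (c + d) + a ≡⟨ cong (λ u → suc n * u + a) (nCk+nC[k+1]≡[n+1]C[k+1] n k) ⟩
    suc n * a + a ≡⟨ +-comm (suc n * a) a ⟩
    suc (suc n) * a ∎
    where
    open ≡-Reasoning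
    a = suc n C suc k
    b = suc n C suc (suc k)
    c = n C k
    d = n C suc k
    lem : ∀ a b k → (a + b) * suc (suc k) ≡ a * suc k + a + b * suc (suc k)
    lem = ℕ-Solver.solve-∀
    lem₂ : ∀ n c d a → suc n * c + a + suc n * d ≡ suc n * (c + d) + a
    lem₂ = ℕ-Solver.solve-∀

  prime∣C : ∀ {p} → Prime p → ∀ k → 1 ≤ k → k < p → p ∣ (p C k)
  prime∣C {suc p} pr (suc k) _ k<p with euclidsLemma (suc p C suc k) (suc k) pr
    (divides (p C k) (trans ([n+1]C[k+1]*[k+1] p k) (*-comm (suc p) (p C k))))
  ... | inj₁ h = h
  ... | inj₂ h = ⊥-elim (<⇒≱ k<p (∣⇒≤ h))

-- Rational inequalities and counting by indicator sums

module Estimates where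

  open import Data.Fin.Permutation using (Permutation; permutation)
  open import Data.Maybe using (nothing)
  open import Data.Nat.Combinatorics using (nCn≡1)
  open import Data.Rational using (_+_; _*_; _-_; -_; _≤_; _<_)
  open import Data.Rational.Properties hiding (_≟_)
  import Data.Rational.Unnormalised as ℚᵘ
  import Data.Rational.Unnormalised.Properties as ℚᵘₚ
  open import Function.Bundles using (Inverse)
  open import Algebra.Properties.Semiring.Sum (CommutativeRing.semiring +-*-commutativeRing) public
    using (sum; sum-cong-≗; ∑-distrib-+; ∑-comm; sum-permute; *-distribˡ-sum)
  open Arithmetic using (2≤prime; 2≤primePower; ∃-prime-divisor; prime∤product; prime∤⇒coprime; prime∣C)

  ℚ-ring : AlmostCommutativeRing 0ℓ 0ℓ
  ℚ-ring = fromCommutativeRing +-*-commutativeRing (λ x → dec⇒maybe (0ℚ ℚₚ.≟ x))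

  0≤-+ : ∀ {x y} → 0ℚ ≤ x → 0ℚ ≤ y → 0ℚ ≤ x + y
  0≤-+ p q = ≤-trans (≤-reflexive (sym (+-identityˡ 0ℚ))) (+-mono-≤ p q)

  0≤-* : ∀ {x y} → 0ℚ ≤ x → 0ℚ ≤ y → 0ℚ ≤ x * y
  0≤-* {x} {y} p q = ≤-trans (≤-reflexive (sym (*-zeroʳ x)))
    (*-monoˡ-≤-nonNeg x {{ℚ.nonNegative p}} q)

  0<-* : ∀ {x y} → 0ℚ < x → 0ℚ < y → 0ℚ < x * y
  0<-* {x} {y} p q = <-respˡ-≡ (*-zeroʳ x) (*-monoʳ-<-pos x {{ℚ.positive p}} q)

  ≤⇒0≤- : ∀ {x y} → x ≤ y → 0ℚ ≤ y - x
  ≤⇒0≤- {x} {y} p = ≤-trans (≤-reflexive (sym (+-inverseʳ x))) (+-monoˡ-≤ (- x) p)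

  ≤-by : ∀ {x y z} → 0ℚ ≤ z → z ≡ y - x → x ≤ y
  ≤-by {x} {y} {z} p e = ≤-trans (≤-reflexive (sym (+-identityˡ x)))
    (≤-trans (+-monoˡ-≤ x p) (≤-reflexive (trans (cong (_+ x) e) (lem y x))))
    where
    lem : ∀ y x → (y - x) + x ≡ y
    lem = solve-∀ ℚ-ring

  <⇒0<- : ∀ {x y} → x < y → 0ℚ < y - x
  <⇒0<- {x} {y} p = subst (_< y - x) (+-inverseʳ x) (+-monoˡ-< (- x) p)

  0≤-sq : ∀ x → 0ℚ ≤ x * x
  0≤-sq x with ≤-total 0ℚ x
  ... | inj₁ p = 0≤-* p p
  ... | inj₂ p = ≤-trans (0≤-* q q) (≤-reflexive (lem x))
    where
    q : 0ℚ ≤ - x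
    q = neg-antimono-≤ p
    lem : ∀ x → (- x) * (- x) ≡ x * x
    lem = solve-∀ ℚ-ring

  *-mono-≤ : ∀ {a b c d} → 0ℚ ≤ a → 0ℚ ≤ d → a ≤ b → c ≤ d → a * c ≤ b * d
  *-mono-≤ {a} {b} {c} {d} 0≤a 0≤d p q = ≤-trans
    (*-monoˡ-≤-nonNeg a {{ℚ.nonNegative 0≤a}} q) (*-monoʳ-≤-nonNeg d {{ℚ.nonNegative 0≤d}} p)

  *-monoˡ-≤ : ∀ {a} → 0ℚ ≤ a → ∀ {b c} → b ≤ c → a * b ≤ a * c
  *-monoˡ-≤ {a} h = *-monoˡ-≤-nonNeg a {{ℚ.nonNegative h}}

  *-cancel-≤ : ∀ {a b c} → 0ℚ < a → a * b ≤ a * c → b ≤ c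
  *-cancel-≤ {a} h = *-cancelˡ-≤-pos a {{ℚ.positive h}}

  0<-+ˡ : ∀ {x y} → 0ℚ < x → 0ℚ ≤ y → 0ℚ < x + y
  0<-+ˡ {x} {y} p q = <-≤-trans p (≤-trans (≤-reflexive (sym (+-identityʳ x))) (+-monoʳ-≤ x q))

  0<-⇒< : ∀ {x y} → 0ℚ < y - x → x < y
  0<-⇒< {x} {y} p = subst₂ _<_ (+-identityˡ x) (lem y x) (+-monoˡ-< x p)
    where
    lem : ∀ y x → (y - x) + x ≡ y
    lem = solve-∀ ℚ-ring

  square-cancel-≤ : ∀ {x c} → 0ℚ ≤ c → x * x ≤ c * c → x ≤ c
  square-cancel-≤ {x} {c} h p with x ≤? c
  ... | yes q = q
  ... | no x≰c = ⊥-elim (<-irrefl refl (<-≤-trans (0<-⇒< (subst (0ℚ <_) (lem x c) pos)) p))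
    where
    c<x : c < x
    c<x = ≰⇒> x≰c
    pos : 0ℚ < (x - c) * (x + c)
    pos = 0<-* (<⇒0<- c<x) (0<-+ˡ (≤-<-trans h c<x) h)
    lem : ∀ x c → (x - c) * (x + c) ≡ x * x - c * c
    lem = solve-∀ ℚ-ring

  square-cancel-≥ : ∀ {x c} → 0ℚ ≤ c → x * x ≤ c * c → - c ≤ x
  square-cancel-≥ {x} {c} h p = subst (- c ≤_) (neg-neg x)
    (neg-antimono-≤ (square-cancel-≤ h (≤-trans (≤-reflexive (lem x)) p)))
    where
    lem : ∀ x → (- x) * (- x) ≡ x * x
    lem = solve-∀ ℚ-ring
    neg-neg : ∀ x → - (- x) ≡ x
    neg-neg = solve-∀ ℚ-ring

  ℕ→ℚ-+ : ∀ m n → ℕ→ℚ (m ℕ.+ n) ≡ ℕ→ℚ m + ℕ→ℚ n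
  ℕ→ℚ-+ m n = toℚᵘ-injective (ℚᵘₚ.≃-trans (toℚᵘ-fromℚᵘ (ℚᵘ.mkℚᵘ (ℤ.+ (m ℕ.+ n)) 0))
    (ℚᵘₚ.≃-sym (ℚᵘₚ.≃-trans (toℚᵘ-homo-+ (ℕ→ℚ m) (ℕ→ℚ n))
      (ℚᵘₚ.≃-trans (ℚᵘₚ.+-cong (toℚᵘ-fromℚᵘ (ℚᵘ.mkℚᵘ (ℤ.+ m) 0)) (toℚᵘ-fromℚᵘ (ℚᵘ.mkℚᵘ (ℤ.+ n) 0)))
        (ℚᵘ.*≡* (cong (ℤ._* ℤ.1ℤ) (cong₂ ℤ._+_ (ℤₚ.*-identityʳ (ℤ.+ m)) (ℤₚ.*-identityʳ (ℤ.+ n)))))))))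

  ℕ→ℚ-* : ∀ m n → ℕ→ℚ (m ℕ.* n) ≡ ℕ→ℚ m * ℕ→ℚ n
  ℕ→ℚ-* m n = toℚᵘ-injective (ℚᵘₚ.≃-trans (toℚᵘ-fromℚᵘ (ℚᵘ.mkℚᵘ (ℤ.+ (m ℕ.* n)) 0))
    (ℚᵘₚ.≃-sym (ℚᵘₚ.≃-trans (toℚᵘ-homo-* (ℕ→ℚ m) (ℕ→ℚ n))
      (ℚᵘₚ.≃-trans (ℚᵘₚ.*-cong (toℚᵘ-fromℚᵘ (ℚᵘ.mkℚᵘ (ℤ.+ m) 0)) (toℚᵘ-fromℚᵘ (ℚᵘ.mkℚᵘ (ℤ.+ n) 0)))
        (ℚᵘ.*≡* (cong (ℤ._* ℤ.1ℤ) (sym (ℤₚ.pos-* m n))))))))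

  ℕ→ℚ-mono-≤ : ∀ {m n} → m ℕ.≤ n → ℕ→ℚ m ≤ ℕ→ℚ n
  ℕ→ℚ-mono-≤ {m} {n} p = toℚᵘ-cancel-≤
    (ℚᵘₚ.≤-trans (ℚᵘₚ.≤-reflexive (toℚᵘ-fromℚᵘ (ℚᵘ.mkℚᵘ (ℤ.+ m) 0)))
    (ℚᵘₚ.≤-trans (ℚᵘ.*≤* (ℤₚ.*-monoʳ-≤-nonNeg ℤ.1ℤ (ℤ.+≤+ p)))
      (ℚᵘₚ.≤-reflexive (ℚᵘₚ.≃-sym (toℚᵘ-fromℚᵘ (ℚᵘ.mkℚᵘ (ℤ.+ n) 0))))))

  0≤ℕ→ℚ : ∀ n → 0ℚ ≤ ℕ→ℚ n
  0≤ℕ→ℚ n = ℕ→ℚ-mono-≤ {0} {n} ℕ.z≤n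

  ℕ→ℚ-suc : ∀ n → ℕ→ℚ (suc n) ≡ 1ℚ + ℕ→ℚ n
  ℕ→ℚ-suc n = ℕ→ℚ-+ 1 n

  0<1 : 0ℚ < 1ℚ
  0<1 = ℚ.*<* (ℤ.+<+ (ℕ.s≤s ℕ.z≤n))

  0≤1 : 0ℚ ≤ 1ℚ
  0≤1 = <⇒≤ 0<1

  ℕ→ℚ-pos : ∀ n → 0ℚ < ℕ→ℚ (suc n)
  ℕ→ℚ-pos n = subst (0ℚ <_) (sym (ℕ→ℚ-suc n)) (0<-+ˡ 0<1 (0≤ℕ→ℚ n))

  ℕ→ℚ-mono-< : ∀ {m n} → m ℕ.< n → ℕ→ℚ m < ℕ→ℚ n
  ℕ→ℚ-mono-< {m} {n} p = <-≤-trans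
    (0<-⇒< (subst (0ℚ <_) (trans (lem (ℕ→ℚ m)) (cong (_- ℕ→ℚ m) (sym (ℕ→ℚ-suc m)))) 0<1))
    (ℕ→ℚ-mono-≤ p)
    where
    lem : ∀ x → 1ℚ ≡ (1ℚ + x) - x
    lem = solve-∀ ℚ-ring

  ℕ→ℚ-cancel-< : ∀ {m n} → ℕ→ℚ m < ℕ→ℚ n → m ℕ.< n
  ℕ→ℚ-cancel-< p = ℕₚ.≰⇒> (λ q → <-irrefl refl (<-≤-trans p (ℕ→ℚ-mono-≤ q)))

  recip-inverse : ∀ n → 1 ℕ.≤ n → ℕ→ℚ n * recip n ≡ 1ℚ
  recip-inverse (suc n) _ = toℚᵘ-injective
    (ℚᵘₚ.≃-trans (toℚᵘ-homo-* (ℕ→ℚ (suc n)) (recip (suc n)))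
    (ℚᵘₚ.≃-trans (ℚᵘₚ.*-cong (toℚᵘ-fromℚᵘ (ℚᵘ.mkℚᵘ (ℤ.+ suc n) 0)) (toℚᵘ-fromℚᵘ (ℚᵘ.mkℚᵘ (ℤ.+ 1) n)))
      (ℚᵘ.*≡* (cong ℤ.+_ (trans (ℕₚ.*-identityʳ _) (trans (ℕₚ.*-identityʳ (suc n)) (sym (trans (ℕₚ.*-identityˡ _) (cong suc (ℕₚ.+-identityʳ n))))))))))

  0≤recip : ∀ n → 0ℚ ≤ recip n
  0≤recip zero = ≤-refl
  0≤recip (suc n) = toℚᵘ-cancel-≤ (ℚᵘₚ.≤-trans (ℚᵘ.*≤* (ℤ.+≤+ ℕ.z≤n))
    (ℚᵘₚ.≤-reflexive (ℚᵘₚ.≃-sym (toℚᵘ-fromℚᵘ (ℚᵘ.mkℚᵘ (ℤ.+ 1) n)))))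

  -- Iverson bracket. Every cardinality below is a sum of these, so that counting becomes algebra in
  -- `ℚ`.
  ⟦_⟧ : ∀ {p} {P : Set p} → Dec P → ℚ
  ⟦ yes _ ⟧ = 1ℚ
  ⟦ no _ ⟧ = 0ℚ

  ⟦⟧-yes : ∀ {p} {P : Set p} (d : Dec P) → P → ⟦ d ⟧ ≡ 1ℚ
  ⟦⟧-yes (yes _) _ = refl
  ⟦⟧-yes (no n) p = ⊥-elim (n p)

  ⟦⟧-no : ∀ {p} {P : Set p} (d : Dec P) → ¬ P → ⟦ d ⟧ ≡ 0ℚ
  ⟦⟧-no (yes p) n = ⊥-elim (n p)
  ⟦⟧-no (no _) _ = refl

  ⟦⟧-cong : ∀ {p q} {P : Set p} {Q : Set q} (d : Dec P) (e : Dec Q) → (P → Q) → (Q → P) → ⟦ d ⟧ ≡ ⟦ e ⟧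
  ⟦⟧-cong (yes p) e f g = sym (⟦⟧-yes e (f p))
  ⟦⟧-cong (no n) e f g = sym (⟦⟧-no e (λ q → n (g q)))

  0≤⟦⟧ : ∀ {p} {P : Set p} (d : Dec P) → 0ℚ ≤ ⟦ d ⟧
  0≤⟦⟧ (yes _) = 0≤1
  0≤⟦⟧ (no _) = ≤-refl

  ⟦⟧≤1 : ∀ {p} {P : Set p} (d : Dec P) → ⟦ d ⟧ ≤ 1ℚ
  ⟦⟧≤1 (yes _) = ≤-refl
  ⟦⟧≤1 (no _) = 0≤1

  ⟦⟧-mono : ∀ {p q} {P : Set p} {Q : Set q} (d : Dec P) (e : Dec Q) → (P → Q) → ⟦ d ⟧ ≤ ⟦ e ⟧
  ⟦⟧-mono (yes p) e f = ≤-reflexive (sym (⟦⟧-yes e (f p)))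
  ⟦⟧-mono (no n) e f = 0≤⟦⟧ e

  ⟦⟧-guard : ∀ {p} {P : Set p} (d : Dec P) {x y : ℚ} → (P → x ≡ y) → ⟦ d ⟧ * x ≡ ⟦ d ⟧ * y
  ⟦⟧-guard (yes p) f = cong (1ℚ *_) (f p)
  ⟦⟧-guard (no _) {x} {y} f = trans (*-zeroˡ x) (sym (*-zeroˡ y))

  sum-mono : ∀ {n} {f g : Fin n → ℚ} → (∀ i → f i ≤ g i) → sum f ≤ sum g
  sum-mono {zero} h = ≤-refl
  sum-mono {suc n} h = +-mono-≤ (h Fin.zero) (sum-mono (λ i → h (Fin.suc i)))

  sum-const : ∀ n c → sum {n} (λ _ → c) ≡ ℕ→ℚ n * c
  sum-const zero c = sym (*-zeroˡ c)
  sum-const (suc n) c = trans (cong (c +_) (sum-const n c))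
    (trans (lem c (ℕ→ℚ n)) (cong (_* c) (sym (ℕ→ℚ-suc n))))
    where
    lem : ∀ c n → c + n * c ≡ (1ℚ + n) * c
    lem = solve-∀ ℚ-ring

  sum-single : ∀ {n} (a : Fin n) (f : Fin n → ℚ) → sum (λ i → ⟦ i Finₚ.≟ a ⟧ * f i) ≡ f a
  sum-single {suc n} Fin.zero f = trans
    (cong₂ _+_ (*-identityˡ (f Fin.zero))
      (trans (sum-cong-≗ {n} (λ i → *-zeroˡ (f (Fin.suc i)))) (trans (sum-const n 0ℚ) (*-zeroʳ (ℕ→ℚ n)))))
    (+-identityʳ _)
  sum-single {suc n} (Fin.suc a) f = trans
    (cong₂ _+_ (*-zeroˡ (f Fin.zero))
      (trans (sum-cong-≗ (λ i → cong (_* f (Fin.suc i)) (⟦⟧-cong (Fin.suc i Finₚ.≟ Fin.suc a) (i Finₚ.≟ a) Finₚ.suc-injective (cong Fin.suc))))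
        (sum-single a (λ i → f (Fin.suc i)))))
    (+-identityˡ _)

  -- Summation and arithmetic in a finite field

  module Field (F : FiniteField) where
    open FiniteField F public

    F-commutativeRing : CommutativeRing 0ℓ 0ℓ
    F-commutativeRing = record { isCommutativeRing = isCommutativeRing }

    F-ring : AlmostCommutativeRing 0ℓ 0ℓ
    F-ring = fromCommutativeRing F-commutativeRing (λ _ → nothing)

    element : Fin card → Carrier
    element = Inverse.to enum

    index : Carrier → Fin card
    index = Inverse.from enum

    element-index : ∀ x → element (index x) ≡ x
    element-index x = Inverse.inverseˡ enum refl

    index-element : ∀ i → index (element i) ≡ i
    index-element i = Inverse.inverseʳ enum refl

    infix 4 _≟F_
    _≟F_ : (x y : Carrier) → Dec (x ≡ y)
    x ≟F y = map′ (λ e → trans (sym (element-index x)) (trans (cong element e) (element-index y))) (cong index)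
      (index x Finₚ.≟ index y)

    any? : ∀ {P : Carrier → Set} → (∀ x → Dec (P x)) → Dec (Σ Carrier P)
    any? {P} P? = map′ (λ (i , p) → element i , p) (λ (x , p) → index x , subst P (sym (element-index x)) p)
      (Finₚ.any? (λ i → P? (element i)))

    ∑ : (Carrier → ℚ) → ℚ
    ∑ f = sum (λ i → f (element i))

    ∑-cong : ∀ {f g} → (∀ x → f x ≡ g x) → ∑ f ≡ ∑ g
    ∑-cong h = sum-cong-≗ (λ i → h (element i))

    ∑-+ : ∀ f g → ∑ (λ x → f x + g x) ≡ ∑ f + ∑ g
    ∑-+ f g = ∑-distrib-+ (λ i → f (element i)) (λ i → g (element i))

    ∑-*ˡ : ∀ c f → ∑ (λ x → c * f x) ≡ c * ∑ f
    ∑-*ˡ c f = sym (*-distribˡ-sum c (λ i → f (element i)))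

    ∑-- : ∀ f g → ∑ (λ x → f x - g x) ≡ ∑ f - ∑ g
    ∑-- f g = trans (∑-cong (λ x → cong (f x +_) (lem (g x))))
      (trans (∑-+ f (λ x → (- 1ℚ) * g x))
        (cong (∑ f +_) (trans (∑-*ˡ (- 1ℚ) g) (sym (lem (∑ g))))))
      where
      lem : ∀ x → - x ≡ (- 1ℚ) * x
      lem = solve-∀ ℚ-ring

    ∑-swap : ∀ (f : Carrier → Carrier → ℚ) → ∑ (λ x → ∑ (f x)) ≡ ∑ (λ y → ∑ (λ x → f x y))
    ∑-swap f = ∑-comm (λ i j → f (element i) (element j))

    ∑-mono : ∀ {f g} → (∀ x → f x ≤ g x) → ∑ f ≤ ∑ g
    ∑-mono h = sum-mono (λ i → h (element i))

    ∑-const : ∀ c → ∑ (λ _ → c) ≡ ℕ→ℚ card * c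
    ∑-const = sum-const card

    ∑-zero : ∑ (λ _ → 0ℚ) ≡ 0ℚ
    ∑-zero = trans (∑-const 0ℚ) (*-zeroʳ (ℕ→ℚ card))

    0≤∑ : ∀ {f} → (∀ x → 0ℚ ≤ f x) → 0ℚ ≤ ∑ f
    0≤∑ h = ≤-trans (≤-reflexive (sym ∑-zero)) (∑-mono h)

    element-permutation : (φ ψ : Carrier → Carrier) → (∀ x → φ (ψ x) ≡ x) → (∀ x → ψ (φ x) ≡ x) → Permutation card card
    element-permutation φ ψ φψ ψφ = permutation (λ i → index (φ (element i))) (λ i → index (ψ (element i)))
      (λ i → trans (cong (λ y → index (φ y)) (element-index _)) (trans (cong index (φψ _)) (index-element i)))
      (λ i → trans (cong (λ y → index (ψ y)) (element-index _)) (trans (cong index (ψφ _)) (index-element i)))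

    ∑-bijection : ∀ f (φ ψ : Carrier → Carrier) → (∀ x → φ (ψ x) ≡ x) → (∀ x → ψ (φ x) ≡ x) →
      ∑ (λ x → f (φ x)) ≡ ∑ f
    ∑-bijection f φ ψ φψ ψφ = trans
      (sum-cong-≗ (λ i → cong f (sym (element-index (φ (element i))))))
      (sym (sum-permute (λ i → f (element i)) (element-permutation φ ψ φψ ψφ)))

    ∑-single : ∀ a f → ∑ (λ x → ⟦ x ≟F a ⟧ * f x) ≡ f a
    ∑-single a f = trans
      (sum-cong-≗ (λ i → cong (_* f (element i))
        (⟦⟧-cong (element i ≟F a) (i Finₚ.≟ index a) (λ e → trans (sym (index-element i)) (cong index e))
          (λ e → trans (cong element e) (element-index a)))))
      (trans (sum-single (index a) (λ i → f (element i))) (cong f (element-index a)))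

    ∑-single-1 : ∀ a → ∑ (λ x → ⟦ x ≟F a ⟧) ≡ 1ℚ
    ∑-single-1 a = trans (∑-cong (λ x → sym (*-identityʳ ⟦ x ≟F a ⟧))) (∑-single a (λ _ → 1ℚ))

    term≤∑ : ∀ {f} → (∀ x → 0ℚ ≤ f x) → ∀ a → f a ≤ ∑ f
    term≤∑ {f} h a = ≤-trans (≤-reflexive (sym (∑-single a f)))
      (∑-mono (λ x → ≤-trans (*-monoʳ-≤-nonNeg (f x) {{ℚ.nonNegative (h x)}} (⟦⟧≤1 (x ≟F a)))
        (≤-reflexive (*-identityˡ (f x)))))

    -- Turns a global count into pointwise equality: a termwise inequality whose totals agree has no
    -- gap anywhere. Applied to trace fibres, to roots of unity and to square roots.
    ∑≤0⇒≡0 : ∀ {f} → (∀ x → 0ℚ ≤ f x) → ∑ f ≤ 0ℚ → ∀ a → f a ≡ 0ℚ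
    ∑≤0⇒≡0 h s a = ≤-antisym (≤-trans (term≤∑ h a) s) (h a)

    module FR = CommutativeRing F-commutativeRing

    open import Tactic.RingSolver.NonReflective F-ring using ()
      renaming (solve to F-solve; _⊜_ to _:=_; _⊕_ to _:+_; _⊗_ to _:*_; ⊝_ to :-_; Κ to :K) public

    open import Algebra.Properties.Ring (CommutativeRing.ring F-commutativeRing) public
      using (-‿involutive; -‿distribˡ-*; -‿distribʳ-*; x+x≈x⇒x≈0)
      renaming (+-cancelˡ to +F-cancelˡ; +-cancelʳ to +F-cancelʳ)

    difference-0 : ∀ {x y} → x +F -F y ≡ 0F → x ≡ y
    difference-0 {x} {y} e = +F-cancelʳ (-F y) x y (trans e (sym (FR.-‿inverseʳ y)))

    infix 8 _⁻¹
    -- Extended by `0F ⁻¹ ≡ 0F`, which makes it an involution of the whole field; sums over all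
    -- elements can then contain inverses without side conditions.
    _⁻¹ : Carrier → Carrier
    x ⁻¹ with x ≟F 0F
    ... | yes _ = 0F
    ... | no x≢0 = proj₁ (inverse x x≢0)

    *-⁻¹ : ∀ {x} → x ≢ 0F → x *F x ⁻¹ ≡ 1F
    *-⁻¹ {x} x≢0 with x ≟F 0F
    ... | yes e = ⊥-elim (x≢0 e)
    ... | no n = proj₂ (inverse x n)

    ⁻¹-* : ∀ {x} → x ≢ 0F → x ⁻¹ *F x ≡ 1F
    ⁻¹-* {x} x≢0 = trans (FR.*-comm (x ⁻¹) x) (*-⁻¹ x≢0)

    0⁻¹ : 0F ⁻¹ ≡ 0F
    0⁻¹ with 0F ≟F 0F
    ... | yes _ = refl
    ... | no n = ⊥-elim (n refl)

    *F-cancelˡ : ∀ {x y z} → x ≢ 0F → x *F y ≡ x *F z → y ≡ z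
    *F-cancelˡ {x} {y} {z} x≢0 e = trans (sym (lem y)) (trans (cong (x ⁻¹ *F_) e) (lem z))
      where
      lem : ∀ w → x ⁻¹ *F (x *F w) ≡ w
      lem w = trans (sym (FR.*-assoc _ x w)) (trans (cong (_*F w) (⁻¹-* x≢0)) (FR.*-identityˡ w))

    *-≡0 : ∀ {x y} → x *F y ≡ 0F → x ≡ 0F ⊎ y ≡ 0F
    *-≡0 {x} {y} e with x ≟F 0F
    ... | yes p = inj₁ p
    ... | no n = inj₂ (*F-cancelˡ n (trans e (sym (FR.zeroʳ x))))

    *-≢0 : ∀ {x y} → x ≢ 0F → y ≢ 0F → x *F y ≢ 0F
    *-≢0 p q e with *-≡0 e
    ... | inj₁ h = p h
    ... | inj₂ h = q h

    *-≢0ˡ : ∀ {x y} → x *F y ≢ 0F → x ≢ 0F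
    *-≢0ˡ {y = y} p refl = p (FR.zeroˡ y)

    ⁻¹-≢0 : ∀ {x} → x ≢ 0F → x ⁻¹ ≢ 0F
    ⁻¹-≢0 {x} x≢0 e = 0≢1 (trans (sym (FR.zeroʳ x)) (trans (cong (x *F_) (sym e)) (*-⁻¹ x≢0)))

    ⁻¹-unique : ∀ {x y} → x *F y ≡ 1F → y ≡ x ⁻¹
    ⁻¹-unique {x} {y} e = *F-cancelˡ x≢0 (trans e (sym (*-⁻¹ x≢0)))
      where
      x≢0 : x ≢ 0F
      x≢0 refl = 0≢1 (trans (sym (FR.zeroˡ y)) e)

    ⁻¹-involutive : ∀ x → (x ⁻¹) ⁻¹ ≡ x
    ⁻¹-involutive x with x ≟F 0F
    ... | yes refl = 0⁻¹
    ... | no n = sym (⁻¹-unique (trans (FR.*-comm _ x) (proj₂ (inverse x n))))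

    *-⁻¹-cancelˡ : ∀ {x} → x ≢ 0F → ∀ y → x *F (x ⁻¹ *F y) ≡ y
    *-⁻¹-cancelˡ {x} h y = trans (sym (FR.*-assoc x _ y)) (trans (cong (_*F y) (*-⁻¹ h)) (FR.*-identityˡ y))

    ⁻¹-*-cancelˡ : ∀ {x} → x ≢ 0F → ∀ y → x ⁻¹ *F (x *F y) ≡ y
    ⁻¹-*-cancelˡ {x} h y = trans (sym (FR.*-assoc _ x y)) (trans (cong (_*F y) (⁻¹-* h)) (FR.*-identityˡ y))

    *-⁻¹-cancelʳ : ∀ {x} → x ≢ 0F → ∀ y → (y *F x ⁻¹) *F x ≡ y
    *-⁻¹-cancelʳ {x} h y = trans (FR.*-assoc y _ x) (trans (cong (y *F_) (⁻¹-* h)) (FR.*-identityʳ y))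

    ∑-scale : ∀ {a} → a ≢ 0F → ∀ f → ∑ (λ x → f (a *F x)) ≡ ∑ f
    ∑-scale {a} h f = ∑-bijection f (a *F_) (a ⁻¹ *F_) (*-⁻¹-cancelˡ h) (⁻¹-*-cancelˡ h)

    ∑-scaleʳ : ∀ {a} → a ≢ 0F → ∀ f → ∑ (λ x → f (x *F a)) ≡ ∑ f
    ∑-scaleʳ {a} h f = trans (∑-cong (λ x → cong f (FR.*-comm x a))) (∑-scale h f)

    ^F-+ : ∀ x m n → x ^F (m ℕ.+ n) ≡ x ^F m *F x ^F n
    ^F-+ x zero n = sym (FR.*-identityˡ _)
    ^F-+ x (suc m) n = trans (cong (x *F_) (^F-+ x m n)) (sym (FR.*-assoc x _ _))

    1^F : ∀ n → 1F ^F n ≡ 1F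
    1^F zero = refl
    1^F (suc n) = trans (FR.*-identityˡ _) (1^F n)

    0^F : ∀ n → 1 ℕ.≤ n → 0F ^F n ≡ 0F
    0^F (suc n) _ = FR.zeroˡ _

    *-^F : ∀ x y n → (x *F y) ^F n ≡ x ^F n *F y ^F n
    *-^F x y zero = sym (FR.*-identityˡ _)
    *-^F x y (suc n) = trans (cong ((x *F y) *F_) (*-^F x y n)) (lem x y (x ^F n) (y ^F n))
      where
      lem : ∀ a b c d → (a *F b) *F (c *F d) ≡ (a *F c) *F (b *F d)
      lem = F-solve 4 (λ a b c d → (a :* b) :* (c :* d) := (a :* c) :* (b :* d)) refl

    ^F-* : ∀ x m n → x ^F (m ℕ.* n) ≡ (x ^F m) ^F n
    ^F-* x zero n = sym (1^F n)
    ^F-* x (suc m) n = trans (^F-+ x n (m ℕ.* n)) (trans (cong (x ^F n *F_) (^F-* x m n)) (sym (*-^F x (x ^F m) n)))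

    ^F-*′ : ∀ x m n → x ^F (m ℕ.* n) ≡ (x ^F n) ^F m
    ^F-*′ x m n = trans (cong (x ^F_) (ℕₚ.*-comm m n)) (^F-* x n m)

    ^F-≢0 : ∀ {x} → x ≢ 0F → ∀ n → x ^F n ≢ 0F
    ^F-≢0 h zero e = 0≢1 (sym e)
    ^F-≢0 h (suc n) = *-≢0 h (^F-≢0 h n)

    ^F-⁻¹ : ∀ {x} n → x ≢ 0F → (x ⁻¹) ^F n ≡ (x ^F n) ⁻¹
    ^F-⁻¹ {x} n h = ⁻¹-unique (trans (sym (*-^F x _ n)) (trans (cong (_^F n) (*-⁻¹ h)) (1^F n)))

    0≢⇒⁻¹-^1 : ∀ {x} n → x ≢ 0F → x ^F n ≡ 1F → (x ⁻¹) ^F n ≡ 1F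
    0≢⇒⁻¹-^1 {x} n h e = trans (^F-⁻¹ n h) (sym (⁻¹-unique (trans (FR.*-identityʳ _) e)))

  -- Monic polynomials and the number of their roots

  module FieldPolynomials (F : FiniteField) where
    open Field F

    -- Coefficients from the constant term upwards with an implicit leading 1, so that the length of
    -- the list is the degree.
    evalMonic : List Carrier → Carrier → Carrier
    evalMonic [] x = 1F
    evalMonic (c ∷ cs) x = c +F x *F evalMonic cs x

    -- Synthetic division `P(x) = (x - r) D(x) + P(r)` with the negative term moved to the left.
    -- Each coefficient of `D` is the value at `r` of what remains of `P`.
    divide-root : ∀ c cs r → Σ (List Carrier) (λ ds → length ds ≡ length cs ×
      (∀ x → evalMonic (c ∷ cs) x +F r *F evalMonic ds x ≡ x *F evalMonic ds x +F evalMonic (c ∷ cs) r))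
    divide-root c [] r = [] , refl , λ x → lem c x r
      where
      lem : ∀ c x r → (c +F x *F 1F) +F r *F 1F ≡ x *F 1F +F (c +F r *F 1F)
      lem c x r = cong₃ (FR.*-identityʳ x) (FR.*-identityʳ r)
        where
        lem′ : ∀ c x r → (c +F x) +F r ≡ x +F (c +F r)
        lem′ = F-solve 3 (λ c x r → ((c :+ x) :+ r) := (x :+ (c :+ r))) refl
        cong₃ : ∀ {x′ r′} → x′ ≡ x → r′ ≡ r → (c +F x′) +F r′ ≡ x′ +F (c +F r′)
        cong₃ refl refl = lem′ c x r
    divide-root c (c′ ∷ cs) r with divide-root c′ cs r
    ... | es , len , h = evalMonic (c′ ∷ cs) r ∷ es , cong suc len , λ x →
      trans (lem₁ c x r (evalMonic (c′ ∷ cs) x) (evalMonic (c′ ∷ cs) r) (evalMonic es x))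
        (trans (cong (λ w → (c +F r *F evalMonic (c′ ∷ cs) r) +F x *F w) (h x))
          (lem₂ c x r (evalMonic (c′ ∷ cs) r) (evalMonic es x)))
      where
      lem₁ : ∀ c x r P Pr e → (c +F x *F P) +F r *F (Pr +F x *F e) ≡ (c +F r *F Pr) +F x *F (P +F r *F e)
      lem₁ = F-solve 6 (λ c x r P Pr e → ((c :+ x :* P) :+ r :* (Pr :+ x :* e)) := ((c :+ r :* Pr) :+ x :* (P :+ r :* e))) refl
      lem₂ : ∀ c x r Pr e → (c +F r *F Pr) +F x *F (x *F e +F Pr) ≡ x *F (Pr +F x *F e) +F (c +F r *F Pr)
      lem₂ = F-solve 5 (λ c x r Pr e → ((c :+ r :* Pr) :+ x :* (x :* e :+ Pr)) := (x :* (Pr :+ x :* e) :+ (c :+ r :* Pr))) refl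

    evalMonic-roots : ∀ m cs → length cs ≡ m → ∑ (λ x → ⟦ evalMonic cs x ≟F 0F ⟧) ≤ ℕ→ℚ m
    evalMonic-roots zero [] _ = ≤-reflexive (trans (∑-cong (λ x → ⟦⟧-no (1F ≟F 0F) (λ e → 0≢1 (sym e)))) ∑-zero)
    evalMonic-roots (suc m) (c ∷ cs) len with any? (λ x → evalMonic (c ∷ cs) x ≟F 0F)
    ... | no none = ≤-trans (≤-reflexive (trans (∑-cong (λ x → ⟦⟧-no (evalMonic (c ∷ cs) x ≟F 0F) (λ e → none (x , e)))) ∑-zero))
            (0≤ℕ→ℚ (suc m))
    ... | yes (r , root) with divide-root c cs r
    ...   | ds , len′ , h = ≤-trans (∑-mono split)
      (≤-trans (≤-reflexive (∑-+ (λ x → ⟦ x ≟F r ⟧) (λ x → ⟦ evalMonic ds x ≟F 0F ⟧)))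
      (≤-trans (+-mono-≤ (≤-reflexive (∑-single-1 r)) (evalMonic-roots m ds (trans len′ (ℕₚ.suc-injective len))))
        (≤-reflexive (sym (ℕ→ℚ-suc m)))))
      where
      quotient-root : ∀ x → evalMonic (c ∷ cs) x ≡ 0F → x ≢ r → evalMonic ds x ≡ 0F
      quotient-root x e x≢r with evalMonic ds x ≟F 0F
      ... | yes z = z
      ... | no n = ⊥-elim (x≢r (*F-cancelˡ n (trans (FR.*-comm _ x) (trans (sym xg≡rg) (FR.*-comm r _)))))
        where
        xg≡rg : r *F evalMonic ds x ≡ x *F evalMonic ds x
        xg≡rg = trans (sym (FR.+-identityˡ _)) (trans (cong (_+F r *F evalMonic ds x) (sym e))
          (trans (h x) (trans (cong (x *F evalMonic ds x +F_) root) (FR.+-identityʳ _))))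
      split : ∀ x → ⟦ evalMonic (c ∷ cs) x ≟F 0F ⟧ ≤ ⟦ x ≟F r ⟧ + ⟦ evalMonic ds x ≟F 0F ⟧
      split x with evalMonic (c ∷ cs) x ≟F 0F
      ... | no _ = 0≤-+ (0≤⟦⟧ (x ≟F r)) (0≤⟦⟧ (evalMonic ds x ≟F 0F))
      ... | yes e with x ≟F r
      ...   | yes _ = ≤-trans (≤-reflexive (sym (+-identityʳ 1ℚ))) (+-monoʳ-≤ 1ℚ (0≤⟦⟧ (evalMonic ds x ≟F 0F)))
      ...   | no x≢r = ≤-reflexive (trans (sym (⟦⟧-yes (evalMonic ds x ≟F 0F) (quotient-root x e x≢r))) (sym (+-identityˡ _)))

    Monic : ℕ → (Carrier → Carrier) → Set
    Monic m f = Σ (List Carrier) (λ cs → length cs ≡ m × (∀ x → f x ≡ evalMonic cs x))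

    monic-roots : ∀ {m f} → Monic m f → ∑ (λ x → ⟦ f x ≟F 0F ⟧) ≤ ℕ→ℚ m
    monic-roots {f = f} (cs , refl , h) = ≤-trans
      (≤-reflexive (∑-cong (λ x → ⟦⟧-cong (f x ≟F 0F) (evalMonic cs x ≟F 0F) (trans (sym (h x))) (trans (h x)))))
      (evalMonic-roots _ cs refl)

    monic-^ : ∀ m → Monic m (_^F m)
    monic-^ m = replicate m 0F , Listₚ.length-replicate m , go m
      where
      go : ∀ m x → x ^F m ≡ evalMonic (replicate m 0F) x
      go zero x = refl
      go (suc m) x = trans (cong (x *F_) (go m x)) (sym (FR.+-identityˡ _))

    monic-+monomial : ∀ {m f} j c → j ℕ.< m → Monic m f → Monic m (λ x → f x +F c *F x ^F j)
    monic-+monomial j c j<m (cs , refl , h) with go j cs j<m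
      where
      go : ∀ j cs → j ℕ.< length cs → Σ (List Carrier) (λ ds → length ds ≡ length cs ×
        (∀ x → evalMonic cs x +F c *F x ^F j ≡ evalMonic ds x))
      go zero (b ∷ cs) _ = b +F c ∷ cs , refl , λ x →
        trans (cong ((b +F x *F evalMonic cs x) +F_) (FR.*-identityʳ c)) (lem b (x *F evalMonic cs x) c)
        where
        lem : ∀ b y c → (b +F y) +F c ≡ (b +F c) +F y
        lem = F-solve 3 (λ b y c → ((b :+ y) :+ c) := ((b :+ c) :+ y)) refl
      go (suc j) (b ∷ cs) (s≤s l) with go j cs l
      ... | ds , len , e = b ∷ ds , cong suc len , λ x →
        trans (lem b x (evalMonic cs x) c (x ^F j)) (cong (λ w → b +F x *F w) (e x))
        where
        lem : ∀ b x y c z → (b +F x *F y) +F c *F (x *F z) ≡ b +F x *F (y +F c *F z)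
        lem = F-solve 5 (λ b x y c z → ((b :+ x :* y) :+ c :* (x :* z)) := (b :+ x :* (y :+ c :* z))) refl
    ... | ds , len , e = ds , len , λ x → trans (cong (_+F c *F x ^F j) (h x)) (e x)

    monic-- : ∀ {m f} b → 1 ℕ.≤ m → Monic m f → Monic m (λ x → f x +F -F b)
    monic-- {f = f} b 1≤m M with monic-+monomial 0 (-F b) 1≤m M
    ... | cs , len , e = cs , len , λ x → trans (cong (f x +F_) (sym (FR.*-identityʳ (-F b)))) (e x)

    monic-fibre : ∀ {m f} b → 1 ℕ.≤ m → Monic m f → ∑ (λ x → ⟦ f x ≟F b ⟧) ≤ ℕ→ℚ m
    monic-fibre {m} {f} b 1≤m M = ≤-trans
      (∑-mono (λ x → ⟦⟧-mono (f x ≟F b) (f x +F -F b ≟F 0F) (λ { refl → FR.-‿inverseʳ b })))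
      (monic-roots {m} (monic-- b 1≤m M))

    fixed-roots : ∀ m → 2 ℕ.≤ m → ∑ (λ x → ⟦ x ^F m ≟F x ⟧) ≤ ℕ→ℚ m
    fixed-roots m 2≤m = ≤-trans
      (∑-mono (λ x → ⟦⟧-mono (x ^F m ≟F x) (x ^F m +F (-F 1F) *F x ^F 1 ≟F 0F)
        (λ e → trans (cong₂ _+F_ e (lem x)) (FR.-‿inverseʳ x))))
      (monic-roots {m} (monic-+monomial {m} 1 (-F 1F) 2≤m (monic-^ m)))
      where
      lem : ∀ x → (-F 1F) *F (x *F 1F) ≡ -F x
      lem x = trans (cong ((-F 1F) *F_) (FR.*-identityʳ x)) (trans (sym (-‿distribˡ-* 1F x)) (cong -F_ (FR.*-identityˡ x)))

  -- Fermat's theorem and the Frobenius map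

  module FiniteFieldPowers (F : FiniteField) where
    open Field F
    open FieldPolynomials F

    import Algebra.Properties.CommutativeMonoid.Sum FR.+-commutativeMonoid as S+
    import Algebra.Properties.CommutativeMonoid.Sum FR.*-commutativeMonoid as S*
    import Algebra.Properties.Semiring.Mult FR.semiring as Mult
    import Algebra.Properties.Semiring.Exp FR.semiring as Exp
    import Algebra.Properties.CommutativeSemiring.Binomial FR.commutativeSemiring as Binomial

    -- Translation by 1 permutes the field, so the sum of all elements does not change when `card`
    -- copies of 1 are added.
    card×1 : card Mult.× 1F ≡ 0F
    card×1 = +F-cancelˡ (S+.sum element) (card Mult.× 1F) 0F (sym (trans (FR.+-identityʳ _)
      (trans (S+.sum-permute element π)
      (trans (S+.sum-cong-≗ (λ i → element-index (element i +F 1F)))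
      (trans (S+.∑-distrib-+ element (λ _ → 1F)) (cong (S+.sum element +F_) (S+.sum-replicate card)))))))
      where
      π = element-permutation (_+F 1F) (_+F (-F 1F))
        (λ x → trans (FR.+-assoc x _ 1F) (trans (cong (x +F_) (FR.-‿inverseˡ 1F)) (FR.+-identityʳ x)))
        (λ x → trans (FR.+-assoc x 1F _) (trans (cong (x +F_) (FR.-‿inverseʳ 1F)) (FR.+-identityʳ x)))

    private
      product-const : ∀ n x → S*.sum {n} (λ _ → x) ≡ x ^F n
      product-const zero x = refl
      product-const (suc n) x = cong (x *F_) (product-const n x)

      product-punctured : ∀ {n} (t : Fin n → Carrier) x i₀ → t i₀ ≡ 1F → (∀ i → i ≢ i₀ → t i ≡ x) → S*.sum t ≡ x ^F (n ∸ 1)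
      product-punctured {suc n} t x i₀ e h = trans (S*.sum-remove {i = i₀} t)
        (trans (cong₂ _*F_ e (trans (S*.sum-cong-≗ (λ i → h _ (Finₚ.punchInᵢ≢i i₀ i))) (product-const n x)))
          (FR.*-identityˡ _))

      product-≢0 : ∀ {n} (t : Fin n → Carrier) → (∀ i → t i ≢ 0F) → S*.sum t ≢ 0F
      product-≢0 {zero} t h e = 0≢1 (sym e)
      product-≢0 {suc n} t h = *-≢0 (h Fin.zero) (product-≢0 (λ i → t (Fin.suc i)) (λ i → h (Fin.suc i)))

      -- A product over `Fin card` cannot skip 0; this puts the factor 1 there, so that only the
      -- units count.
      nonzeroOr1 : Carrier → Carrier → Carrier
      nonzeroOr1 x y with y ≟F 0F
      ... | yes _ = 1F
      ... | no _ = x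

      nonzeroOr1-0 : ∀ {x y} → y ≡ 0F → nonzeroOr1 x y ≡ 1F
      nonzeroOr1-0 {x} {y} e with y ≟F 0F
      ... | yes _ = refl
      ... | no n = ⊥-elim (n e)

      nonzeroOr1-≢0 : ∀ {x y} → y ≢ 0F → nonzeroOr1 x y ≡ x
      nonzeroOr1-≢0 {x} {y} n with y ≟F 0F
      ... | yes e = ⊥-elim (n e)
      ... | no _ = refl

      nonzeroOr1-≢0′ : ∀ y → nonzeroOr1 y y ≢ 0F
      nonzeroOr1-≢0′ y with y ≟F 0F
      ... | yes _ = λ e → 0≢1 (sym e)
      ... | no n = n

    -- Multiplication by `x` permutes the units, so their product absorbs the factor
    -- `x ^F (card ∸ 1)`; being nonzero, it cancels.
    fermat : ∀ {x} → x ≢ 0F → x ^F (card ∸ 1) ≡ 1F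
    fermat {x} x≢0 = trans (sym prodʰ) (*F-cancelˡ prodᵍ≢0 (trans (FR.*-comm prodᵍ prodh) (trans prod-eq (sym (FR.*-identityʳ prodᵍ)))))
      where
      g h : Fin card → Carrier
      g i = nonzeroOr1 (element i) (element i)
      h i = nonzeroOr1 x (element i)
      prodᵍ prodh : Carrier
      prodᵍ = S*.sum g
      prodh = S*.sum h
      prodʰ : prodh ≡ x ^F (card ∸ 1)
      prodʰ = product-punctured h x (index 0F) (nonzeroOr1-0 (element-index 0F))
        (λ i i≢ → nonzeroOr1-≢0 (λ e → i≢ (trans (sym (index-element i)) (cong index e))))
      prodᵍ≢0 : prodᵍ ≢ 0F
      prodᵍ≢0 = product-≢0 g (λ i → nonzeroOr1-≢0′ (element i))
      scaled : ∀ y → nonzeroOr1 x y *F nonzeroOr1 y y ≡ nonzeroOr1 (x *F y) (x *F y)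
      scaled y with y ≟F 0F
      ... | yes refl = trans (FR.*-identityˡ 1F) (sym (nonzeroOr1-0 (FR.zeroʳ x)))
      ... | no y≢0 = sym (nonzeroOr1-≢0 (*-≢0 x≢0 y≢0))
      π = element-permutation (x *F_) (x ⁻¹ *F_) (*-⁻¹-cancelˡ x≢0) (⁻¹-*-cancelˡ x≢0)
      prod-eq : prodh *F prodᵍ ≡ prodᵍ
      prod-eq = trans (sym (S*.∑-distrib-+ h g)) (trans (S*.sum-cong-≗ (λ i → trans (scaled (element i))
        (cong (λ y → nonzeroOr1 y y) (sym (element-index _))))) (sym (S*.sum-permute g π)))

    1≤card : 1 ℕ.≤ card
    1≤card = ℕₚ.≤-trans (s≤s z≤n) (Finₚ.toℕ<n (index 0F))

    ^F-card : ∀ x → x ^F card ≡ x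
    ^F-card x with x ≟F 0F
    ... | yes refl = 0^F card 1≤card
    ... | no x≢0 = trans (cong (x ^F_) (sym (ℕₚ.m+[n∸m]≡n 1≤card))) (trans (cong (x *F_) (fermat x≢0)) (FR.*-identityʳ x))

    module Frobenius (p e : ℕ) (p-prime : Prime p) (card≡ : card ≡ p ^ e) where

      private
        ^-×1 : ∀ e → (p ^ e) Mult.× 1F ≡ (p Mult.× 1F) ^F e
        ^-×1 zero = FR.+-identityʳ 1F
        ^-×1 (suc e) = trans (Mult.×1-homo-* p (p ^ e)) (cong ((p Mult.× 1F) *F_) (^-×1 e))

      -- `card` copies of 1 make the `e`-th power of `p` copies of 1. The former is 0, so the latter
      -- cannot be a unit.
      characteristic : p Mult.× 1F ≡ 0F
      characteristic with p Mult.× 1F ≟F 0F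
      ... | yes h = h
      ... | no h = ⊥-elim (^F-≢0 h e (trans (sym (^-×1 e)) (trans (cong (Mult._× 1F) (sym card≡)) card×1)))

      multiple≡0 : ∀ {m} x → p ∣ m → m Mult.× x ≡ 0F
      multiple≡0 x (divides c refl) = trans (sym (Mult.×-assocˡ x c p))
        (trans (cong (c Mult.×_) p×x≡0) (×0 c))
        where
        p×x≡0 : p Mult.× x ≡ 0F
        p×x≡0 = trans (cong (p Mult.×_) (sym (FR.*-identityˡ x))) (trans (sym (Mult.×-assoc-* p 1F x))
          (trans (cong (_*F x) characteristic) (FR.zeroˡ x)))
        ×0 : ∀ c → c Mult.× 0F ≡ 0F
        ×0 zero = refl
        ×0 (suc c) = trans (FR.+-identityˡ _) (×0 c)

      private
        exp≡^F : ∀ x n → x Exp.^ n ≡ x ^F n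
        exp≡^F x zero = refl
        exp≡^F x (suc n) = cong (x *F_) (exp≡^F x n)

        frobenius-suc : ∀ p′ → p ≡ suc p′ → ∀ x y → (x +F y) ^F p ≡ x ^F p +F y ^F p
        frobenius-suc p′ refl x y = trans (sym (exp≡^F (x +F y) p)) (trans (Binomial.theorem p x y)
          (trans (cong (first +F_) (trans (S+.sum-init-last (λ i → term (Fin.suc i)))
            (cong (_+F last) (trans (S+.sum-cong-≗ middle≡0) (S+.sum-replicate-zero p′)))))
          (trans (cong₂ (λ u v → u +F (0F +F v)) first≡ last≡)
            (trans (cong (y ^F p +F_) (FR.+-identityˡ _)) (FR.+-comm _ _)))))
          where
          term : Fin (suc p) → Carrier
          term = Binomial.binomialTerm x y p
          first last : Carrier
          first = term Fin.zero
          last = term (Fin.suc (Fin.fromℕ p′))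
          first≡ : first ≡ y ^F p
          first≡ = trans (FR.+-identityʳ _) (trans (FR.*-identityˡ _) (exp≡^F y p))
          last≡ : last ≡ x ^F p
          last≡ rewrite Finₚ.toℕ-fromℕ p′ | nCn≡1 (suc p′) | ℕₚ.n∸n≡0 p′ =
            trans (FR.+-identityʳ _) (trans (FR.*-identityʳ _) (exp≡^F x (suc p′)))
          middle≡0 : ∀ i → term (Fin.suc (Fin.inject₁ i)) ≡ 0F
          middle≡0 i = multiple≡0 _ (prime∣C p-prime (suc (toℕ (Fin.inject₁ i))) (s≤s z≤n)
            (s≤s (subst (ℕ._< p′) (sym (Finₚ.toℕ-inject₁ i)) (Finₚ.toℕ<n i))))

      frobenius : ∀ x y → (x +F y) ^F p ≡ x ^F p +F y ^F p
      frobenius = frobenius-suc (p ∸ 1) (sym (ℕₚ.m+[n∸m]≡n (ℕ.>-nonZero⁻¹ p {{prime⇒nonZero p-prime}})))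

      frobenius-^ : ∀ m x y → (x +F y) ^F (p ^ m) ≡ x ^F (p ^ m) +F y ^F (p ^ m)
      frobenius-^ zero x y = trans (FR.*-identityʳ _) (sym (cong₂ _+F_ (FR.*-identityʳ x) (FR.*-identityʳ y)))
      frobenius-^ (suc m) x y = begin
        (x +F y) ^F (p ℕ.* p ^ m)                ≡⟨ ^F-* (x +F y) p (p ^ m) ⟩
        ((x +F y) ^F p) ^F (p ^ m)               ≡⟨ cong (_^F (p ^ m)) (frobenius x y) ⟩
        (x ^F p +F y ^F p) ^F (p ^ m)            ≡⟨ frobenius-^ m (x ^F p) (y ^F p) ⟩
        (x ^F p) ^F (p ^ m) +F (y ^F p) ^F (p ^ m) ≡⟨ sym (cong₂ _+F_ (^F-* x p (p ^ m)) (^F-* y p (p ^ m))) ⟩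
        x ^F (p ℕ.* p ^ m) +F y ^F (p ℕ.* p ^ m) ∎
        where open ≡-Reasoning

  -- The trace and the size of its fibres

  module Trace (F : FiniteField) (q n : ℕ) (q-primePower : IsPrimePower q) (1≤n : 1 ℕ.≤ n)
    (card≡ : FiniteField.card F ≡ q ^ n) where

    open Field F public
    open FieldPolynomials F public
    open FiniteFieldPowers F public

    private
      p m : ℕ
      p = proj₁ q-primePower
      m = proj₁ (proj₂ q-primePower)
      p-prime : Prime p
      p-prime = proj₁ (proj₂ (proj₂ q-primePower))
      q≡ : q ≡ p ^ m
      q≡ = proj₂ (proj₂ (proj₂ (proj₂ q-primePower)))

    2≤q : 2 ℕ.≤ q
    2≤q = 2≤primePower q-primePower

    ^F-q-+ : ∀ x y → (x +F y) ^F q ≡ x ^F q +F y ^F q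
    ^F-q-+ x y = subst (λ k → (x +F y) ^F k ≡ x ^F k +F y ^F k) (sym q≡)
      (Frobenius.frobenius-^ p (m ℕ.* n) p-prime
        (trans card≡ (trans (cong (_^ n) q≡) (ℕₚ.^-*-assoc p m n))) m x y)

    ^F-q^-+ : ∀ i x y → (x +F y) ^F (q ^ i) ≡ x ^F (q ^ i) +F y ^F (q ^ i)
    ^F-q^-+ zero x y = trans (FR.*-identityʳ _) (sym (cong₂ _+F_ (FR.*-identityʳ x) (FR.*-identityʳ y)))
    ^F-q^-+ (suc i) x y = trans (^F-* (x +F y) q (q ^ i)) (trans (cong (_^F (q ^ i)) (^F-q-+ x y))
      (trans (^F-q^-+ i (x ^F q) (y ^F q)) (sym (cong₂ _+F_ (^F-* x q (q ^ i)) (^F-* y q (q ^ i))))))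

    -- The copy of the field with `q` elements inside `F`, as the fixed points of the `q`-th power
    -- map. Its size is only determined in `subfieldSize≡q`.
    InSubfield : Carrier → Set
    InSubfield c = c ^F q ≡ c

    inSubfield? : ∀ c → Dec (InSubfield c)
    inSubfield? c = c ^F q ≟F c

    subfield-^q^ : ∀ {c} → InSubfield c → ∀ i → c ^F (q ^ i) ≡ c
    subfield-^q^ h zero = FR.*-identityʳ _
    subfield-^q^ {c} h (suc i) = trans (^F-* c q (q ^ i)) (trans (cong (_^F (q ^ i)) h) (subfield-^q^ h i))

    tr : Carrier → Carrier
    tr = Tr q n

    private
      sumF-+ : ∀ k f g → sumF k (λ i → f i +F g i) ≡ sumF k f +F sumF k g
      sumF-+ zero f g = sym (FR.+-identityˡ 0F)
      sumF-+ (suc k) f g = trans (cong (_+F (f k +F g k)) (sumF-+ k f g)) (lem (sumF k f) (sumF k g) (f k) (g k))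
        where
        lem : ∀ a b c d → (a +F b) +F (c +F d) ≡ (a +F c) +F (b +F d)
        lem = F-solve 4 (λ a b c d → ((a :+ b) :+ (c :+ d)) := ((a :+ c) :+ (b :+ d))) refl

      sumF-cong : ∀ k {f g : ℕ → Carrier} → (∀ i → f i ≡ g i) → sumF k f ≡ sumF k g
      sumF-cong zero h = refl
      sumF-cong (suc k) h = cong₂ _+F_ (sumF-cong k h) (h k)

      sumF-* : ∀ k c f → sumF k (λ i → c *F f i) ≡ c *F sumF k f
      sumF-* zero c f = sym (FR.zeroʳ c)
      sumF-* (suc k) c f = trans (cong (_+F c *F f k) (sumF-* k c f)) (sym (FR.distribˡ c _ _))

      sumF-shift : ∀ k (f : ℕ → Carrier) → f 0 +F sumF k (λ i → f (suc i)) ≡ sumF k f +F f k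
      sumF-shift zero f = FR.+-comm (f 0) 0F
      sumF-shift (suc k) f = trans (sym (FR.+-assoc _ _ _)) (cong (_+F f (suc k)) (sumF-shift k f))

    tr-+ : ∀ x y → tr (x +F y) ≡ tr x +F tr y
    tr-+ x y = trans (sumF-cong n (λ i → ^F-q^-+ i x y)) (sumF-+ n _ _)

    tr-* : ∀ {c} → InSubfield c → ∀ x → tr (c *F x) ≡ c *F tr x
    tr-* {c} h x = trans (sumF-cong n (λ i → trans (*-^F c x (q ^ i)) (cong (_*F x ^F (q ^ i)) (subfield-^q^ h i)))) (sumF-* n c _)

    tr-0 : tr 0F ≡ 0F
    tr-0 = x+x≈x⇒x≈0 _ (trans (sym (tr-+ 0F 0F)) (cong tr (FR.+-identityˡ 0F)))

    -- The `q`-th power moves each conjugate to the next, and `x ^F (q ^ n) ≡ x` closes the cycle.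
    tr-inSubfield : ∀ x → InSubfield (tr x)
    tr-inSubfield x = trans (powers n) (+F-cancelˡ (x ^F 1) _ _
      (trans (sumF-shift n (λ i → x ^F (q ^ i))) (trans (FR.+-comm _ _) (cong (_+F tr x) last≡))))
      where
      last≡ : x ^F (q ^ n) ≡ x ^F 1
      last≡ = trans (cong (x ^F_) (sym card≡)) (trans (^F-card x) (sym (FR.*-identityʳ x)))
      powers : ∀ k → sumF k (λ i → x ^F (q ^ i)) ^F q ≡ sumF k (λ i → x ^F (q ^ suc i))
      powers zero = 0^F q (ℕₚ.≤-trans (s≤s z≤n) 2≤q)
      powers (suc k) = trans (^F-q-+ _ _) (cong₂ _+F_ (powers k) (sym (^F-*′ x q (q ^ k))))

    tr-difference : ∀ x y → tr (x +F -F y) ≡ 0F → tr x ≡ tr y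
    tr-difference x y h = trans (cong tr (sym x-y+y)) (trans (tr-+ (x +F -F y) y) (trans (cong (_+F tr y) h) (FR.+-identityˡ _)))
      where
      x-y+y : (x +F -F y) +F y ≡ x
      x-y+y = trans (FR.+-assoc x _ y) (trans (cong (x +F_) (FR.-‿inverseˡ y)) (FR.+-identityʳ x))

    tr-difference′ : ∀ x y → tr x ≡ tr y → tr (x +F -F y) ≡ 0F
    tr-difference′ x y h = +F-cancelʳ (tr y) _ _ (trans (sym (tr-+ (x +F -F y) y)) (trans (cong tr x-y+y) (trans h (sym (FR.+-identityˡ _)))))
      where
      x-y+y : (x +F -F y) +F y ≡ x
      x-y+y = trans (FR.+-assoc x _ y) (trans (cong (x +F_) (FR.-‿inverseˡ y)) (FR.+-identityʳ x))

    M : ℕ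
    M = q ^ (n ∸ 1)

    1≤M : 1 ℕ.≤ M
    1≤M = ℕₚ.m^n>0 q {{ℕ.>-nonZero (ℕₚ.≤-trans (s≤s z≤n) 2≤q)}} (n ∸ 1)

    card≡q*M : card ≡ q ℕ.* M
    card≡q*M = trans card≡ (cong (q ^_) (sym (ℕₚ.m+[n∸m]≡n 1≤n)))

    monic-tr : Monic M tr
    monic-tr = go n 1≤n
      where
      partial : ∀ k j → j ℕ.≤ k → Monic (q ^ k) (λ x → sumF j (λ i → x ^F (q ^ i)) +F x ^F (q ^ k))
      partial k zero _ with monic-^ (q ^ k)
      ... | cs , len , e = cs , len , λ x → trans (FR.+-identityˡ _) (e x)
      partial k (suc j) j<k with monic-+monomial (q ^ j) 1F (ℕₚ.^-monoʳ-< q 2≤q j<k) (partial k j (ℕₚ.<⇒≤ j<k))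
      ... | cs , len , e = cs , len , λ x → trans (lem _ _ _) (e x)
        where
        lem : ∀ a b c → (a +F b) +F c ≡ (a +F c) +F 1F *F b
        lem a b c = trans (lem′ a b c) (cong ((a +F c) +F_) (sym (FR.*-identityˡ b)))
          where
          lem′ : ∀ a b c → (a +F b) +F c ≡ (a +F c) +F b
          lem′ = F-solve 3 (λ a b c → ((a :+ b) :+ c) := ((a :+ c) :+ b)) refl
      go : ∀ n → 1 ℕ.≤ n → Monic (q ^ (n ∸ 1)) (Tr q n)
      go (suc k) _ = partial k k ℕₚ.≤-refl

    fibre : Carrier → ℚ
    fibre b = ∑ (λ x → ⟦ tr x ≟F b ⟧)

    fibre≤M : ∀ b → fibre b ≤ ℕ→ℚ M
    fibre≤M b = monic-fibre b 1≤M monic-tr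

    private
      subfieldSize : ℚ
      subfieldSize = ∑ (λ b → ⟦ inSubfield? b ⟧)

      subfieldSize≤q : subfieldSize ≤ ℕ→ℚ q
      subfieldSize≤q = fixed-roots q 2≤q

      ∑fibres : ∑ (λ b → ⟦ inSubfield? b ⟧ * fibre b) ≡ ℕ→ℚ q * ℕ→ℚ M
      ∑fibres = begin
        ∑ (λ b → ⟦ inSubfield? b ⟧ * fibre b)
          ≡⟨ ∑-cong (λ b → sym (∑-*ˡ ⟦ inSubfield? b ⟧ (λ x → ⟦ tr x ≟F b ⟧))) ⟩
        ∑ (λ b → ∑ (λ x → ⟦ inSubfield? b ⟧ * ⟦ tr x ≟F b ⟧))
          ≡⟨ ∑-swap (λ b x → ⟦ inSubfield? b ⟧ * ⟦ tr x ≟F b ⟧) ⟩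
        ∑ (λ x → ∑ (λ b → ⟦ inSubfield? b ⟧ * ⟦ tr x ≟F b ⟧))
          ≡⟨ ∑-cong (λ x → trans (∑-cong (λ b → trans (*-comm ⟦ inSubfield? b ⟧ ⟦ tr x ≟F b ⟧)
               (cong (_* ⟦ inSubfield? b ⟧) (⟦⟧-cong (tr x ≟F b) (b ≟F tr x) sym sym))))
               (trans (∑-single (tr x) (λ b → ⟦ inSubfield? b ⟧)) (⟦⟧-yes (inSubfield? (tr x)) (tr-inSubfield x)))) ⟩
        ∑ (λ x → 1ℚ)
          ≡⟨ ∑-const 1ℚ ⟩
        ℕ→ℚ card * 1ℚ
          ≡⟨ *-identityʳ (ℕ→ℚ card) ⟩
        ℕ→ℚ card
          ≡⟨ trans (cong ℕ→ℚ card≡q*M) (ℕ→ℚ-* q M) ⟩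
        ℕ→ℚ q * ℕ→ℚ M ∎
        where open ≡-Reasoning

      ∑subfield-M : ∑ (λ b → ⟦ inSubfield? b ⟧ * ℕ→ℚ M) ≡ subfieldSize * ℕ→ℚ M
      ∑subfield-M = trans (∑-cong (λ b → *-comm ⟦ inSubfield? b ⟧ (ℕ→ℚ M)))
        (trans (∑-*ˡ (ℕ→ℚ M) (λ b → ⟦ inSubfield? b ⟧)) (*-comm (ℕ→ℚ M) subfieldSize))

      deficiency≡0 : ∀ b → ⟦ inSubfield? b ⟧ * (ℕ→ℚ M - fibre b) ≡ 0ℚ
      deficiency≡0 = ∑≤0⇒≡0 (λ b → 0≤-* (0≤⟦⟧ (inSubfield? b)) (≤⇒0≤- (fibre≤M b)))
        (≤-trans (≤-reflexive (trans (∑-cong (λ b → lem ⟦ inSubfield? b ⟧ (ℕ→ℚ M) (fibre b)))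
          (trans (∑-- (λ b → ⟦ inSubfield? b ⟧ * ℕ→ℚ M) (λ b → ⟦ inSubfield? b ⟧ * fibre b))
            (cong₂ _-_ ∑subfield-M ∑fibres))))
          (≤-by (0≤-* (≤⇒0≤- subfieldSize≤q) (0≤ℕ→ℚ M)) (lem₂ subfieldSize (ℕ→ℚ q) (ℕ→ℚ M))))
        where
        lem : ∀ a b c → a * (b - c) ≡ a * b - a * c
        lem = solve-∀ ℚ-ring
        lem₂ : ∀ s q m → (q - s) * m ≡ 0ℚ - (s * m - q * m)
        lem₂ = solve-∀ ℚ-ring

    -- Each of the `q * M` elements has its trace in a subfield of at most `q` elements, and each
    -- fibre has at most `M` elements because `tr` is a polynomial of degree `M`. Hence no fibre
    -- over the subfield falls short, and surjectivity of the trace comes for free.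
    fibre≡M : ∀ {b} → InSubfield b → fibre b ≡ ℕ→ℚ M
    fibre≡M {b} h = sym (trans (lem (ℕ→ℚ M) (fibre b)) (trans (cong (_+ fibre b)
      (trans (sym (*-identityˡ (ℕ→ℚ M - fibre b))) (trans (cong (_* (ℕ→ℚ M - fibre b)) (sym (⟦⟧-yes (inSubfield? b) h))) (deficiency≡0 b))))
        (+-identityˡ (fibre b))))
      where
      lem : ∀ a b → a ≡ (a - b) + b
      lem = solve-∀ ℚ-ring

    subfieldSize≡q : ∑ (λ b → ⟦ inSubfield? b ⟧) ≡ ℕ→ℚ q
    subfieldSize≡q = ≤-antisym subfieldSize≤q (*-cancel-≤ M>0 (≤-reflexive
      (trans (*-comm (ℕ→ℚ M) (ℕ→ℚ q)) (trans (sym ∑fibres)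
        (trans (∑-cong (λ b → ⟦⟧-guard (inSubfield? b) (fibre≡M {b})))
          (trans ∑subfield-M (*-comm subfieldSize (ℕ→ℚ M))))))))
      where
      M>0 : 0ℚ < ℕ→ℚ M
      M>0 = ℕ→ℚ-mono-< {0} 1≤M

  sum-atMostOne : ∀ {n} {P : Fin n → Set} (P? : ∀ i → Dec (P i)) → (∀ i j → P i → P j → i ≡ j) →
    sum (λ i → ⟦ P? i ⟧) ≤ 1ℚ
  sum-atMostOne {n} P? unique with Finₚ.any? P?
  ... | yes (a , pa) = ≤-trans (sum-mono (λ i → ≤-trans (⟦⟧-mono (P? i) (i Finₚ.≟ a) (λ pi → unique i a pi pa))
      (≤-reflexive (sym (*-identityʳ ⟦ i Finₚ.≟ a ⟧))))) (≤-reflexive (sum-single a (λ _ → 1ℚ)))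
  ... | no none = ≤-trans (≤-reflexive (trans (sum-cong-≗ (λ i → ⟦⟧-no (P? i) (λ pi → none (i , pi))))
      (trans (sum-const n 0ℚ) (*-zeroʳ (ℕ→ℚ n))))) 0≤1

  *-cancel-≡ : ∀ {a b c} → 0ℚ < a → a * b ≡ a * c → b ≡ c
  *-cancel-≡ h e = ≤-antisym (*-cancel-≤ h (≤-reflexive e)) (*-cancel-≤ h (≤-reflexive (sym e)))

  0<ℕ→ℚ-prime : ∀ {p} → Prime p → 0ℚ < ℕ→ℚ p
  0<ℕ→ℚ-prime h = ℕ→ℚ-mono-< {0} (ℕₚ.≤-trans (s≤s z≤n) (2≤prime h))

  divℕ-exact : ∀ {m d} → d ∣ m → 1 ℕ.≤ d → divℕ m d ℕ.* d ≡ m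
  divℕ-exact {m} {suc d} d∣m _ = DivMod.m/n*n≡m d∣m

  -- Power residues and the functions `f D`

  module PowerResidues (F : FiniteField) where
    open Field F
    open FieldPolynomials F
    open FiniteFieldPowers F

    N : ℕ
    N = card ∸ 1

    card≡1+N : card ≡ suc N
    card≡1+N = sym (ℕₚ.m+[n∸m]≡n 1≤card)

    nz : Carrier → ℚ
    nz x = ⟦ ¬? (x ≟F 0F) ⟧

    nz-≢0 : ∀ {x} → x ≢ 0F → nz x ≡ 1ℚ
    nz-≢0 {x} h = ⟦⟧-yes (¬? (x ≟F 0F)) h

    nz-0 : nz 0F ≡ 0ℚ
    nz-0 = ⟦⟧-no (¬? (0F ≟F 0F)) (λ n → n refl)

    ∑-nz : ∑ nz ≡ ℕ→ℚ N
    ∑-nz = trans (∑-cong pointwise) (trans (∑-- (λ _ → 1ℚ) (λ x → ⟦ x ≟F 0F ⟧))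
      (trans (cong₂ _-_ (trans (∑-const 1ℚ) (trans (*-identityʳ (ℕ→ℚ card)) (trans (cong ℕ→ℚ card≡1+N) (ℕ→ℚ-suc N)))) (∑-single-1 0F))
        (lem (ℕ→ℚ N))))
      where
      pointwise : ∀ x → nz x ≡ 1ℚ - ⟦ x ≟F 0F ⟧
      pointwise x with x ≟F 0F
      ... | yes _ = refl
      ... | no _ = refl
      lem : ∀ a → (1ℚ + a) - 1ℚ ≡ a
      lem = solve-∀ ℚ-ring

    ^F≡1-∣ : ∀ {x m n} → m ∣ n → x ^F m ≡ 1F → x ^F n ≡ 1F
    ^F≡1-∣ {x} {m} (divides c refl) e = trans (^F-*′ x c m) (trans (cong (_^F c) e) (1^F c))

    ^F≡1-coprime : ∀ {x m n} → Coprime m n → x ^F m ≡ 1F → x ^F n ≡ 1F → x ≡ 1F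
    ^F≡1-coprime {x} {m} {n} c em en with coprime-Bézout c
    ... | Bézout.+- a b eq = sym (trans (sym (^F≡1-∣ (divides a refl) em)) (trans (cong (x ^F_) (sym eq))
            (trans (cong (x *F_) (^F≡1-∣ {n = b ℕ.* n} (divides b refl) en)) (FR.*-identityʳ x))))
    ... | Bézout.-+ a b eq = sym (trans (sym (^F≡1-∣ (divides b refl) en)) (trans (cong (x ^F_) (sym eq))
            (trans (cong (x *F_) (^F≡1-∣ {n = a ℕ.* m} (divides a refl) em)) (FR.*-identityʳ x))))

    PrimeDivisor : ℕ → Set
    PrimeDivisor p = Prime p × p ∣ N

    cofactor : ℕ → ℕ
    cofactor p = divℕ N p

    cofactor-* : ∀ {p} → PrimeDivisor p → cofactor p ℕ.* p ≡ N
    cofactor-* (pr , d) = divℕ-exact d (ℕₚ.≤-trans (s≤s z≤n) (2≤prime pr))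

    -- For a prime `p` dividing `N`, the units with `x ^ (N / p) = 1` are the `p`-th powers. Working
    -- with the equation avoids the construction of a generator of the unit group.
    inKernel? : ∀ p x → Dec (x ^F cofactor p ≡ 1F)
    inKernel? p x = x ^F cofactor p ≟F 1F

    -- The primitive p-th roots of unity are ω^j, so multiplication by the ω^j moves every p-th root of unity through 1 once.
    root-of-unity-orbit : ∀ {p ω b} → Prime p → ω ^F p ≡ 1F → ω ≢ 1F → b ^F p ≡ 1F →
      sum {p} (λ j → ⟦ b *F ω ^F toℕ j ≟F 1F ⟧) ≡ 1ℚ
    root-of-unity-orbit {p} {ω} {b} p-prime ωᵖ≡1 ω≢1 bᵖ≡1 = trans (lem (hits b))
      (trans (cong (λ u → 1ℚ - u) (trans (sym (*-identityˡ (1ℚ - hits b)))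
        (trans (cong (_* (1ℚ - hits b)) (sym (⟦⟧-yes (root? b) bᵖ≡1))) (misses≡0 b)))) lem₁)
      where
      1≤p : 1 ℕ.≤ p
      1≤p = ℕₚ.≤-trans (s≤s z≤n) (2≤prime p-prime)
      ω≢0 : ω ≢ 0F
      ω≢0 refl = 0≢1 (trans (sym (0^F p 1≤p)) ωᵖ≡1)
      root? : ∀ x → Dec (x ^F p ≡ 1F)
      root? x = x ^F p ≟F 1F
      hits : Carrier → ℚ
      hits x = sum {p} (λ j → ⟦ x *F ω ^F toℕ j ≟F 1F ⟧)
      lem : ∀ a → a ≡ 1ℚ - (1ℚ - a)
      lem = solve-∀ ℚ-ring
      lem₁ : 1ℚ - 0ℚ ≡ 1ℚ
      lem₁ = refl
      -- Two hits would give `ω ^ (j - i) = 1` with `0 < j - i < p`, hence `ω = 1`.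
      noRepeat : ∀ x (i j : Fin p) → x *F ω ^F toℕ i ≡ 1F → x *F ω ^F toℕ j ≡ 1F → ¬ (toℕ i ℕ.< toℕ j)
      noRepeat x i j ei ej i<j = ω≢1 (^F≡1-coprime
        (prime⇒coprime p-prime {{ℕ.>-nonZero (ℕₚ.m<n⇒0<n∸m i<j)}} (ℕₚ.≤-<-trans (ℕₚ.m∸n≤m (toℕ j) (toℕ i)) (Finₚ.toℕ<n j)))
        ωᵖ≡1 (trans (sym (FR.*-identityˡ _)) (trans (cong (_*F ω ^F (toℕ j ∸ toℕ i)) (sym ei))
          (trans (FR.*-assoc x _ _) (trans (cong (x *F_) (trans (sym (^F-+ ω (toℕ i) _)) (cong (ω ^F_) (ℕₚ.m+[n∸m]≡n (ℕₚ.<⇒≤ i<j))))) ej)))))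
      hits≤1 : ∀ x → hits x ≤ 1ℚ
      hits≤1 x = sum-atMostOne (λ j → x *F ω ^F toℕ j ≟F 1F) unique
        where
        unique : ∀ i j → x *F ω ^F toℕ i ≡ 1F → x *F ω ^F toℕ j ≡ 1F → i ≡ j
        unique i j ei ej with ℕₚ.<-cmp (toℕ i) (toℕ j)
        ... | tri< i<j _ _ = ⊥-elim (noRepeat x i j ei ej i<j)
        ... | tri≈ _ e _ = Finₚ.toℕ-injective e
        ... | tri> _ _ j<i = ⊥-elim (noRepeat x j i ej ei j<i)
      ∑hits : ∑ (λ x → ⟦ root? x ⟧ * hits x) ≡ ℕ→ℚ p
      ∑hits = begin
        ∑ (λ x → ⟦ root? x ⟧ * hits x)
          ≡⟨ ∑-cong (λ x → *-distribˡ-sum {p} ⟦ root? x ⟧ (λ j → ⟦ x *F ω ^F toℕ j ≟F 1F ⟧)) ⟩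
        ∑ (λ x → sum {p} (λ j → ⟦ root? x ⟧ * ⟦ x *F ω ^F toℕ j ≟F 1F ⟧))
          ≡⟨ ∑-comm {card} {p} (λ i j → ⟦ root? (element i) ⟧ * ⟦ element i *F ω ^F toℕ j ≟F 1F ⟧) ⟩
        sum {p} (λ j → ∑ (λ x → ⟦ root? x ⟧ * ⟦ x *F ω ^F toℕ j ≟F 1F ⟧))
          ≡⟨ sum-cong-≗ {p} (λ j → trans (∑-cong (hit j)) (trans (∑-single ((ω ^F toℕ j) ⁻¹) (λ x → ⟦ root? x ⟧))
               (⟦⟧-yes (root? ((ω ^F toℕ j) ⁻¹)) (0≢⇒⁻¹-^1 p (^F-≢0 ω≢0 (toℕ j)) (ωʲᵖ≡1 j))))) ⟩
        sum {p} (λ j → 1ℚ)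
          ≡⟨ trans (sum-const p 1ℚ) (*-identityʳ (ℕ→ℚ p)) ⟩
        ℕ→ℚ p ∎
        where
        open ≡-Reasoning
        ωʲᵖ≡1 : ∀ (j : Fin p) → (ω ^F toℕ j) ^F p ≡ 1F
        ωʲᵖ≡1 j = trans (sym (^F-* ω (toℕ j) p)) (^F≡1-∣ (divides (toℕ j) refl) ωᵖ≡1)
        hit : ∀ j x → ⟦ root? x ⟧ * ⟦ x *F ω ^F toℕ j ≟F 1F ⟧ ≡ ⟦ x ≟F (ω ^F toℕ j) ⁻¹ ⟧ * ⟦ root? x ⟧
        hit j x = trans (*-comm ⟦ root? x ⟧ _) (cong (_* ⟦ root? x ⟧)
          (⟦⟧-cong (x *F ω ^F toℕ j ≟F 1F) (x ≟F (ω ^F toℕ j) ⁻¹)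
            (λ e → ⁻¹-unique (trans (FR.*-comm _ x) e)) (λ { refl → ⁻¹-* (^F-≢0 ω≢0 (toℕ j)) })))
      -- There are at most `p` roots, each hit at most once, and the hits total `p`; so every root
      -- is hit.
      misses≡0 : ∀ x → ⟦ root? x ⟧ * (1ℚ - hits x) ≡ 0ℚ
      misses≡0 = ∑≤0⇒≡0 (λ x → 0≤-* (0≤⟦⟧ (root? x)) (≤⇒0≤- (hits≤1 x)))
        (≤-trans (≤-reflexive (trans (∑-cong (λ x → lem₂ ⟦ root? x ⟧ (hits x)))
          (trans (∑-- (λ x → ⟦ root? x ⟧) (λ x → ⟦ root? x ⟧ * hits x)) (cong (λ u → ∑ (λ x → ⟦ root? x ⟧) - u) ∑hits))))
          (≤-by (≤⇒0≤- (monic-fibre 1F 1≤p (monic-^ p))) (lem₃ (∑ (λ x → ⟦ root? x ⟧)) (ℕ→ℚ p))))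
        where
        lem₂ : ∀ a b → a * (1ℚ - b) ≡ a - a * b
        lem₂ = solve-∀ ℚ-ring
        lem₃ : ∀ a b → b - a ≡ 0ℚ - (a - b)
        lem₃ = solve-∀ ℚ-ring

    fermat-N : ∀ {x} → x ≢ 0F → x ^F N ≡ 1F
    fermat-N = fermat

    cofactor-^p : ∀ {p x} → PrimeDivisor p → x ≢ 0F → (x ^F cofactor p) ^F p ≡ 1F
    cofactor-^p {p} {x} pd h = trans (sym (^F-* x (cofactor p) p)) (trans (cong (x ^F_) (cofactor-* pd)) (fermat-N h))

    -- Raising to the power `N / p` sends `y w ^ j` to `b ω ^ j`, where `b` and `ω ≠ 1` are `p`-th
    -- roots of unity.
    kernel-orbit : ∀ {p w y} → PrimeDivisor p → w ≢ 0F → w ^F cofactor p ≢ 1F → y ≢ 0F →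
      sum {p} (λ j → ⟦ inKernel? p (y *F w ^F toℕ j) ⟧) ≡ 1ℚ
    kernel-orbit {p} {w} {y} pd w≢0 wᵉ≢1 y≢0 = trans
      (sum-cong-≗ {p} (λ j → ⟦⟧-cong (inKernel? p (y *F w ^F toℕ j)) (y ^F e *F (w ^F e) ^F toℕ j ≟F 1F)
        (trans (sym (eq j))) (trans (eq j))))
      (root-of-unity-orbit (proj₁ pd) (cofactor-^p pd w≢0) wᵉ≢1 (cofactor-^p pd y≢0))
      where
      e = cofactor p
      eq : ∀ (j : Fin p) → (y *F w ^F toℕ j) ^F e ≡ y ^F e *F (w ^F e) ^F toℕ j
      eq j = trans (*-^F y _ e) (cong (y ^F e *F_) (trans (sym (^F-* w (toℕ j) e)) (^F-*′ w (toℕ j) e)))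

    1≤cofactor : ∀ {p} → PrimeDivisor p → 1 ℕ.≤ N → 1 ℕ.≤ cofactor p
    1≤cofactor {p} pd 1≤N with cofactor p | cofactor-* pd
    ... | zero | e = ⊥-elim (ℕₚ.<⇒≢ 1≤N e)
    ... | suc _ | _ = s≤s z≤n

    1≤N : 1 ℕ.≤ N
    1≤N = ℕₚ.≤-pred (ℕₚ.≤-trans two≤card (ℕₚ.≤-reflexive card≡1+N))
      where
      two≤card : 2 ℕ.≤ card
      two≤card with 2 ℕ.≤? card
      ... | yes h = h
      ... | no h = ⊥-elim (0≢1 (trans (sym (element-index 0F)) (trans (cong element (same (index 0F) (index 1F))) (element-index 1F))))
        where
        same : (i j : Fin card) → i ≡ j
        same i j = Finₚ.toℕ-injective (trans (zero≡ i) (sym (zero≡ j)))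
          where
          zero≡ : (i : Fin card) → toℕ i ≡ 0
          zero≡ i = ℕₚ.n≤0⇒n≡0 (ℕₚ.≤-pred (ℕₚ.≤-trans (Finₚ.toℕ<n i) (ℕₚ.≤-pred (ℕₚ.≰⇒> h))))

    -- Otherwise all `N` units would be roots of `x ^ (N / p) = 1`, an equation of degree less than
    -- `N`.
    nonResidue : ∀ {p} → PrimeDivisor p → Σ Carrier (λ u → u ≢ 0F × u ^F cofactor p ≢ 1F)
    nonResidue {p} pd with any? (λ u → ¬? (u ≟F 0F) ×-dec ¬? (inKernel? p u))
    ... | yes (u , h) = u , h
    ... | no none = ⊥-elim (ℕₚ.<⇒≱ e<N N≤e)
      where
      e = cofactor p
      1≤e = 1≤cofactor pd 1≤N
      N≤e : N ℕ.≤ e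
      N≤e = ℕₚ.≮⇒≥ (λ l → <-irrefl refl (<-≤-trans (ℕ→ℚ-mono-< l)
        (≤-trans (≤-reflexive (sym ∑-nz)) (≤-trans (∑-mono (λ x → ⟦⟧-mono (¬? (x ≟F 0F)) (inKernel? p x) (kernel x)))
          (monic-fibre 1F 1≤e (monic-^ e))))))
        where
        kernel : ∀ x → x ≢ 0F → x ^F e ≡ 1F
        kernel x h with inKernel? p x
        ... | yes k = k
        ... | no k = ⊥-elim (none (x , h , k))
      e<N : e ℕ.< N
      e<N = ℕₚ.<-≤-trans (ℕₚ.m<m*n e p {{ℕ.>-nonZero 1≤e}} (2≤prime (proj₁ pd))) (ℕₚ.≤-reflexive (cofactor-* pd))

    -- If `ξ = ζ ^ d` with a prime `p` dividing `d`, then `ξ ^ (N / p)` is a power of `ζ ^ N = 1`. A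
    -- `d` without prime divisor is 1, since 0 does not divide `N`.
    nonResidues⇒free : ∀ {ξ} → (∀ {p} → PrimeDivisor p → ξ ^F cofactor p ≢ 1F) → IsFree N ξ
    nonResidues⇒free {ξ} nonresidue d ζ d∣N ζ≢0 ξ≡ζᵈ with d ℕ.≟ 1
    ... | yes d≡1 = d≡1
    ... | no d≢1 with ∃-prime-divisor d (λ { refl → ℕₚ.<⇒≢ 1≤N (sym (Div.0∣⇒≡0 d∣N)) }) d≢1
    ...   | p , p-prime , divides c d≡ = ⊥-elim (nonresidue pd (trans (cong (_^F cofactor p) ξ≡ζᵈ)
              (trans (sym (^F-* ζ d (cofactor p))) (^F≡1-∣ (divides c exponent) (fermat-N ζ≢0)))))
      where
      pd : PrimeDivisor p
      pd = p-prime , Div.∣-trans (divides c d≡) d∣N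
      exponent : d ℕ.* cofactor p ≡ c ℕ.* N
      exponent = trans (cong (ℕ._* cofactor p) d≡) (trans (ℕₚ.*-assoc c p (cofactor p))
        (cong (c ℕ.*_) (trans (ℕₚ.*-comm p (cofactor p)) (cofactor-* pd))))

    r : ℕ → ℚ
    r p = recip (p ∸ 1)

    p*r : ∀ {p} → Prime p → ℕ→ℚ p * r p ≡ 1ℚ + r p
    p*r {suc (suc p)} _ = trans (cong (_* r (suc (suc p))) (ℕ→ℚ-suc (suc p))) (trans (lem (ℕ→ℚ (suc p)) (r (suc (suc p))))
      (cong (_+ r (suc (suc p))) (recip-inverse (suc p) (s≤s z≤n))))
      where
      lem : ∀ a b → (1ℚ + a) * b ≡ a * b + b
      lem = solve-∀ ℚ-ring
    p*r {1} h = ⊥-elim (¬prime[1] h)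
    p*r {0} h = ⊥-elim (¬prime[0] h)

    -- g p is -1 on the p-th powers and 1/(p - 1) on the other units, so (1 - 1/p) (1 + g p) is the indicator of the latter;
    -- f D, the product of g p over p in D, is (up to sign and normalisation) the sum of the characters of order ∏ D.
    g : ℕ → Carrier → ℚ
    g p x = r p - (1ℚ + r p) * ⟦ inKernel? p x ⟧

    f : List ℕ → Carrier → ℚ
    f [] x = nz x
    f (p ∷ D) x = g p x * f D x

    Distinct : List ℕ → Set
    Distinct D = All PrimeDivisor D × Unique D

    f-0 : ∀ D → f D 0F ≡ 0ℚ
    f-0 [] = nz-0
    f-0 (p ∷ D) = trans (cong (g p 0F *_) (f-0 D)) (*-zeroʳ (g p 0F))

    f-≡0 : ∀ D {x} → x ≡ 0F → f D x ≡ 0ℚ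
    f-≡0 D refl = f-0 D

    g-invariant : ∀ p {x w} → w ^F cofactor p ≡ 1F → g p (x *F w) ≡ g p x
    g-invariant p {x} {w} e = cong (λ u → r p - (1ℚ + r p) * u)
      (⟦⟧-cong (inKernel? p (x *F w)) (inKernel? p x) (trans (sym eq)) (trans eq))
      where
      eq : (x *F w) ^F cofactor p ≡ x ^F cofactor p
      eq = trans (*-^F x w (cofactor p)) (trans (cong (x ^F cofactor p *F_) e) (FR.*-identityʳ _))

    nz-* : ∀ {x w} → w ≢ 0F → nz (x *F w) ≡ nz x
    nz-* {x} {w} h = ⟦⟧-cong (¬? (x *F w ≟F 0F)) (¬? (x ≟F 0F)) *-≢0ˡ (λ n → *-≢0 n h)

    f-invariant : ∀ {D x w} → w ≢ 0F → All (λ p → w ^F cofactor p ≡ 1F) D → f D (x *F w) ≡ f D x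
    f-invariant h [] = nz-* h
    f-invariant {p ∷ D} h (e ∷ es) = cong₂ _*_ (g-invariant p e) (f-invariant h es)

    nz-⁻¹ : ∀ x → nz (x ⁻¹) ≡ nz x
    nz-⁻¹ x = ⟦⟧-cong (¬? (x ⁻¹ ≟F 0F)) (¬? (x ≟F 0F)) (λ { h refl → h 0⁻¹ }) ⁻¹-≢0

    f-⁻¹ : ∀ D x → f D (x ⁻¹) ≡ f D x
    f-⁻¹ D x = go D (x ≟F 0F)
      where
      go : ∀ D → Dec (x ≡ 0F) → f D (x ⁻¹) ≡ f D x
      go D (yes x≡0) = cong (f D) (trans (cong _⁻¹ x≡0) (trans 0⁻¹ (sym x≡0)))
      go [] (no x≢0) = nz-⁻¹ x
      go (p ∷ D) (no x≢0) = cong₂ _*_ (cong (λ u → r p - (1ℚ + r p) * u) (⟦⟧-cong (inKernel? p (x ⁻¹)) (inKernel? p x)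
        (λ h → trans (cong (_^F cofactor p) (sym (⁻¹-involutive x))) (0≢⇒⁻¹-^1 (cofactor p) (⁻¹-≢0 x≢0) h))
        (0≢⇒⁻¹-^1 (cofactor p) x≢0))) (go D (no x≢0))

    -- For distinct primes `σ D` is the Möbius function and `κ D` the reciprocal of Euler's function
    -- at the product of `D`; on units `f D` is `σ D * κ D` times the sum of the characters of that
    -- order, whence the constant in `convolution`.
    σ : List ℕ → ℚ
    σ [] = 1ℚ
    σ (p ∷ D) = - σ D

    σ² : ∀ D → σ D * σ D ≡ 1ℚ
    σ² [] = refl
    σ² (p ∷ D) = trans (lem (σ D)) (σ² D)
      where
      lem : ∀ a → (- a) * (- a) ≡ a * a
      lem = solve-∀ ℚ-ring

    κ : List ℕ → ℚ
    κ [] = 1ℚ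
    κ (p ∷ D) = r p * κ D

    g-1 : ∀ p → g p 1F ≡ - 1ℚ
    g-1 p = trans (cong (λ u → r p - (1ℚ + r p) * u) (⟦⟧-yes (inKernel? p 1F) (1^F (cofactor p)))) (lem (r p))
      where
      lem : ∀ a → a - (1ℚ + a) * 1ℚ ≡ - 1ℚ
      lem = solve-∀ ℚ-ring

    f-1 : ∀ D → f D 1F ≡ σ D
    f-1 [] = nz-≢0 (λ e → 0≢1 (sym e))
    f-1 (p ∷ D) = trans (cong₂ _*_ (g-1 p) (f-1 D)) (lem (σ D))
      where
      lem : ∀ a → (- 1ℚ) * a ≡ - a
      lem = solve-∀ ℚ-ring

    -- w lies in every kernel with index in D but not in that of p, so translating by powers of w averages out the factor g p alone.
    separator : ∀ {p D} → Distinct (p ∷ D) → Σ Carrier (λ w → w ≢ 0F × w ^F cofactor p ≢ 1F × All (λ p′ → w ^F cofactor p′ ≡ 1F) D)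
    separator {p} {D} (pd ∷ pds , p∉D ∷ uD) with nonResidue pd
    ... | u , u≢0 , h = u ^F product D , ^F-≢0 u≢0 (product D) ,
      (λ e → h (^F≡1-coprime (prime∤⇒coprime (proj₁ pd) (prime∤product (proj₁ pd) (All.map proj₁ pds) (Allₚ.All¬⇒¬Any p∉D)))
        (cofactor-^p pd u≢0) (trans (sym (^F-* u (cofactor p) (product D))) (trans (^F-*′ u (cofactor p) (product D)) e)))) ,
      All.tabulate (λ {p′} p′∈D → trans (sym (^F-* u (product D) (cofactor p′)))
        (^F≡1-∣ (N∣ p′ (All.lookup pds p′∈D) (∈⇒∣product p′∈D)) (fermat-N u≢0)))
      where
      N∣ : ∀ p′ → PrimeDivisor p′ → p′ ∣ product D → N ∣ product D ℕ.* cofactor p′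
      N∣ p′ pd′ p′∣ = subst (_∣ product D ℕ.* cofactor p′) (cofactor-* pd′)
        (subst (cofactor p′ ℕ.* p′ ∣_) (ℕₚ.*-comm (cofactor p′) (product D)) (Div.*-monoʳ-∣ (cofactor p′) p′∣))

    -- Every translate of `H` has the same sum. Summing along the powers of `w` takes the place of a
    -- decomposition into cosets.
    average : ∀ {w} p → w ≢ 0F → ∀ H → ℕ→ℚ p * ∑ H ≡ ∑ (λ z → sum {p} (λ j → H (z *F w ^F toℕ j)))
    average {w} p w≢0 H = sym (trans (∑-comm {card} {p} (λ i j → H (element i *F w ^F toℕ j)))
      (trans (sum-cong-≗ {p} (λ j → ∑-scaleʳ (^F-≢0 w≢0 (toℕ j)) H)) (sum-const p (∑ H))))

    -- The orbit meets the kernel once, so the sum is `p r - (1 + r)`, which vanishes for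
    -- `r = 1 / (p - 1)`.
    sum-g : ∀ {p w z} → PrimeDivisor p → w ≢ 0F → w ^F cofactor p ≢ 1F → z ≢ 0F →
      sum {p} (λ j → g p (z *F w ^F toℕ j)) ≡ 0ℚ
    sum-g {p} {w} {z} pd w≢0 wᵉ≢1 z≢0 = begin
      sum {p} (λ j → r p - (1ℚ + r p) * k j)
        ≡⟨ sum-cong-≗ {p} (λ j → lem (r p) (k j)) ⟩
      sum {p} (λ j → r p + (- (1ℚ + r p)) * k j)
        ≡⟨ ∑-distrib-+ {p} (λ _ → r p) (λ j → (- (1ℚ + r p)) * k j) ⟩
      sum {p} (λ j → r p) + sum {p} (λ j → (- (1ℚ + r p)) * k j)
        ≡⟨ cong₂ _+_ (trans (sum-const p (r p)) (p*r (proj₁ pd)))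
            (trans (sym (*-distribˡ-sum {p} (- (1ℚ + r p)) k)) (cong ((- (1ℚ + r p)) *_) (kernel-orbit pd w≢0 wᵉ≢1 z≢0))) ⟩
      (1ℚ + r p) + (- (1ℚ + r p)) * 1ℚ
        ≡⟨ lem₂ (r p) ⟩
      0ℚ ∎
      where
      open ≡-Reasoning
      k : Fin p → ℚ
      k j = ⟦ inKernel? p (z *F w ^F toℕ j) ⟧
      lem : ∀ a b → a - (1ℚ + a) * b ≡ a + (- (1ℚ + a)) * b
      lem = solve-∀ ℚ-ring
      lem₂ : ∀ a → (1ℚ + a) + (- (1ℚ + a)) * 1ℚ ≡ 0ℚ
      lem₂ = solve-∀ ℚ-ring

    -- Along the orbits of the separator `f D` is constant while `g p` sums to 0.
    ∑f≡0 : ∀ {p D} → Distinct (p ∷ D) → ∑ (f (p ∷ D)) ≡ 0ℚ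
    ∑f≡0 {p} {D} dist@(pd ∷ _ , _) with separator dist
    ... | w , w≢0 , wᵉ≢1 , wD = *-cancel-≡ (0<ℕ→ℚ-prime (proj₁ pd)) (trans (average p w≢0 (f (p ∷ D)))
      (trans (∑-cong inner) (trans ∑-zero (sym (*-zeroʳ (ℕ→ℚ p))))))
      where
      wʲ-kernel : ∀ (j : Fin p) → All (λ p′ → (w ^F toℕ j) ^F cofactor p′ ≡ 1F) D
      wʲ-kernel j = All.map (λ {p′} e → trans (sym (^F-* w (toℕ j) (cofactor p′)))
        (^F≡1-∣ (divides (toℕ j) refl) e)) wD
      inner : ∀ z → sum {p} (λ j → f (p ∷ D) (z *F w ^F toℕ j)) ≡ 0ℚ
      inner z = trans (sum-cong-≗ {p} (λ j → trans (cong (g p (z *F w ^F toℕ j) *_) (f-invariant (^F-≢0 w≢0 (toℕ j)) (wʲ-kernel j)))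
        (*-comm (g p (z *F w ^F toℕ j)) (f D z)))) (trans (sym (*-distribˡ-sum {p} (f D z) (λ j → g p (z *F w ^F toℕ j)))) (case (z ≟F 0F)))
        where
        case : Dec (z ≡ 0F) → f D z * sum {p} (λ j → g p (z *F w ^F toℕ j)) ≡ 0ℚ
        case (yes z≡0) = trans (cong (_* s) (f-≡0 D z≡0)) (*-zeroˡ s)
          where s = sum {p} (λ j → g p (z *F w ^F toℕ j))
        case (no z≢0) = trans (cong (f D z *_) (sum-g pd w≢0 wᵉ≢1 z≢0)) (*-zeroʳ (f D z))

    -- Convolution along one orbit. In the expanded product `k` and `k′` are each hit once, and in
    -- `k′ j * k j` the condition on the quotient may be replaced by the one on `x`, which does not
    -- vary with `j`.
    sum-gg : ∀ {p w x z} → PrimeDivisor p → w ≢ 0F → w ^F cofactor p ≢ 1F → x ≢ 0F → z ≢ 0F →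
      sum {p} (λ j → g p (x *F (z *F w ^F toℕ j) ⁻¹) * g p (z *F w ^F toℕ j)) ≡ - (ℕ→ℚ p * (r p * g p x))
    sum-gg {p} {w} {x} {z} pd w≢0 wᵉ≢1 x≢0 z≢0 = begin
      sum {p} (λ j → g p (x *F (z *F w ^F toℕ j) ⁻¹) * g p (z *F w ^F toℕ j))
        ≡⟨ sum-cong-≗ {p} (λ j → trans (expand (r p) (k′ j) (k j)) (cong (λ u → r p * r p + (a * k′ j + (a * k j + b * u))) (k′k j))) ⟩
      sum {p} (λ j → r p * r p + (a * k′ j + (a * k j + b * (⟦ inKernel? p x ⟧ * k j))))
        ≡⟨ trans (∑-distrib-+ {p} _ _) (cong (sum {p} (λ _ → r p * r p) +_) (trans (∑-distrib-+ {p} _ _) (cong (sum {p} (λ j → a * k′ j) +_) (∑-distrib-+ {p} _ _)))) ⟩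
      sum {p} (λ _ → r p * r p) + (sum {p} (λ j → a * k′ j) + (sum {p} (λ j → a * k j) + sum {p} (λ j → b * (⟦ inKernel? p x ⟧ * k j))))
        ≡⟨ cong₂ _+_ (trans (sum-const p (r p * r p)) (trans (sym (*-assoc (ℕ→ℚ p) (r p) (r p))) (cong (_* r p) (p*r (proj₁ pd)))))
            (cong₂ _+_ (scale a k′ k′-orbit) (cong₂ _+_ (scale a k k-orbit)
              (trans (sum-cong-≗ {p} (λ j → sym (*-assoc b ⟦ inKernel? p x ⟧ (k j)))) (scale (b * ⟦ inKernel? p x ⟧) k k-orbit)))) ⟩
      (1ℚ + r p) * r p + (a + (a + b * ⟦ inKernel? p x ⟧))
        ≡⟨ collect (r p) ⟦ inKernel? p x ⟧ ⟩
      - ((1ℚ + r p) * g p x)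
        ≡⟨ cong -_ (trans (cong (_* g p x) (sym (p*r (proj₁ pd)))) (*-assoc (ℕ→ℚ p) (r p) (g p x))) ⟩
      - (ℕ→ℚ p * (r p * g p x)) ∎
      where
      open ≡-Reasoning
      e = cofactor p
      a b : ℚ
      a = - (r p * (1ℚ + r p))
      b = (1ℚ + r p) * (1ℚ + r p)
      k k′ : Fin p → ℚ
      k j = ⟦ inKernel? p (z *F w ^F toℕ j) ⟧
      k′ j = ⟦ inKernel? p (x *F (z *F w ^F toℕ j) ⁻¹) ⟧
      zw≢0 : ∀ (j : Fin p) → z *F w ^F toℕ j ≢ 0F
      zw≢0 j = *-≢0 z≢0 (^F-≢0 w≢0 (toℕ j))
      expand : ∀ r u v → (r - (1ℚ + r) * u) * (r - (1ℚ + r) * v) ≡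
        r * r + ((- (r * (1ℚ + r))) * u + ((- (r * (1ℚ + r))) * v + ((1ℚ + r) * (1ℚ + r)) * (u * v)))
      expand = solve-∀ ℚ-ring
      collect : ∀ r u → (1ℚ + r) * r + ((- (r * (1ℚ + r))) + ((- (r * (1ℚ + r))) + ((1ℚ + r) * (1ℚ + r)) * u)) ≡ - ((1ℚ + r) * (r - (1ℚ + r) * u))
      collect = solve-∀ ℚ-ring
      scale : ∀ c h → sum {p} h ≡ 1ℚ → sum {p} (λ j → c * h j) ≡ c
      scale c h eq = trans (sym (*-distribˡ-sum {p} c h)) (trans (cong (c *_) eq) (*-identityʳ c))
      k-orbit : sum {p} k ≡ 1ℚ
      k-orbit = kernel-orbit pd w≢0 wᵉ≢1 z≢0
      k′-orbit : sum {p} k′ ≡ 1ℚ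
      k′-orbit = trans (sum-cong-≗ {p} (λ j → cong (λ u → ⟦ inKernel? p u ⟧) (eq j)))
        (kernel-orbit {y = x *F z ⁻¹} pd (⁻¹-≢0 w≢0) (λ h → wᵉ≢1 (trans (cong (_^F e) (sym (⁻¹-involutive w))) (0≢⇒⁻¹-^1 e (⁻¹-≢0 w≢0) h)))
          (*-≢0 x≢0 (⁻¹-≢0 z≢0)))
        where
        eq : ∀ (j : Fin p) → x *F (z *F w ^F toℕ j) ⁻¹ ≡ (x *F z ⁻¹) *F (w ⁻¹) ^F toℕ j
        eq j = trans (cong (x *F_) (sym (⁻¹-unique product≡1))) (sym (FR.*-assoc x _ _))
          where
          swap : ∀ a b c d → (a *F b) *F (c *F d) ≡ (a *F c) *F (b *F d)
          swap = F-solve 4 (λ a b c d → ((a :* b) :* (c :* d)) := ((a :* c) :* (b :* d))) refl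
          product≡1 : (z *F w ^F toℕ j) *F (z ⁻¹ *F (w ⁻¹) ^F toℕ j) ≡ 1F
          product≡1 = trans (swap z _ _ _) (trans (cong₂ _*F_ (*-⁻¹ z≢0)
            (trans (cong (w ^F toℕ j *F_) (^F-⁻¹ (toℕ j) w≢0)) (*-⁻¹ (^F-≢0 w≢0 (toℕ j))))) (FR.*-identityˡ 1F))
      k′k : ∀ j → k′ j * k j ≡ ⟦ inKernel? p x ⟧ * k j
      k′k j = trans (*-comm (k′ j) (k j)) (trans (⟦⟧-guard (inKernel? p zw) (λ h → ⟦⟧-cong (inKernel? p (x *F zw ⁻¹)) (inKernel? p x)
        (trans (sym (quotient h))) (trans (quotient h)))) (*-comm (k j) ⟦ inKernel? p x ⟧))
        where
        zw = z *F w ^F toℕ j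
        quotient : zw ^F e ≡ 1F → (x *F zw ⁻¹) ^F e ≡ x ^F e
        quotient h = trans (*-^F x _ e) (trans (cong (x ^F e *F_) (0≢⇒⁻¹-^1 e (zw≢0 j) h)) (FR.*-identityʳ _))

    -- Takes the place of the orthogonality of characters: averaging along the separator of `p`
    -- splits off `- (r p * g p x)` by `sum-gg` and leaves the convolution for the remaining primes.
    convolution : ∀ {D} → Distinct D → ∀ {x} → x ≢ 0F →
      ∑ (λ z → f D (x *F z ⁻¹) * f D z) ≡ σ D * κ D * ℕ→ℚ N * f D x
    convolution {[]} _ {x} x≢0 = trans (∑-cong pointwise) (trans ∑-nz (sym (trans (cong (1ℚ * 1ℚ * ℕ→ℚ N *_) (nz-≢0 x≢0)) (lem (ℕ→ℚ N)))))
      where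
      pointwise : ∀ z → nz (x *F z ⁻¹) * nz z ≡ nz z
      pointwise z = trans (*-comm (nz (x *F z ⁻¹)) (nz z)) (trans (⟦⟧-guard (¬? (z ≟F 0F)) {y = 1ℚ} (λ z≢0 → nz-≢0 (*-≢0 x≢0 (⁻¹-≢0 z≢0)))) (*-identityʳ (nz z)))
      lem : ∀ a → 1ℚ * 1ℚ * a * 1ℚ ≡ a
      lem = solve-∀ ℚ-ring
    convolution {p ∷ D} dist@(pd ∷ pds , _ ∷ uD) {x} x≢0 with separator dist
    ... | w , w≢0 , wᵉ≢1 , wD = *-cancel-≡ (0<ℕ→ℚ-prime (proj₁ pd)) (begin
      ℕ→ℚ p * ∑ H
        ≡⟨ average p w≢0 H ⟩
      ∑ (λ z → sum {p} (λ j → H (z *F w ^F toℕ j)))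
        ≡⟨ ∑-cong inner ⟩
      ∑ (λ z → c * Φ z)
        ≡⟨ trans (∑-*ˡ c Φ) (cong (c *_) (convolution {D} (pds , uD) x≢0)) ⟩
      c * (σ D * κ D * ℕ→ℚ N * f D x)
        ≡⟨ lem (ℕ→ℚ p) (r p) (g p x) (σ D) (κ D) (ℕ→ℚ N) (f D x) ⟩
      ℕ→ℚ p * ((- σ D) * (r p * κ D) * ℕ→ℚ N * (g p x * f D x)) ∎)
      where
      open ≡-Reasoning
      lem : ∀ p r g s k n f → (- (p * (r * g))) * (s * k * n * f) ≡ p * ((- s) * (r * k) * n * (g * f))
      lem = solve-∀ ℚ-ring
      c : ℚ
      c = - (ℕ→ℚ p * (r p * g p x))
      Φ H : Carrier → ℚ
      Φ z = f D (x *F z ⁻¹) * f D z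
      H z = f (p ∷ D) (x *F z ⁻¹) * f (p ∷ D) z
      gg : Carrier → ℚ
      gg z = g p (x *F z ⁻¹) * g p z
      wʲ-kernel : ∀ (j : Fin p) → All (λ p′ → (w ^F toℕ j) ^F cofactor p′ ≡ 1F) D
      wʲ-kernel j = All.map (λ {p′} e → trans (sym (^F-* w (toℕ j) (cofactor p′)))
        (^F≡1-∣ (divides (toℕ j) refl) e)) wD
      Φ-invariant : ∀ z → z ≢ 0F → ∀ (j : Fin p) → Φ (z *F w ^F toℕ j) ≡ Φ z
      Φ-invariant z z≢0 j = cong₂ _*_ (trans (sym (f-invariant (^F-≢0 w≢0 (toℕ j)) (wʲ-kernel j))) (cong (f D) eq)) (f-invariant (^F-≢0 w≢0 (toℕ j)) (wʲ-kernel j))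
        where
        wʲ = w ^F toℕ j
        wʲ≢0 = ^F-≢0 w≢0 (toℕ j)
        eq : (x *F (z *F wʲ) ⁻¹) *F wʲ ≡ x *F z ⁻¹
        eq = trans (FR.*-assoc x _ wʲ) (cong (x *F_) (⁻¹-unique (trans (lem′ z ((z *F wʲ) ⁻¹) wʲ) (*-⁻¹ (*-≢0 z≢0 wʲ≢0)))))
          where
          lem′ : ∀ a b c → a *F (b *F c) ≡ (a *F c) *F b
          lem′ = F-solve 3 (λ a b c → (a :* (b :* c)) := ((a :* c) :* b)) refl
      H-split : ∀ z → H z ≡ gg z * Φ z
      H-split z = lem′ (g p (x *F z ⁻¹)) (f D (x *F z ⁻¹)) (g p z) (f D z)
        where
        lem′ : ∀ a b c d → (a * b) * (c * d) ≡ (a * c) * (b * d)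
        lem′ = solve-∀ ℚ-ring
      inner : ∀ z → sum {p} (λ j → H (z *F w ^F toℕ j)) ≡ c * Φ z
      inner z = case (z ≟F 0F)
        where
        case : Dec (z ≡ 0F) → sum {p} (λ j → H (z *F w ^F toℕ j)) ≡ c * Φ z
        case (yes refl) = trans (sum-cong-≗ {p} (λ j → vanish (f (p ∷ D) (x *F (0F *F w ^F toℕ j) ⁻¹)) (f-≡0 (p ∷ D) (FR.zeroˡ _))))
          (trans (sum-const p 0ℚ) (trans (*-zeroʳ (ℕ→ℚ p)) (sym (trans (cong (c *_) (vanish (f D (x *F 0F ⁻¹)) (f-0 D))) (*-zeroʳ c)))))
          where
          vanish : ∀ a {b} → b ≡ 0ℚ → a * b ≡ 0ℚ
          vanish a refl = *-zeroʳ a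
        case (no z≢0) = trans (sum-cong-≗ {p} (λ j → trans (H-split _) (trans (cong (gg (z *F w ^F toℕ j) *_) (Φ-invariant z z≢0 j))
            (*-comm (gg (z *F w ^F toℕ j)) (Φ z)))))
          (trans (sym (*-distribˡ-sum {p} (Φ z) (λ j → gg (z *F w ^F toℕ j))))
            (trans (cong (Φ z *_) (sum-gg pd w≢0 wᵉ≢1 x≢0 z≢0)) (*-comm (Φ z) c)))

    -- The convolution at `x = 1`, because `f D` takes the same value at `z` and at `z ⁻¹`.
    ∑f² : ∀ {D} → Distinct D → ∑ (λ z → f D z * f D z) ≡ κ D * ℕ→ℚ N
    ∑f² {D} dist = trans (∑-cong (λ z → cong (_* f D z) (sym (trans (cong (f D) (FR.*-identityˡ _)) (f-⁻¹ D z)))))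
      (trans (convolution dist (λ e → 0≢1 (sym e))) (trans (cong (σ D * κ D * ℕ→ℚ N *_) (f-1 D))
        (trans (lem (σ D) (κ D) (ℕ→ℚ N)) (trans (cong (_* (κ D * ℕ→ℚ N)) (σ² D)) (*-identityˡ (κ D * ℕ→ℚ N))))))
      where
      lem : ∀ s k n → s * k * n * s ≡ (s * s) * (k * n)
      lem = solve-∀ ℚ-ring

    0<r : ∀ {p} → Prime p → 0ℚ < r p
    0<r {p} h with r p ℚₚ.≟ 0ℚ
    ... | no r≢0 = ≰⇒> (λ le → r≢0 (≤-antisym le (0≤recip (p ∸ 1))))
    ... | yes r≡0 = ⊥-elim (1≢0 (trans (sym (+-identityʳ 1ℚ)) (trans (cong (1ℚ +_) (sym r≡0)) (trans (sym (p*r h)) (trans (cong (ℕ→ℚ p *_) r≡0) (*-zeroʳ (ℕ→ℚ p)))))))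

    0<κN : ∀ {D} → Distinct D → 0ℚ < κ D * ℕ→ℚ N
    0<κN {D} (pds , _) = 0<-* (go pds) (ℕ→ℚ-mono-< {0} 1≤N)
      where
      go : ∀ {D} → All PrimeDivisor D → 0ℚ < κ D
      go [] = 0<1
      go (pd ∷ pds) = 0<-* (0<r (proj₁ pd)) (go pds)

  -- Second moments of trace sums

  module Moments (F : FiniteField) (q n : ℕ) (q-primePower : IsPrimePower q) (1≤n : 1 ℕ.≤ n)
    (card≡ : FiniteField.card F ≡ q ^ n) (β : FiniteField.Carrier F)
    (β-inSubfield : FiniteField._^F_ F β q ≡ β) (β≢0 : β ≢ FiniteField.0F F) where

    open Trace F q n q-primePower 1≤n card≡ public
    open PowerResidues F public

    Mℚ qℚ : ℚ
    Mℚ = ℕ→ℚ M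
    qℚ = ℕ→ℚ q

    0<q-1 : 0ℚ < qℚ - 1ℚ
    0<q-1 = <⇒0<- (ℕ→ℚ-mono-< {1} {q} 2≤q)

    ∑-*-∑ : ∀ f g → ∑ f * ∑ g ≡ ∑ (λ x → ∑ (λ y → f x * g y))
    ∑-*-∑ f g = trans (*-comm (∑ f) (∑ g)) (trans (sym (∑-*ˡ (∑ g) f)) (∑-cong (λ x → trans (*-comm (∑ g) (f x)) (sym (∑-*ˡ (f x) g)))))

    ∑∑-cong : ∀ {f g : Carrier → Carrier → ℚ} → (∀ x y → f x y ≡ g x y) → ∑ (λ x → ∑ (f x)) ≡ ∑ (λ x → ∑ (g x))
    ∑∑-cong h = ∑-cong (λ x → ∑-cong (h x))

    subfield-* : ∀ {b c} → InSubfield b → InSubfield c → InSubfield (b *F c)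
    subfield-* {b} {c} hb hc = trans (*-^F b c q) (cong₂ _*F_ hb hc)

    subfield-⁻¹ : ∀ {b} → b ≢ 0F → InSubfield b → InSubfield (b ⁻¹)
    subfield-⁻¹ {b} b≢0 hb = trans (^F-⁻¹ q b≢0) (cong _⁻¹ hb)

    -- The map `u` is the identity for the linear sums and squaring for the quadratic ones; in the
    -- second moment only the weight `V` of the collisions of `u` tells them apart.
    module SecondMoment (u : Carrier → Carrier) (h : Carrier → ℚ) where

      T : Carrier → Carrier → ℚ
      T b a = ∑ (λ y → h y * ⟦ tr (a *F u y) ≟F b ⟧)

      S : Carrier → ℚ
      S b = ∑ (λ a → T b a * T b a)

      V : ℚ
      V = ∑ (λ y → ∑ (λ y′ → ⟦ u y ≟F u y′ ⟧ * (h y * h y′)))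

      0≤S : ∀ b → 0ℚ ≤ S b
      0≤S b = 0≤∑ (λ a → 0≤-sq (T b a))

      trace-collision : ∀ x x′ → ∑ (λ a → ⟦ tr (a *F x′) ≟F tr (a *F x) ⟧) ≡ Mℚ + (qℚ - 1ℚ) * Mℚ * ⟦ x ≟F x′ ⟧
      trace-collision x x′ with x ≟F x′
      ... | yes refl = trans (∑-cong (λ a → ⟦⟧-yes (tr (a *F x) ≟F tr (a *F x)) refl)) (trans (∑-const 1ℚ)
          (trans (*-identityʳ (ℕ→ℚ card)) (trans (cong ℕ→ℚ card≡q*M) (trans (ℕ→ℚ-* q M) (lem qℚ Mℚ)))))
        where
        lem : ∀ q m → q * m ≡ m + (q - 1ℚ) * m * 1ℚ
        lem = solve-∀ ℚ-ring
      ... | no x≢x′ = trans (∑-cong (λ a → ⟦⟧-cong (tr (a *F x′) ≟F tr (a *F x)) (tr (a *F d) ≟F 0F)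
          (λ e → trans (cong tr (expand a)) (tr-difference′ (a *F x) (a *F x′) (sym e)))
          (λ e → sym (tr-difference (a *F x) (a *F x′) (trans (cong tr (sym (expand a))) e)))))
          (trans (∑-scaleʳ d≢0 (λ a → ⟦ tr a ≟F 0F ⟧)) (trans (fibre≡M 0-inSubfield) (lem qℚ Mℚ)))
        where
        d = x +F -F x′
        d≢0 : d ≢ 0F
        d≢0 e = x≢x′ (difference-0 e)
        expand : ∀ a → a *F d ≡ a *F x +F -F (a *F x′)
        expand a = trans (FR.distribˡ a x _) (cong (a *F x +F_) (sym (-‿distribʳ-* a x′)))
        0-inSubfield : InSubfield 0F
        0-inSubfield = 0^F q (ℕₚ.≤-trans (s≤s z≤n) 2≤q)
        lem : ∀ q m → m ≡ m + (q - 1ℚ) * m * 0ℚ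
        lem = solve-∀ ℚ-ring

      -- Summing over `b` merges the two trace conditions into one equation between traces. Its
      -- number of solutions `a` has a constant part, which yields the square of `∑ h`, and a part
      -- supported on collisions, which yields `V`.
      ∑S : ∑ S ≡ Mℚ * (∑ h * ∑ h) + (qℚ - 1ℚ) * Mℚ * V
      ∑S = begin
        ∑ (λ b → ∑ (λ a → T b a * T b a))
          ≡⟨ ∑-swap (λ b a → T b a * T b a) ⟩
        ∑ (λ a → ∑ (λ b → T b a * T b a))
          ≡⟨ ∑-cong square ⟩
        ∑ (λ a → ∑ (λ y → ∑ (λ y′ → h y * h y′ * ⟦ tr (a *F u y′) ≟F tr (a *F u y) ⟧)))
          ≡⟨ trans (∑-swap (λ a y → ∑ (λ y′ → h y * h y′ * ⟦ tr (a *F u y′) ≟F tr (a *F u y) ⟧)))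
               (∑-cong (λ y → ∑-swap (λ a y′ → h y * h y′ * ⟦ tr (a *F u y′) ≟F tr (a *F u y) ⟧))) ⟩
        ∑ (λ y → ∑ (λ y′ → ∑ (λ a → h y * h y′ * ⟦ tr (a *F u y′) ≟F tr (a *F u y) ⟧)))
          ≡⟨ ∑∑-cong (λ y y′ → trans (∑-*ˡ (h y * h y′) (λ a → ⟦ tr (a *F u y′) ≟F tr (a *F u y) ⟧))
               (trans (cong (h y * h y′ *_) (trace-collision (u y) (u y′))) (lem (h y * h y′) Mℚ ((qℚ - 1ℚ) * Mℚ) ⟦ u y ≟F u y′ ⟧))) ⟩
        ∑ (λ y → ∑ (λ y′ → Mℚ * (h y * h y′) + (qℚ - 1ℚ) * Mℚ * (⟦ u y ≟F u y′ ⟧ * (h y * h y′))))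
          ≡⟨ trans (∑-cong (λ y → trans (∑-+ (λ y′ → Mℚ * (h y * h y′)) (λ y′ → (qℚ - 1ℚ) * Mℚ * (⟦ u y ≟F u y′ ⟧ * (h y * h y′))))
               (cong₂ _+_ (∑-*ˡ Mℚ (λ y′ → h y * h y′)) (∑-*ˡ ((qℚ - 1ℚ) * Mℚ) (λ y′ → ⟦ u y ≟F u y′ ⟧ * (h y * h y′))))))
               (∑-+ (λ y → Mℚ * ∑ (λ y′ → h y * h y′)) (λ y → (qℚ - 1ℚ) * Mℚ * ∑ (λ y′ → ⟦ u y ≟F u y′ ⟧ * (h y * h y′)))) ⟩
        ∑ (λ y → Mℚ * ∑ (λ y′ → h y * h y′)) + ∑ (λ y → (qℚ - 1ℚ) * Mℚ * ∑ (λ y′ → ⟦ u y ≟F u y′ ⟧ * (h y * h y′)))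
          ≡⟨ cong₂ _+_ (trans (∑-*ˡ Mℚ (λ y → ∑ (λ y′ → h y * h y′))) (cong (Mℚ *_) (sym (∑-*-∑ h h))))
               (∑-*ˡ ((qℚ - 1ℚ) * Mℚ) (λ y → ∑ (λ y′ → ⟦ u y ≟F u y′ ⟧ * (h y * h y′)))) ⟩
        Mℚ * (∑ h * ∑ h) + (qℚ - 1ℚ) * Mℚ * V ∎
        where
        open ≡-Reasoning
        lem : ∀ x m c d → x * (m + c * d) ≡ m * x + c * (d * x)
        lem = solve-∀ ℚ-ring
        rearrange : ∀ a b c d → (a * b) * (c * d) ≡ b * (a * c * d)
        rearrange = solve-∀ ℚ-ring
        square : ∀ a → ∑ (λ b → T b a * T b a) ≡ ∑ (λ y → ∑ (λ y′ → h y * h y′ * ⟦ tr (a *F u y′) ≟F tr (a *F u y) ⟧))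
        square a = trans (∑-cong (λ b → ∑-*-∑ (λ y → h y * ⟦ tr (a *F u y) ≟F b ⟧) (λ y → h y * ⟦ tr (a *F u y) ≟F b ⟧)))
          (trans (∑-swap (λ b y → ∑ (λ y′ → (h y * ⟦ tr (a *F u y) ≟F b ⟧) * (h y′ * ⟦ tr (a *F u y′) ≟F b ⟧))))
          (∑-cong (λ y → trans (∑-swap (λ b y′ → (h y * ⟦ tr (a *F u y) ≟F b ⟧) * (h y′ * ⟦ tr (a *F u y′) ≟F b ⟧)))
          (∑-cong (λ y′ → trans (∑-cong (λ b → trans (rearrange (h y) ⟦ tr (a *F u y) ≟F b ⟧ (h y′) ⟦ tr (a *F u y′) ≟F b ⟧)
            (cong (_* (h y * h y′ * ⟦ tr (a *F u y′) ≟F b ⟧)) (⟦⟧-cong (tr (a *F u y) ≟F b) (b ≟F tr (a *F u y)) sym sym))))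
            (∑-single (tr (a *F u y)) (λ b → h y * h y′ * ⟦ tr (a *F u y′) ≟F b ⟧)))))))

      -- With `c = β / b` in the subfield, `a ↦ c a` permutes the field and carries the condition
      -- for `b` to that for `β`.
      S-subfield : ∀ {b} → InSubfield b → b ≢ 0F → S b ≡ S β
      S-subfield {b} hb b≢0 = trans (∑-cong (λ a → cong (λ t → t * t) (T-scale a))) (∑-scale c≢0 (λ a → T β a * T β a))
        where
        c = β *F b ⁻¹
        c≢0 : c ≢ 0F
        c≢0 = *-≢0 β≢0 (⁻¹-≢0 b≢0)
        hc : InSubfield c
        hc = subfield-* β-inSubfield (subfield-⁻¹ b≢0 hb)
        cb≡β : c *F b ≡ β
        cb≡β = *-⁻¹-cancelʳ b≢0 β
        eq : ∀ a y → tr ((c *F a) *F u y) ≡ c *F tr (a *F u y)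
        eq a y = trans (cong tr (FR.*-assoc c a (u y))) (tr-* hc (a *F u y))
        T-scale : ∀ a → T b a ≡ T β (c *F a)
        T-scale a = ∑-cong (λ y → cong (h y *_) (⟦⟧-cong (tr (a *F u y) ≟F b) (tr ((c *F a) *F u y) ≟F β)
          (λ e → trans (eq a y) (trans (cong (c *F_) e) cb≡β))
          (λ e → *F-cancelˡ c≢0 (trans (sym (eq a y)) (trans e (sym cb≡β))))))

      S-lower : S 0F + (qℚ - 1ℚ) * S β ≤ ∑ S
      S-lower = ≤-trans (≤-reflexive (sym total)) (∑-mono pointwise)
        where
        -- `S β` at each of the `q` elements of the subfield, corrected to `S 0F` at 0, and the
        -- trivial bound 0 elsewhere.
        lower : Carrier → ℚ
        lower b = ⟦ b ≟F 0F ⟧ * S 0F + (S β * ⟦ inSubfield? b ⟧ - ⟦ b ≟F 0F ⟧ * S β)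
        total : ∑ lower ≡ S 0F + (qℚ - 1ℚ) * S β
        total = trans (∑-+ (λ b → ⟦ b ≟F 0F ⟧ * S 0F) (λ b → S β * ⟦ inSubfield? b ⟧ - ⟦ b ≟F 0F ⟧ * S β))
          (trans (cong₂ _+_ (∑-single 0F (λ _ → S 0F)) (trans (∑-- (λ b → S β * ⟦ inSubfield? b ⟧) (λ b → ⟦ b ≟F 0F ⟧ * S β))
            (cong₂ _-_ (trans (∑-*ˡ (S β) (λ b → ⟦ inSubfield? b ⟧)) (cong (S β *_) subfieldSize≡q)) (∑-single 0F (λ _ → S β)))))
          (lem (S 0F) (S β) qℚ))
          where
          lem : ∀ a b q → a + (b * q - b) ≡ a + (q - 1ℚ) * b
          lem = solve-∀ ℚ-ring
        pointwise : ∀ b → lower b ≤ S b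
        pointwise b with b ≟F 0F
        ... | yes refl = ≤-reflexive (trans (cong (λ t → 1ℚ * S 0F + (S β * t - 1ℚ * S β))
                (⟦⟧-yes (inSubfield? 0F) (0^F q (ℕₚ.≤-trans (s≤s z≤n) 2≤q)))) (lem (S 0F) (S β)))
          where
          lem : ∀ a b → 1ℚ * a + (b * 1ℚ - 1ℚ * b) ≡ a
          lem = solve-∀ ℚ-ring
        ... | no b≢0 with inSubfield? b
        ...   | yes hb = ≤-reflexive (trans (lem (S 0F) (S β)) (sym (S-subfield hb b≢0)))
          where
          lem : ∀ a b → 0ℚ * a + (b * 1ℚ - 0ℚ * b) ≡ b
          lem = solve-∀ ℚ-ring
        ...   | no _ = ≤-trans (≤-reflexive (lem (S 0F) (S β))) (0≤S b)
          where
          lem : ∀ a b → 0ℚ * a + (b * 0ℚ - 0ℚ * b) ≡ 0ℚ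
          lem = solve-∀ ℚ-ring

      S-lower-V : ∑ h ≡ 0ℚ → S 0F + (qℚ - 1ℚ) * S β ≤ (qℚ - 1ℚ) * (Mℚ * V)
      S-lower-V ∑h≡0 = ≤-trans S-lower (≤-reflexive (trans ∑S (trans (cong (λ t → Mℚ * (t * t) + (qℚ - 1ℚ) * Mℚ * V) ∑h≡0) (lem qℚ Mℚ V))))
        where
        lem : ∀ q m v → m * (0ℚ * 0ℚ) + (q - 1ℚ) * m * v ≡ (q - 1ℚ) * (m * v)
        lem = solve-∀ ℚ-ring

      -- After `S 0F` is dropped, `q - 1` equal shares `S β` face the factor `q - 1` in front of
      -- `V`.
      S-bound : ∑ h ≡ 0ℚ → S β ≤ Mℚ * V
      S-bound ∑h≡0 = *-cancel-≤ 0<q-1 (≤-trans (≤-by (0≤S 0F) (lem (S 0F) ((qℚ - 1ℚ) * S β))) (S-lower-V ∑h≡0))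
        where
        lem : ∀ a b → a ≡ (a + b) - b
        lem = solve-∀ ℚ-ring

    module _ (h : Carrier → ℚ) where
      open SecondMoment (λ y → y) h

      V-id : V ≡ ∑ (λ y → h y * h y)
      V-id = ∑-cong (λ y → trans (∑-cong (λ y′ → cong (_* (h y * h y′)) (⟦⟧-cong (y ≟F y′) (y′ ≟F y) sym sym)))
        (∑-single y (λ y′ → h y * h y′)))

      -- For a subfield-invariant h all T b with b ≠ 0 agree, so T 0 = - (q - 1) T β and S 0 takes its full share of the second moment.
      S-bound-invariant : ∑ h ≡ 0ℚ → (∀ {c} → InSubfield c → c ≢ 0F → ∀ y → h (y *F c) ≡ h y) → qℚ * S β ≤ Mℚ * ∑ (λ y → h y * h y)
      S-bound-invariant ∑h≡0 invariant = *-cancel-≤ 0<q-1 (≤-trans (≤-reflexive (trans (lem qℚ (S β)) (cong (_+ (qℚ - 1ℚ) * S β) (sym S0))))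
        (≤-trans (S-lower-V ∑h≡0) (≤-reflexive (cong (λ v → (qℚ - 1ℚ) * (Mℚ * v)) V-id))))
        where
        lem : ∀ q s → (q - 1ℚ) * (q * s) ≡ ((q - 1ℚ) * (q - 1ℚ)) * s + (q - 1ℚ) * s
        lem = solve-∀ ℚ-ring
        T-subfield : ∀ a {b} → InSubfield b → b ≢ 0F → T b a ≡ T β a
        T-subfield a {b} hb b≢0 = trans (sym (∑-scaleʳ c≢0 (λ y → h y * ⟦ tr (a *F y) ≟F b ⟧)))
          (∑-cong (λ y → cong₂ _*_ (invariant hc c≢0 y) (⟦⟧-cong (tr (a *F (y *F c)) ≟F b) (tr (a *F y) ≟F β)
            (λ e → *F-cancelˡ c≢0 (trans (sym (eq y)) (trans e (sym cβ≡b))))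
            (λ e → trans (eq y) (trans (cong (c *F_) e) cβ≡b)))))
          where
          c = b *F β ⁻¹
          c≢0 : c ≢ 0F
          c≢0 = *-≢0 b≢0 (⁻¹-≢0 β≢0)
          hc : InSubfield c
          hc = subfield-* hb (subfield-⁻¹ β≢0 β-inSubfield)
          cβ≡b : c *F β ≡ b
          cβ≡b = *-⁻¹-cancelʳ β≢0 b
          eq : ∀ y → tr (a *F (y *F c)) ≡ c *F tr (a *F y)
          eq y = trans (cong tr (trans (sym (FR.*-assoc a y c)) (FR.*-comm (a *F y) c))) (tr-* hc (a *F y))
        -- Each `y` is counted for the single value `b = tr (a y)`, so the total is `∑ h`.
        ∑T : ∀ a → ∑ (λ b → T b a) ≡ 0ℚ
        ∑T a = trans (∑-swap (λ b y → h y * ⟦ tr (a *F y) ≟F b ⟧)) (trans (∑-cong (λ y → trans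
          (∑-cong (λ b → trans (*-comm (h y) ⟦ tr (a *F y) ≟F b ⟧) (cong (_* h y) (⟦⟧-cong (tr (a *F y) ≟F b) (b ≟F tr (a *F y)) sym sym))))
          (∑-single (tr (a *F y)) (λ _ → h y)))) ∑h≡0)
        T-split : ∀ a b → T b a ≡ ⟦ b ≟F 0F ⟧ * T 0F a + (T β a * ⟦ inSubfield? b ⟧ - ⟦ b ≟F 0F ⟧ * T β a)
        T-split a b with b ≟F 0F
        ... | yes refl = sym (trans (cong (λ t → 1ℚ * T 0F a + (T β a * t - 1ℚ * T β a))
                (⟦⟧-yes (inSubfield? 0F) (0^F q (ℕₚ.≤-trans (s≤s z≤n) 2≤q)))) (lem′ (T 0F a) (T β a)))
          where
          lem′ : ∀ a b → 1ℚ * a + (b * 1ℚ - 1ℚ * b) ≡ a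
          lem′ = solve-∀ ℚ-ring
        ... | no b≢0 with inSubfield? b
        ...   | yes hb = trans (T-subfield a hb b≢0) (lem′ (T 0F a) (T β a))
          where
          lem′ : ∀ a b → b ≡ 0ℚ * a + (b * 1ℚ - 0ℚ * b)
          lem′ = solve-∀ ℚ-ring
        ...   | no ¬hb = trans (trans (∑-cong (λ y → trans (cong (h y *_) (⟦⟧-no (tr (a *F y) ≟F b) (λ { refl → ¬hb (tr-inSubfield (a *F y)) })))
                    (*-zeroʳ (h y)))) ∑-zero) (lem′ (T 0F a) (T β a))
          where
          lem′ : ∀ a b → 0ℚ ≡ 0ℚ * a + (b * 0ℚ - 0ℚ * b)
          lem′ = solve-∀ ℚ-ring
        T0 : ∀ a → T 0F a ≡ - ((qℚ - 1ℚ) * T β a)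
        T0 a = trans (lem′ (T 0F a) ((qℚ - 1ℚ) * T β a)) (trans (cong (_- (qℚ - 1ℚ) * T β a) (trans (sym total) (∑T a))) (+-identityˡ (- ((qℚ - 1ℚ) * T β a))))
          where
          lem′ : ∀ a b → a ≡ (a + b) - b
          lem′ = solve-∀ ℚ-ring
          lem₂ : ∀ a b q → a + (b * q - b) ≡ a + (q - 1ℚ) * b
          lem₂ = solve-∀ ℚ-ring
          total : ∑ (λ b → T b a) ≡ T 0F a + (qℚ - 1ℚ) * T β a
          total = trans (∑-cong (T-split a)) (trans (∑-+ (λ b → ⟦ b ≟F 0F ⟧ * T 0F a) (λ b → T β a * ⟦ inSubfield? b ⟧ - ⟦ b ≟F 0F ⟧ * T β a))
            (trans (cong₂ _+_ (∑-single 0F (λ _ → T 0F a)) (trans (∑-- (λ b → T β a * ⟦ inSubfield? b ⟧) (λ b → ⟦ b ≟F 0F ⟧ * T β a))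
              (cong₂ _-_ (trans (∑-*ˡ (T β a) (λ b → ⟦ inSubfield? b ⟧)) (cong (T β a *_) subfieldSize≡q)) (∑-single 0F (λ _ → T β a)))))
            (lem₂ (T 0F a) (T β a) qℚ)))
        S0 : S 0F ≡ ((qℚ - 1ℚ) * (qℚ - 1ℚ)) * S β
        S0 = trans (∑-cong (λ a → trans (cong (λ t → t * t) (T0 a)) (lem′ (qℚ - 1ℚ) (T β a)))) (∑-*ˡ ((qℚ - 1ℚ) * (qℚ - 1ℚ)) (λ a → T β a * T β a))
          where
          lem′ : ∀ c t → (- (c * t)) * (- (c * t)) ≡ (c * c) * (t * t)
          lem′ = solve-∀ ℚ-ring

  -- Bounds for the sums `E D` and `B D`

  module Bounds (F : FiniteField) (q n : ℕ) (q-primePower : IsPrimePower q) (1≤n : 1 ℕ.≤ n)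
    (card≡ : FiniteField.card F ≡ q ^ n) (β : FiniteField.Carrier F)
    (β-inSubfield : FiniteField._^F_ F β q ≡ β) (β≢0 : β ≢ FiniteField.0F F)
    (Q : ℕ) (Q-* : Q ℕ.* (q ∸ 1) ≡ FiniteField.card F ∸ 1) (Q-odd : ¬ (2 ∣ Q)) (2∣N : 2 ∣ FiniteField.card F ∸ 1) where

    open Moments F q n q-primePower 1≤n card≡ β β-inSubfield β≢0 public

    Nℚ : ℚ
    Nℚ = ℕ→ℚ N

    convolution′ : ∀ {D} → Distinct D → ∀ x → ∑ (λ z → f D (x *F z ⁻¹) * f D z) ≡ σ D * κ D * Nℚ * f D x
    convolution′ {D} dist x = case (x ≟F 0F)
      where
      case : Dec (x ≡ 0F) → ∑ (λ z → f D (x *F z ⁻¹) * f D z) ≡ σ D * κ D * Nℚ * f D x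
      case (no x≢0) = convolution dist x≢0
      case (yes refl) = trans (∑-cong (λ z → trans (cong (_* f D z) (f-≡0 D (FR.zeroˡ (z ⁻¹)))) (*-zeroˡ (f D z))))
        (trans ∑-zero (sym (trans (cong (σ D * κ D * Nℚ *_) (f-0 D)) (*-zeroʳ (σ D * κ D * Nℚ)))))

    -- f D reproduces itself under convolution, so ∑ (v - σ E f)² ≥ 0 with v x = ∑ f(ξ) τ(x ξ) bounds E² by the mean square of v.
    completed-square : ∀ {D} → Distinct D → ∀ (τ : Carrier → ℚ) →
      let E = ∑ (λ ξ → f D ξ * τ ξ)
          v = λ x → ∑ (λ ξ → f D ξ * τ (x *F ξ))
      in κ D * Nℚ * (E * E) ≤ ∑ (λ x → v x * v x)
    completed-square {D} dist τ = ≤-by (0≤∑ (λ x → 0≤-sq (v x - l * f D x))) (begin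
      ∑ (λ x → (v x - l * f D x) * (v x - l * f D x))
        ≡⟨ ∑-cong (λ x → expand (v x) l (f D x)) ⟩
      ∑ (λ x → (v x * v x - (l + l) * (f D x * v x)) + l * l * (f D x * f D x))
        ≡⟨ trans (∑-+ (λ x → v x * v x - (l + l) * (f D x * v x)) (λ x → l * l * (f D x * f D x)))
            (cong₂ _+_ (trans (∑-- (λ x → v x * v x) (λ x → (l + l) * (f D x * v x)))
                (cong (λ u → ∑ (λ x → v x * v x) - u) (trans (∑-*ˡ (l + l) (λ x → f D x * v x)) (cong ((l + l) *_) ∑fv))))
              (trans (∑-*ˡ (l * l) (λ x → f D x * f D x)) (cong (l * l *_) (∑f² dist)))) ⟩
      (∑ (λ x → v x * v x) - (l + l) * (σ D * κ D * Nℚ * E)) + l * l * (κ D * Nℚ)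
        ≡⟨ collect (∑ (λ x → v x * v x)) (σ D) E (κ D) Nℚ ⟩
      ∑ (λ x → v x * v x) - (σ D * σ D) * (κ D * Nℚ * (E * E))
        ≡⟨ cong (λ u → ∑ (λ x → v x * v x) - u) (trans (cong (_* (κ D * Nℚ * (E * E))) (σ² D)) (*-identityˡ (κ D * Nℚ * (E * E)))) ⟩
      ∑ (λ x → v x * v x) - κ D * Nℚ * (E * E) ∎)
      where
      open ≡-Reasoning
      E l : ℚ
      E = ∑ (λ ξ → f D ξ * τ ξ)
      -- The coefficient of the orthogonal projection of `v` onto `f D`, because `∑ f v = σ κ N E`
      -- and `∑ f² = κ N`.
      l = σ D * E
      v : Carrier → ℚ
      v x = ∑ (λ ξ → f D ξ * τ (x *F ξ))
      expand : ∀ v l f → (v - l * f) * (v - l * f) ≡ (v * v - (l + l) * (f * v)) + l * l * (f * f)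
      expand = solve-∀ ℚ-ring
      collect : ∀ s σ e k n → (s - (σ * e + σ * e) * (σ * k * n * e)) + (σ * e) * (σ * e) * (k * n) ≡ s - (σ * σ) * (k * n * (e * e))
      collect = solve-∀ ℚ-ring
      shift : ∀ x → f D x * v x ≡ ∑ (λ ξ → τ ξ * (f D (ξ *F x ⁻¹) * f D x))
      shift x = case (x ≟F 0F)
        where
        case : Dec (x ≡ 0F) → f D x * v x ≡ ∑ (λ ξ → τ ξ * (f D (ξ *F x ⁻¹) * f D x))
        case (yes refl) = trans (cong (_* v 0F) (f-0 D)) (trans (*-zeroˡ (v 0F)) (sym (trans (∑-cong (λ ξ →
          trans (cong (λ t → τ ξ * (f D (ξ *F 0F ⁻¹) * t)) (f-0 D)) (lem (τ ξ) (f D (ξ *F 0F ⁻¹))))) ∑-zero)))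
          where
          lem : ∀ a b → a * (b * 0ℚ) ≡ 0ℚ
          lem = solve-∀ ℚ-ring
        -- Substituting `ξ / x` for `ξ` moves `x` out of `τ` and into `f D`.
        case (no x≢0) = trans (sym (∑-*ˡ (f D x) (λ ξ → f D ξ * τ (x *F ξ)))) (trans (sym (∑-scale (⁻¹-≢0 x≢0) (λ ξ → f D x * (f D ξ * τ (x *F ξ)))))
          (∑-cong (λ ξ → trans (cong₂ (λ s t → f D x * (f D s * τ t)) (FR.*-comm (x ⁻¹) ξ) (*-⁻¹-cancelˡ x≢0 ξ)) (lem (f D x) (f D (ξ *F x ⁻¹)) (τ ξ)))))
          where
          lem : ∀ a b c → a * (b * c) ≡ c * (b * a)
          lem = solve-∀ ℚ-ring
      ∑fv : ∑ (λ x → f D x * v x) ≡ σ D * κ D * Nℚ * E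
      ∑fv = trans (∑-cong shift) (trans (∑-swap (λ x ξ → τ ξ * (f D (ξ *F x ⁻¹) * f D x)))
        (trans (∑-cong (λ ξ → trans (∑-*ˡ (τ ξ) (λ x → f D (ξ *F x ⁻¹) * f D x)) (trans (cong (τ ξ *_) (convolution′ dist ξ)) (lem (τ ξ) (σ D * κ D * Nℚ) (f D ξ)))))
          (∑-*ˡ (σ D * κ D * Nℚ) (λ ξ → f D ξ * τ ξ))))
        where
        lem : ∀ a b c → a * (b * c) ≡ b * (c * a)
        lem = solve-∀ ℚ-ring

    τ₁ τ₂ : Carrier → ℚ
    τ₁ y = ⟦ tr y ≟F β ⟧
    τ₂ ξ = ⟦ tr (ξ *F ξ) ≟F β ⟧

    E B : List ℕ → ℚ
    E D = ∑ (λ ξ → f D ξ * τ₂ ξ)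
    B D = ∑ (λ y → f D y * τ₁ y)

    module L (D : List ℕ) = SecondMoment (λ y → y) (f D)
    module S₂ (D : List ℕ) = SecondMoment (λ y → y *F y) (f D)

    private
      cancel-κN : ∀ {D a b} → Distinct D → κ D * Nℚ * a ≤ b * (κ D * Nℚ) → a ≤ b
      cancel-κN {D} {a} {b} dist h = *-cancel-≤ (0<κN dist) (≤-trans h (≤-reflexive (*-comm b (κ D * Nℚ))))

    -- The completed square and the second moment both carry the factor `∑ f² = κ N`. It cancels,
    -- which makes the bound independent of the primes.
    B-bound : ∀ {p D} → Distinct (p ∷ D) → B (p ∷ D) * B (p ∷ D) ≤ Mℚ
    B-bound {p} {D} dist = cancel-κN dist (≤-trans (completed-square dist τ₁)
      (≤-trans (L.S-bound (p ∷ D) (∑f≡0 dist)) (≤-reflexive (cong (Mℚ *_) (trans (V-id (f (p ∷ D))) (∑f² dist))))))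

    qB-bound : ∀ {p D} → Distinct (p ∷ D) → (∀ {c} → InSubfield c → c ≢ 0F → ∀ y → f (p ∷ D) (y *F c) ≡ f (p ∷ D) y) →
      qℚ * (B (p ∷ D) * B (p ∷ D)) ≤ Mℚ
    qB-bound {p} {D} dist invariant = cancel-κN dist (≤-trans (≤-reflexive (lem (κ (p ∷ D) * Nℚ) qℚ (B (p ∷ D) * B (p ∷ D))))
      (≤-trans (*-monoˡ-≤ (0≤ℕ→ℚ q) (completed-square dist τ₁))
      (≤-trans (S-bound-invariant (f (p ∷ D)) (∑f≡0 dist) invariant) (≤-reflexive (cong (Mℚ *_) (∑f² dist))))))
      where
      lem : ∀ a b c → a * (b * c) ≡ b * (a * c)
      lem = solve-∀ ℚ-ring

    square-roots≤2 : ∀ y → ∑ (λ x → ⟦ x *F x ≟F y ⟧) ≤ ℕ→ℚ 2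
    square-roots≤2 y = ≤-trans (∑-mono (λ x → ⟦⟧-mono (x *F x ≟F y) (x ^F 2 ≟F y) (trans (cong (x *F_) (FR.*-identityʳ x)))))
      (monic-fibre y (s≤s z≤n) (monic-^ 2))

    ∑-squares : ∀ G → (∀ x → 0ℚ ≤ G x) → ∑ (λ x → G (x *F x)) ≤ ℕ→ℚ 2 * ∑ G
    ∑-squares G 0≤G = ≤-trans (≤-reflexive (trans (∑-cong (λ x → sym (∑-single (x *F x) G)))
      (trans (∑-swap (λ x a → ⟦ a ≟F x *F x ⟧ * G a)) (∑-cong (λ a → trans (∑-cong (λ x → trans (*-comm ⟦ a ≟F x *F x ⟧ (G a))
        (cong (G a *_) (⟦⟧-cong (a ≟F x *F x) (x *F x ≟F a) sym sym)))) (∑-*ˡ (G a) (λ x → ⟦ x *F x ≟F a ⟧)))))))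
      (≤-trans (∑-mono (λ a → ≤-trans (*-monoˡ-≤ (0≤G a) (square-roots≤2 a)) (≤-reflexive (*-comm (G a) (ℕ→ℚ 2))))) (≤-reflexive (∑-*ˡ (ℕ→ℚ 2) G)))

    -- On each collision `2 f(y) f(y′) ≤ f(y)² + f(y′)²`, and at most two elements share a given
    -- square.
    V-squares : ∀ D → S₂.V D ≤ ℕ→ℚ 2 * ∑ (λ y → f D y * f D y)
    V-squares D = *-cancel-≤ {ℕ→ℚ 2} (ℕ→ℚ-pos 1) (≤-trans (≤-reflexive (sym (∑-*ˡ (ℕ→ℚ 2) (λ y → ∑ (collide y)))))
      (≤-trans (∑-mono (λ y → ≤-trans (≤-reflexive (sym (∑-*ˡ (ℕ→ℚ 2) (collide y)))) (∑-mono (λ y′ → amgm ⟦ y *F y ≟F y′ *F y′ ⟧ (f D y) (f D y′) (0≤⟦⟧ (y *F y ≟F y′ *F y′))))))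
      (≤-trans (≤-reflexive (trans (∑-cong (λ y → ∑-+ (λ y′ → (f D y * f D y) * ⟦ y *F y ≟F y′ *F y′ ⟧) (λ y′ → (f D y′ * f D y′) * ⟦ y *F y ≟F y′ *F y′ ⟧)))
          (∑-+ (λ y → ∑ (λ y′ → (f D y * f D y) * ⟦ y *F y ≟F y′ *F y′ ⟧)) (λ y → ∑ (λ y′ → (f D y′ * f D y′) * ⟦ y *F y ≟F y′ *F y′ ⟧)))))
        (≤-trans (+-mono-≤ (∑-mono left) (≤-trans (≤-reflexive (∑-swap (λ y y′ → (f D y′ * f D y′) * ⟦ y *F y ≟F y′ *F y′ ⟧))) (∑-mono right)))
          (≤-reflexive (trans (cong₂ _+_ sums sums) (lem (∑ (λ y → f D y * f D y)))))))))
      where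
      collide : Carrier → Carrier → ℚ
      collide y y′ = ⟦ y *F y ≟F y′ *F y′ ⟧ * (f D y * f D y′)
      amgm : ∀ i a b → 0ℚ ≤ i → ℕ→ℚ 2 * (i * (a * b)) ≤ (a * a) * i + (b * b) * i
      amgm i a b 0≤i = ≤-by (0≤-* 0≤i (0≤-sq (a - b))) (lem₁ i a b)
        where
        lem₁ : ∀ i a b → i * ((a - b) * (a - b)) ≡ ((a * a) * i + (b * b) * i) - (1ℚ + 1ℚ) * (i * (a * b))
        lem₁ = solve-∀ ℚ-ring
      sums : ∑ (λ y → (f D y * f D y) * ℕ→ℚ 2) ≡ ℕ→ℚ 2 * ∑ (λ y → f D y * f D y)
      sums = trans (∑-cong (λ y → *-comm (f D y * f D y) (ℕ→ℚ 2))) (∑-*ˡ (ℕ→ℚ 2) (λ y → f D y * f D y))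
      lem : ∀ s → (1ℚ + 1ℚ) * s + (1ℚ + 1ℚ) * s ≡ (1ℚ + 1ℚ) * ((1ℚ + 1ℚ) * s)
      lem = solve-∀ ℚ-ring
      left : ∀ y → ∑ (λ y′ → (f D y * f D y) * ⟦ y *F y ≟F y′ *F y′ ⟧) ≤ (f D y * f D y) * ℕ→ℚ 2
      left y = ≤-trans (≤-reflexive (trans (∑-*ˡ (f D y * f D y) (λ y′ → ⟦ y *F y ≟F y′ *F y′ ⟧))
        (cong (f D y * f D y *_) (∑-cong (λ y′ → ⟦⟧-cong (y *F y ≟F y′ *F y′) (y′ *F y′ ≟F y *F y) sym sym)))))
        (*-monoˡ-≤ (0≤-sq (f D y)) (square-roots≤2 (y *F y)))
      right : ∀ y′ → ∑ (λ y → (f D y′ * f D y′) * ⟦ y *F y ≟F y′ *F y′ ⟧) ≤ (f D y′ * f D y′) * ℕ→ℚ 2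
      right y′ = ≤-trans (≤-reflexive (∑-*ˡ (f D y′ * f D y′) (λ y → ⟦ y *F y ≟F y′ *F y′ ⟧)))
        (*-monoˡ-≤ (0≤-sq (f D y′)) (square-roots≤2 (y′ *F y′)))

    -- Since `(x ξ)² = x² ξ²`, the mean square runs over the values `a = x²`, each taken at most
    -- twice. The other factor 2 in the constant 4 comes from the collisions counted by `V`.
    E-bound : ∀ {p D} → Distinct (p ∷ D) → E (p ∷ D) * E (p ∷ D) ≤ ℕ→ℚ 4 * Mℚ
    E-bound {p} {D} dist = cancel-κN dist (≤-trans (completed-square dist τ₂)
      (≤-trans (≤-reflexive (∑-cong (λ x → cong (λ t → t * t) (∑-cong (λ ξ → cong (λ s → f D′ ξ * ⟦ tr s ≟F β ⟧) (interchange x ξ))))))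
      (≤-trans (∑-squares (λ a → S₂.T D′ β a * S₂.T D′ β a) (λ a → 0≤-sq (S₂.T D′ β a)))
      (≤-trans (*-monoˡ-≤ (0≤ℕ→ℚ 2) (≤-trans (S₂.S-bound D′ (∑f≡0 dist)) (*-monoˡ-≤ (0≤ℕ→ℚ M) (V-squares D′))))
        (≤-reflexive (trans (cong (λ t → ℕ→ℚ 2 * (Mℚ * (ℕ→ℚ 2 * t))) (∑f² dist)) (lem Mℚ (κ D′ * Nℚ))))))))
      where
      D′ = p ∷ D
      interchange : ∀ x ξ → (x *F ξ) *F (x *F ξ) ≡ (x *F x) *F (ξ *F ξ)
      interchange = F-solve 2 (λ a b → ((a :* b) :* (a :* b)) := ((a :* a) :* (b :* b))) refl
      lem : ∀ m k → (1ℚ + 1ℚ) * (m * ((1ℚ + 1ℚ) * k)) ≡ ((1ℚ + 1ℚ) * (1ℚ + 1ℚ) * m) * k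
      lem = solve-∀ ℚ-ring

  -- The sieve and its error terms

  Within : ℚ → ℚ → Set
  Within x c = (- c ≤ x) × (x ≤ c)

  within-square : ∀ {x c} → 0ℚ ≤ c → x * x ≤ c * c → Within x c
  within-square h p = square-cancel-≥ h p , square-cancel-≤ h p

  within-+ : ∀ {x y c d} → Within x c → Within y d → Within (x + y) (c + d)
  within-+ {c = c} {d} (a , b) (a′ , b′) = ≤-trans (≤-reflexive (neg-distrib-+ c d)) (+-mono-≤ a a′) , +-mono-≤ b b′

  within-resp : ∀ {x y c d} → x ≡ y → c ≡ d → Within x c → Within y d
  within-resp refl refl h = h

  pow2 : List ℕ → ℚ
  pow2 [] = 1ℚ
  pow2 (p ∷ K) = pow2 K + pow2 K

  pow2Q : ℕ → List ℕ → ℚ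
  pow2Q Q [] = 1ℚ
  pow2Q Q (p ∷ K) with p ∣? Q
  ... | yes _ = pow2Q Q K + pow2Q Q K
  ... | no _ = pow2Q Q K

  θ : ℕ → ℚ
  θ p = 1ℚ - recip p

  recip≤1 : ∀ {p} → Prime p → recip p ≤ 1ℚ
  recip≤1 {p} p-prime = *-cancel-≤ (0<ℕ→ℚ-prime p-prime) (≤-trans (≤-reflexive (recip-inverse p 1≤p))
    (≤-trans (ℕ→ℚ-mono-≤ {1} {p} 1≤p) (≤-reflexive (sym (*-identityʳ (ℕ→ℚ p))))))
    where
    1≤p = ℕₚ.≤-trans (s≤s z≤n) (2≤prime p-prime)

  0≤θ : ∀ {p} → Prime p → 0ℚ ≤ θ p
  0≤θ h = ≤⇒0≤- (recip≤1 h)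

  module Sieve (F : FiniteField) (q n : ℕ) (q-primePower : IsPrimePower q) (1≤n : 1 ℕ.≤ n)
    (card≡ : FiniteField.card F ≡ q ^ n) (β : FiniteField.Carrier F)
    (β-inSubfield : FiniteField._^F_ F β q ≡ β) (β≢0 : β ≢ FiniteField.0F F)
    (Q : ℕ) (Q-* : Q ℕ.* (q ∸ 1) ≡ FiniteField.card F ∸ 1) (Q-odd : ¬ (2 ∣ Q)) (2∣N : 2 ∣ FiniteField.card F ∸ 1)
    (R C : ℚ) (R² : R * R ≡ ℕ→ℚ (q ^ (n ∸ 1))) (0<R : 0ℚ < R) (1≤C : 1ℚ ≤ C)
    -- This is `3/2 + 3/q ≤ C²` without denominators. `C` stays a parameter because two values of it
    -- are used.
    (C-bound : ℕ→ℚ 3 * ℕ→ℚ q + ℕ→ℚ 6 ≤ (ℕ→ℚ 2 * ℕ→ℚ q) * (C * C)) where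

    open Bounds F q n q-primePower 1≤n card≡ β β-inSubfield β≢0 Q Q-* Q-odd 2∣N public

    0≤R : 0ℚ ≤ R
    0≤R = <⇒≤ 0<R

    0≤C : 0ℚ ≤ C
    0≤C = ≤-trans 0≤1 1≤C

    0<q : 0ℚ < qℚ
    0<q = ℕ→ℚ-mono-< {0} (ℕₚ.≤-trans (s≤s z≤n) 2≤q)

    M≤C²M : Mℚ ≤ (C * R) * (C * R)
    M≤C²M = ≤-trans (≤-reflexive (sym (*-identityˡ Mℚ))) (≤-trans (*-monoʳ-≤-nonNeg Mℚ {{ℚ.nonNegative (0≤ℕ→ℚ M)}}
        (≤-trans 1≤C (≤-trans (≤-reflexive (sym (*-identityʳ C))) (*-monoˡ-≤ 0≤C 1≤C))))
      (≤-reflexive (trans (cong (C * C *_) (sym R²)) (lem C R))))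
      where
      lem : ∀ c r → (c * c) * (r * r) ≡ (c * r) * (c * r)
      lem = solve-∀ ℚ-ring

    primeDivisor-2 : PrimeDivisor 2
    primeDivisor-2 = prime[2] , 2∣N

    rootCount : Carrier → ℚ
    rootCount y = ∑ (λ x → ⟦ x *F x ≟F y ⟧)

    square-∈-kernel : ∀ {x} → x ≢ 0F → (x *F x) ^F cofactor 2 ≡ 1F
    square-∈-kernel {x} x≢0 = trans (cong (λ t → (x *F t) ^F cofactor 2) (sym (FR.*-identityʳ x)))
      (trans (sym (^F-* x 2 (cofactor 2))) (trans (cong (x ^F_) (trans (ℕₚ.*-comm 2 (cofactor 2)) (cofactor-* primeDivisor-2))) (fermat-N x≢0)))

    -- As `r 2 = 1`, the right side is 2 on the kernel and 0 off it, and nonzero squares lie in the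
    -- kernel.
    rootCount≤ : ∀ {y} → y ≢ 0F → rootCount y ≤ 1ℚ - g 2 y
    rootCount≤ {y} y≢0 with inKernel? 2 y
    ... | yes _ = square-roots≤2 y
    ... | no ∉kernel = ≤-reflexive (trans (∑-cong (λ x → ⟦⟧-no (x *F x ≟F y)
        (λ { refl → ∉kernel (square-∈-kernel (*-≢0ˡ y≢0)) }))) ∑-zero)

    -- Both sides count N over all y ≠ 0, so the inequality above is an equality everywhere.
    rootCount≡ : ∀ {y} → y ≢ 0F → rootCount y ≡ 1ℚ - g 2 y
    rootCount≡ {y} y≢0 = sym (trans (lem (1ℚ - g 2 y) (rootCount y)) (trans (cong (_+ rootCount y)
        (trans (sym (*-identityˡ (1ℚ - g 2 y - rootCount y))) (trans (cong (_* (1ℚ - g 2 y - rootCount y)) (sym (nz-≢0 y≢0))) (gap≡0 y))))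
      (+-identityˡ (rootCount y))))
      where
      lem : ∀ a b → a ≡ (a - b) + b
      lem = solve-∀ ℚ-ring
      gap≡0 : ∀ y → nz y * (1ℚ - g 2 y - rootCount y) ≡ 0ℚ
      gap≡0 = ∑≤0⇒≡0 0≤gap (≤-reflexive (trans (∑-cong (λ y → lem₂ (nz y) (g 2 y) (rootCount y)))
        (trans (∑-- (λ y → nz y - g 2 y * nz y) (λ y → nz y * rootCount y)) (trans (cong₂ _-_
          (trans (∑-- nz (λ y → g 2 y * nz y)) (cong₂ _-_ ∑-nz (∑f≡0 {2} {[]} (primeDivisor-2 ∷ [] , [] ∷ [])))) ∑roots) (lem₃ Nℚ)))))
        where
        lem₂ : ∀ z g c → z * (1ℚ - g - c) ≡ (z - g * z) - z * c
        lem₂ = solve-∀ ℚ-ring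
        lem₃ : ∀ a → (a - 0ℚ) - a ≡ 0ℚ
        lem₃ = solve-∀ ℚ-ring
        0≤gap : ∀ y → 0ℚ ≤ nz y * (1ℚ - g 2 y - rootCount y)
        0≤gap y with y ≟F 0F
        ... | yes _ = ≤-reflexive (sym (*-zeroˡ (1ℚ - g 2 y - rootCount y)))
        ... | no y≢0 = 0≤-* 0≤1 (≤⇒0≤- (rootCount≤ y≢0))
        ∑roots : ∑ (λ y → nz y * rootCount y) ≡ Nℚ
        ∑roots = trans (∑-cong (λ y → sym (∑-*ˡ (nz y) (λ x → ⟦ x *F x ≟F y ⟧)))) (trans (∑-swap (λ y x → nz y * ⟦ x *F x ≟F y ⟧))
          (trans (∑-cong (λ x → trans (∑-cong (λ y → trans (*-comm (nz y) ⟦ x *F x ≟F y ⟧) (cong (_* nz y) (⟦⟧-cong (x *F x ≟F y) (y ≟F x *F x) sym sym))))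
            (trans (∑-single (x *F x) nz) (⟦⟧-cong (¬? (x *F x ≟F 0F)) (¬? (x ≟F 0F)) *-≢0ˡ (λ h → *-≢0 h h))))) ∑-nz))

    QPrimes : List ℕ → Set
    QPrimes D = All (_∣ Q) D

    -- `x ^ (N / p)` is a `p`-th root of unity and `p` is odd, so its square is 1 only if it is 1
    -- itself.
    f-square : ∀ {D} → Distinct D → QPrimes D → ∀ {x} → x ≢ 0F → f D (x *F x) ≡ f D x
    f-square {[]} _ _ {x} x≢0 = trans (nz-≢0 (*-≢0 x≢0 x≢0)) (sym (nz-≢0 x≢0))
    f-square {p ∷ D} (pd ∷ pds , _ ∷ uD) (p∣Q ∷ D∣Q) {x} x≢0 = cong₂ _*_
      (cong (λ u → r p - (1ℚ + r p) * u) (⟦⟧-cong (inKernel? p (x *F x)) (inKernel? p x)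
        (λ e → ^F≡1-coprime (prime∤⇒coprime prime[2] (λ 2∣p → Q-odd (Div.∣-trans 2∣p p∣Q)))
          (trans (cong (x ^F cofactor p *F_) (FR.*-identityʳ _)) (trans (sym (*-^F x x (cofactor p))) e)) (cofactor-^p pd x≢0))
        (λ e → trans (*-^F x x (cofactor p)) (trans (cong₂ _*F_ e e) (FR.*-identityˡ 1F)))))
      (f-square (pds , uD) D∣Q x≢0)

    -- Substitute `a = ξ²`: squaring does not change `f D`, and a nonzero `a` has `1 - g 2 a` square
    -- roots. The factor `g 2` adjoins the prime 2 to `D`.
    E-split : ∀ {D} → Distinct D → QPrimes D → E D ≡ B D - B (2 ∷ D)
    E-split {D} dist D∣Q = trans (∑-cong squared) (trans (∑-cong (λ ξ → sym (∑-single (ξ *F ξ) G)))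
      (trans (∑-swap (λ ξ a → ⟦ a ≟F ξ *F ξ ⟧ * G a)) (trans (∑-cong (λ a → trans (∑-cong (λ ξ → trans (*-comm ⟦ a ≟F ξ *F ξ ⟧ (G a))
          (cong (G a *_) (⟦⟧-cong (a ≟F ξ *F ξ) (ξ *F ξ ≟F a) sym sym)))) (trans (∑-*ˡ (G a) (λ ξ → ⟦ ξ *F ξ ≟F a ⟧)) (count a))))
        (∑-- G (λ a → f (2 ∷ D) a * τ₁ a)))))
      where
      G : Carrier → ℚ
      G a = f D a * τ₁ a
      squared : ∀ ξ → f D ξ * τ₂ ξ ≡ G (ξ *F ξ)
      squared ξ = case (ξ ≟F 0F)
        where
        case : Dec (ξ ≡ 0F) → f D ξ * τ₂ ξ ≡ G (ξ *F ξ)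
        case (yes refl) = cong (λ t → t * τ₂ 0F) (sym (cong (f D) (FR.zeroˡ 0F)))
        case (no ξ≢0) = cong (_* τ₂ ξ) (sym (f-square dist D∣Q ξ≢0))
      count : ∀ a → G a * rootCount a ≡ G a - f (2 ∷ D) a * τ₁ a
      count a = case (a ≟F 0F)
        where
        case : Dec (a ≡ 0F) → G a * rootCount a ≡ G a - f (2 ∷ D) a * τ₁ a
        case (yes a≡0) = trans (cong (λ t → t * τ₁ a * rootCount a) (f-≡0 D a≡0)) (trans (lem (τ₁ a) (rootCount a) (g 2 a))
          (cong (λ t → t * τ₁ a - g 2 a * t * τ₁ a) (sym (f-≡0 D a≡0))))
          where
          lem : ∀ t c g → 0ℚ * t * c ≡ 0ℚ * t - g * 0ℚ * t
          lem = solve-∀ ℚ-ring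
        case (no a≢0) = trans (cong (G a *_) (rootCount≡ a≢0)) (lem (f D a) (τ₁ a) (g 2 a))
          where
          lem : ∀ f t g → f * t * (1ℚ - g) ≡ f * t - g * f * t
          lem = solve-∀ ℚ-ring

    distinct-2∷ : ∀ {D} → Distinct D → QPrimes D → Distinct (2 ∷ D)
    distinct-2∷ (pds , uD) D∣Q = primeDivisor-2 ∷ pds , All.map (λ { p∣Q refl → Q-odd p∣Q }) D∣Q ∷ uD

    -- The whole trace fibre over `β`, which avoids 0 because `β` is nonzero.
    B-[] : B [] ≡ Mℚ
    B-[] = trans (∑-cong (λ y → trans (*-comm (nz y) (τ₁ y)) (trans (⟦⟧-guard (tr y ≟F β) {y = 1ℚ}
      (λ e → nz-≢0 (λ { refl → β≢0 (trans (sym e) tr-0) }))) (*-identityʳ (τ₁ y))))) (fibre≡M β-inSubfield)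

    -- If `p` divides `Q`, then `N / p` is the multiple `Q / p` of `q - 1`, and nonzero elements of
    -- the subfield satisfy `c ^ (q - 1) = 1`.
    subfield-∈-kernel : ∀ {c p} → InSubfield c → c ≢ 0F → PrimeDivisor p → p ∣ Q → c ^F cofactor p ≡ 1F
    subfield-∈-kernel {c} {p} hc c≢0 pd (divides Q′ Q≡) = ^F≡1-∣ (divides Q′ cofactor≡) (*F-cancelˡ c≢0
        (trans (cong (c ^F_) (ℕₚ.m+[n∸m]≡n {1} (ℕₚ.≤-trans (s≤s z≤n) 2≤q))) (trans hc (sym (FR.*-identityʳ c)))))
      where
      1≤p = ℕₚ.≤-trans (s≤s z≤n) (2≤prime (proj₁ pd))
      cofactor≡ : cofactor p ≡ Q′ ℕ.* (q ∸ 1)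
      cofactor≡ = ℕₚ.*-cancelʳ-≡ _ _ p {{ℕ.>-nonZero 1≤p}} (trans (cofactor-* pd) (trans (sym Q-*) (trans (cong (ℕ._* (q ∸ 1)) Q≡)
        (trans (ℕₚ.*-assoc Q′ p (q ∸ 1)) (trans (cong (Q′ ℕ.*_) (ℕₚ.*-comm p (q ∸ 1))) (sym (ℕₚ.*-assoc Q′ (q ∸ 1) p)))))))

    f-subfield : ∀ {D} → Distinct D → QPrimes D → ∀ {c} → InSubfield c → c ≢ 0F → ∀ y → f D (y *F c) ≡ f D y
    f-subfield (pds , _) D∣Q hc c≢0 y = f-invariant c≢0 (All.zipWith (λ (pd , p∣Q) → subfield-∈-kernel hc c≢0 pd p∣Q) (pds , D∣Q))

    main : List ℕ → ℚ
    main [] = Mℚ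
    main (_ ∷ _) = 0ℚ

    E-within : ∀ {p D} → Distinct (p ∷ D) → Within (E (p ∷ D)) (ℕ→ℚ 2 * R)
    E-within {p} {D} dist = within-square (0≤-* (0≤ℕ→ℚ 2) 0≤R) (≤-trans (E-bound dist)
      (≤-reflexive (trans (cong (ℕ→ℚ 4 *_) (sym R²)) (lem R))))
      where
      lem : ∀ r → ((1ℚ + 1ℚ) * (1ℚ + 1ℚ)) * (r * r) ≡ ((1ℚ + 1ℚ) * r) * ((1ℚ + 1ℚ) * r)
      lem = solve-∀ ℚ-ring

    E-within-Q : ∀ {D} → Distinct D → QPrimes D → Within (E D - main D) (C * R)
    -- Removing the main term leaves only `- B (2 ∷ [])`, which `1 ≤ C` covers.
    E-within-Q {[]} dist D∣Q = within-square (0≤-* 0≤C 0≤R) (≤-trans (≤-reflexive (trans (cong (λ t → (t - Mℚ) * (t - Mℚ)) (trans (E-split dist D∣Q) (cong (_- B (2 ∷ [])) B-[])))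
      (lem Mℚ (B (2 ∷ []))))) (≤-trans (B-bound (distinct-2∷ dist D∣Q)) M≤C²M))
      where
      lem : ∀ m b → ((m - b) - m) * ((m - b) - m) ≡ b * b
      lem = solve-∀ ℚ-ring
    E-within-Q {p ∷ D} dist D∣Q = within-square (0≤-* 0≤C 0≤R) (*-cancel-≤ {(1ℚ + 1ℚ) * qℚ} (0<-* (ℕ→ℚ-pos 1) 0<q)
      (≤-trans (≤-reflexive (cong (λ t → (1ℚ + 1ℚ) * qℚ * ((t - 0ℚ) * (t - 0ℚ))) (E-split dist D∣Q)))
      -- From `(2b + b′)² ≥ 0` follows `2 (b - b′)² ≤ 6 b² + 3 b′²`; with `q b² ≤ M` and `b′² ≤ M`
      -- this is the origin of `3/2 + 3/q`.
      (≤-trans (≤-by (0≤-* (<⇒≤ 0<q) (0≤-sq ((1ℚ + 1ℚ) * b + b′))) (lem qℚ b b′))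
      (≤-trans (+-mono-≤ (*-monoˡ-≤ (0≤ℕ→ℚ 6) (qB-bound dist (f-subfield dist D∣Q))) (*-monoˡ-≤ (0≤-* (0≤ℕ→ℚ 3) (<⇒≤ 0<q)) (B-bound (distinct-2∷ dist D∣Q))))
      (≤-trans (≤-reflexive (lem₂ (ℕ→ℚ 3) qℚ (ℕ→ℚ 6) Mℚ)) (≤-trans (*-monoʳ-≤-nonNeg Mℚ {{ℚ.nonNegative (0≤ℕ→ℚ M)}} C-bound)
        (≤-reflexive (trans (cong ((ℕ→ℚ 2 * qℚ) * (C * C) *_) (sym R²)) (lem₃ (ℕ→ℚ 2 * qℚ) C R)))))))))
      where
      b b′ : ℚ
      b = B (p ∷ D)
      b′ = B (2 ∷ p ∷ D)
      lem : ∀ q b c → q * (((1ℚ + 1ℚ) * b + c) * ((1ℚ + 1ℚ) * b + c)) ≡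
        ((1ℚ + 1ℚ) * (1ℚ + 1ℚ + 1ℚ) * (q * (b * b)) + (1ℚ + 1ℚ + 1ℚ) * q * (c * c)) - (1ℚ + 1ℚ) * q * (((b - c) - 0ℚ) * ((b - c) - 0ℚ))
      lem = solve-∀ ℚ-ring
      lem₂ : ∀ t q s m → s * m + t * q * m ≡ (t * q + s) * m
      lem₂ = solve-∀ ℚ-ring
      lem₃ : ∀ q c r → q * (c * c) * (r * r) ≡ q * ((c * r) * (c * r))
      lem₃ = solve-∀ ℚ-ring

    -- The sum of `E (S ++ D)` over all subsets `S` of `K`, up to the order of the primes, arranged
    -- so that error bounds follow the recursion on `K`.
    sieveSum : List ℕ → List ℕ → ℚ
    sieveSum [] D = E D
    sieveSum (p ∷ K) D = sieveSum K D + sieveSum K (p ∷ D)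

    -- On units a positive multiple of the indicator of lying in no kernel of `K`. The sieve
    -- compares signs only, so the multiple `∏ 1 / θ p` is not normalised away.
    expansion : List ℕ → Carrier → ℚ
    expansion [] ξ = 1ℚ
    expansion (p ∷ K) ξ = (1ℚ + g p ξ) * expansion K ξ

    sieveSum≡ : ∀ K D → sieveSum K D ≡ ∑ (λ ξ → expansion K ξ * (f D ξ * τ₂ ξ))
    sieveSum≡ [] D = ∑-cong (λ ξ → sym (*-identityˡ (f D ξ * τ₂ ξ)))
    sieveSum≡ (p ∷ K) D = trans (cong₂ _+_ (sieveSum≡ K D) (sieveSum≡ K (p ∷ D)))
      (trans (sym (∑-+ (λ ξ → expansion K ξ * (f D ξ * τ₂ ξ)) (λ ξ → expansion K ξ * (f (p ∷ D) ξ * τ₂ ξ))))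
        (∑-cong (λ ξ → lem (expansion K ξ) (f D ξ) (τ₂ ξ) (g p ξ))))
      where
      lem : ∀ e f t g → e * (f * t) + e * (g * f * t) ≡ (1ℚ + g) * e * (f * t)
      lem = solve-∀ ℚ-ring

    Disjoint : List ℕ → List ℕ → Set
    Disjoint K D = All (_∉ D) K

    sieveSum-within : ∀ {K p D} → Distinct K → Distinct (p ∷ D) → Disjoint K (p ∷ D) → Within (sieveSum K (p ∷ D)) (ℕ→ℚ 2 * R * pow2 K)
    sieveSum-within {[]} _ dist _ = within-resp refl (sym (*-identityʳ (ℕ→ℚ 2 * R))) (E-within dist)
    sieveSum-within {p′ ∷ K} (pd′ ∷ pds , p′∉K ∷ uK) (pdD , uD) (p′∉D ∷ dis) = within-resp refl (lem (ℕ→ℚ 2 * R) (pow2 K))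
      (within-+ (sieveSum-within (pds , uK) (pdD , uD) dis)
        (sieveSum-within (pds , uK) (pd′ ∷ pdD , Allₚ.¬Any⇒All¬ _ p′∉D ∷ uD)
          (All.zipWith (λ { (ne , h) (here e) → ne (sym e) ; (ne , h) (there i) → h i }) (p′∉K , dis))))
      where
      lem : ∀ a b → a * b + a * b ≡ a * (b + b)
      lem = solve-∀ ℚ-ring

    -- Divisors of Q contribute C instead of 2, so pow2Q Q K of the pow2 K terms of the expansion are cheaper.
    cost : List ℕ → ℚ
    cost K = ℕ→ℚ 2 * pow2 K - (ℕ→ℚ 2 - C) * pow2Q Q K

    -- If the next prime divides `Q`, both halves keep the constant `C`; if not, the half that
    -- contains it falls under the general bound `2R`. A nonempty list has no main term.
    sieveSum-within-Q : ∀ {K D} → Distinct K → Distinct D → QPrimes D → Disjoint K D → Within (sieveSum K D - main D) (R * cost K)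
    sieveSum-within-Q {[]} _ dist D∣Q _ = within-resp refl (lem (ℕ→ℚ 2) C R) (E-within-Q dist D∣Q)
      where
      lem : ∀ t c r → c * r ≡ r * (t * 1ℚ - (t - c) * 1ℚ)
      lem = solve-∀ ℚ-ring
    sieveSum-within-Q {p ∷ K} {D} (pd ∷ pds , p∉K ∷ uK) (pdD , uD) D∣Q (p∉D ∷ dis) with p ∣? Q
    ... | yes p∣Q = within-resp (lem₁ (sieveSum K D) (sieveSum K (p ∷ D)) (main D)) (lem₂ R (ℕ→ℚ 2) (pow2 K) (ℕ→ℚ 2 - C) (pow2Q Q K))
      (within-+ (sieveSum-within-Q (pds , uK) (pdD , uD) D∣Q dis)
        (sieveSum-within-Q (pds , uK) (pd ∷ pdD , Allₚ.¬Any⇒All¬ _ p∉D ∷ uD) (p∣Q ∷ D∣Q)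
          (All.zipWith (λ { (ne , h) (here e) → ne (sym e) ; (ne , h) (there i) → h i }) (p∉K , dis))))
      where
      lem₁ : ∀ a b m → (a - m) + (b - 0ℚ) ≡ (a + b) - m
      lem₁ = solve-∀ ℚ-ring
      lem₂ : ∀ r t a c b → r * (t * a - c * b) + r * (t * a - c * b) ≡ r * (t * (a + a) - c * (b + b))
      lem₂ = solve-∀ ℚ-ring
    ... | no p∤Q = within-resp (lem₁ (sieveSum K D) (sieveSum K (p ∷ D)) (main D)) (lem₂ R (ℕ→ℚ 2) (pow2 K) (ℕ→ℚ 2 - C) (pow2Q Q K))
      (within-+ (sieveSum-within-Q (pds , uK) (pdD , uD) D∣Q dis)
        (sieveSum-within (pds , uK) (pd ∷ pdD , Allₚ.¬Any⇒All¬ _ p∉D ∷ uD)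
          (All.zipWith (λ { (ne , h) (here e) → ne (sym e) ; (ne , h) (there i) → h i }) (p∉K , dis))))
      where
      lem₁ : ∀ a b m → (a - m) + b ≡ (a + b) - m
      lem₁ = solve-∀ ℚ-ring
      lem₂ : ∀ r t a c b → r * (t * a - c * b) + t * r * a ≡ r * (t * (a + a) - c * b)
      lem₂ = solve-∀ ℚ-ring

    -- Because `θ p * (1 + r p) = 1`. It trades the indicator of a kernel for its density `1/p` and
    -- an error term in `g p`.
    θ*g : ∀ {p} → Prime p → ∀ ξ → θ p * g p ξ ≡ recip p - ⟦ inKernel? p ξ ⟧
    θ*g {p} p-prime ξ = trans (lem (recip p) (r p) k) (trans (cong (λ u → (u - (1ℚ - recip p)) - u * k) unit) (lem₂ (recip p) k))
      where
      k = ⟦ inKernel? p ξ ⟧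
      lem : ∀ c r k → (1ℚ - c) * (r - (1ℚ + r) * k) ≡ ((1ℚ - c) * (1ℚ + r) - (1ℚ - c)) - (1ℚ - c) * (1ℚ + r) * k
      lem = solve-∀ ℚ-ring
      lem₂ : ∀ c k → (1ℚ - (1ℚ - c)) - 1ℚ * k ≡ c - k
      lem₂ = solve-∀ ℚ-ring
      lem₃ : ∀ c p r → (1ℚ - c) * (p * r) ≡ p * r - (p * c) * r
      lem₃ = solve-∀ ℚ-ring
      lem₄ : ∀ r → (1ℚ + r) - 1ℚ * r ≡ 1ℚ
      lem₄ = solve-∀ ℚ-ring
      unit : (1ℚ - recip p) * (1ℚ + r p) ≡ 1ℚ
      unit = trans (cong ((1ℚ - recip p) *_) (sym (p*r p-prime))) (trans (lem₃ (recip p) (ℕ→ℚ p) (r p))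
        (trans (cong₂ (λ u v → u - v * r p) (p*r p-prime) (recip-inverse p (ℕₚ.≤-trans (s≤s z≤n) (2≤prime p-prime)))) (lem₄ (r p))))

    NoSolution : List ℕ → Set
    NoSolution L = ∀ ξ → ξ ≢ 0F → All (λ p → ξ ^F cofactor p ≢ 1F) L → tr (ξ *F ξ) ≢ β

    1+g-kernel : ∀ {p ξ} → ξ ^F cofactor p ≡ 1F → 1ℚ + g p ξ ≡ 0ℚ
    1+g-kernel {p} {ξ} e = trans (cong (λ u → 1ℚ + (r p - (1ℚ + r p) * u)) (⟦⟧-yes (inKernel? p ξ) e)) (lem (r p))
      where
      lem : ∀ r → 1ℚ + (r - (1ℚ + r) * 1ℚ) ≡ 0ℚ
      lem = solve-∀ ℚ-ring

    0≤1+g : ∀ p ξ → 0ℚ ≤ 1ℚ + g p ξ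
    0≤1+g p ξ with inKernel? p ξ
    ... | yes _ = ≤-reflexive (sym (lem (r p)))
      where
      lem : ∀ r → 1ℚ + (r - (1ℚ + r) * 1ℚ) ≡ 0ℚ
      lem = solve-∀ ℚ-ring
    ... | no _ = ≤-trans (0≤-+ 0≤1 (0≤recip (p ∸ 1))) (≤-reflexive (lem (r p)))
      where
      lem : ∀ r → 1ℚ + r ≡ 1ℚ + (r - (1ℚ + r) * 0ℚ)
      lem = solve-∀ ℚ-ring

    0≤expansion : ∀ K ξ → 0ℚ ≤ expansion K ξ
    0≤expansion [] ξ = 0≤1
    0≤expansion (p ∷ K) ξ = 0≤-* (0≤1+g p ξ) (0≤expansion K ξ)

    expansion≡0 : ∀ {K ξ} → Any (λ p → ξ ^F cofactor p ≡ 1F) K → expansion K ξ ≡ 0ℚ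
    expansion≡0 {p ∷ K} {ξ} (here e) = trans (cong (_* expansion K ξ) (1+g-kernel {p} {ξ} e)) (*-zeroˡ (expansion K ξ))
    expansion≡0 {p ∷ K} {ξ} (there i) = trans (cong ((1ℚ + g p ξ) *_) (expansion≡0 i)) (*-zeroʳ (1ℚ + g p ξ))

    kernelCount : List ℕ → Carrier → ℚ
    kernelCount ps ξ = sumℚ (map (λ p → ⟦ inKernel? p ξ ⟧) ps)

    0≤kernelCount : ∀ ps ξ → 0ℚ ≤ kernelCount ps ξ
    0≤kernelCount [] ξ = ≤-refl
    0≤kernelCount (p ∷ ps) ξ = 0≤-+ (0≤⟦⟧ (inKernel? p ξ)) (0≤kernelCount ps ξ)

    1≤kernelCount : ∀ {ps ξ} → Any (λ p → ξ ^F cofactor p ≡ 1F) ps → 1ℚ ≤ kernelCount ps ξ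
    1≤kernelCount {p ∷ ps} {ξ} (here e) = ≤-trans (≤-reflexive (trans (sym (⟦⟧-yes (inKernel? p ξ) e)) (sym (+-identityʳ ⟦ inKernel? p ξ ⟧))))
      (+-monoʳ-≤ ⟦ inKernel? p ξ ⟧ (0≤kernelCount ps ξ))
    1≤kernelCount {p ∷ ps} {ξ} (there i) = ≤-trans (1≤kernelCount i) (≤-trans (≤-reflexive (sym (+-identityˡ (kernelCount ps ξ))))
      (+-monoˡ-≤ (kernelCount ps ξ) (0≤⟦⟧ (inKernel? p ξ))))

    weight : List ℕ → Carrier → ℚ
    weight K ξ = expansion K ξ * (nz ξ * τ₂ ξ)

    0≤weight : ∀ K ξ → 0ℚ ≤ weight K ξ
    0≤weight K ξ = 0≤-* (0≤expansion K ξ) (0≤-* (0≤⟦⟧ (¬? (ξ ≟F 0F))) (0≤⟦⟧ (tr (ξ *F ξ) ≟F β)))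

    -- In the kernel of a prime of `ps` the first factor is at most 0; in that of a prime of `K` the
    -- weight vanishes; at any other point `nz ξ * τ₂ ξ` vanishes, since otherwise `ξ` would be a
    -- solution.
    weighted-sieve≤0 : ∀ K ps → NoSolution (K ++ ps) → ∀ ξ → (1ℚ - kernelCount ps ξ) * weight K ξ ≤ 0ℚ
    weighted-sieve≤0 K ps none ξ = case (Any.any? (λ p → inKernel? p ξ) ps) (Any.any? (λ p → inKernel? p ξ) K)
      where
      nonpositive : ∀ {a b} → a ≤ 0ℚ → 0ℚ ≤ b → a * b ≤ 0ℚ
      nonpositive {a} {b} h 0≤b = ≤-trans (*-monoʳ-≤-nonNeg b {{ℚ.nonNegative 0≤b}} h) (≤-reflexive (*-zeroˡ b))
      c = 1ℚ - kernelCount ps ξ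
      case : Dec (Any (λ p → ξ ^F cofactor p ≡ 1F) ps) → Dec (Any (λ p → ξ ^F cofactor p ≡ 1F) K) → c * weight K ξ ≤ 0ℚ
      case (yes i) _ = nonpositive {c} (≤-by (≤⇒0≤- (1≤kernelCount i)) (lem (kernelCount ps ξ))) (0≤weight K ξ)
        where
        lem : ∀ a → a - 1ℚ ≡ 0ℚ - (1ℚ - a)
        lem = solve-∀ ℚ-ring
      case (no _) (yes i) = ≤-reflexive (trans (cong (λ e → c * (e * (nz ξ * τ₂ ξ))) (expansion≡0 i)) (lem c (nz ξ * τ₂ ξ)))
        where
        lem : ∀ a b → a * (0ℚ * b) ≡ 0ℚ
        lem = solve-∀ ℚ-ring
      case (no ∉ps) (no ∉K) = ≤-reflexive (trans (cong (λ t → c * (expansion K ξ * t)) nz*τ≡0) (lem c (expansion K ξ)))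
        where
        lem : ∀ a b → a * (b * 0ℚ) ≡ 0ℚ
        lem = solve-∀ ℚ-ring
        nz*τ≡0 : nz ξ * τ₂ ξ ≡ 0ℚ
        nz*τ≡0 = trans (⟦⟧-guard (¬? (ξ ≟F 0F)) {y = 0ℚ} (λ ξ≢0 → ⟦⟧-no (tr (ξ *F ξ) ≟F β)
          (none ξ ξ≢0 (Allₚ.++⁺ (Allₚ.¬Any⇒All¬ _ ∉K) (Allₚ.¬Any⇒All¬ _ ∉ps))))) (*-zeroʳ (nz ξ))

    -- By `θ*g` each indicator in `kernelCount` becomes `recip p - θ p * g p`. The densities add up
    -- to `1 - δ ps`, and the factor `g p` turns `f []` into `f (p ∷ [])`.
    sieve-sum : ∀ K ps → All Prime ps →
      δ ps * sieveSum K [] + sumℚ (map (λ p → θ p * sieveSum K (p ∷ [])) ps) ≡ ∑ (λ ξ → (1ℚ - kernelCount ps ξ) * weight K ξ)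
    sieve-sum K [] _ = trans (lem (sieveSum K [])) (trans (sieveSum≡ K []) (∑-cong (λ ξ → lem₂ (weight K ξ))))
      where
      lem : ∀ a → (1ℚ - 0ℚ) * a + 0ℚ ≡ a
      lem = solve-∀ ℚ-ring
      lem₂ : ∀ a → a ≡ (1ℚ - 0ℚ) * a
      lem₂ = solve-∀ ℚ-ring
    sieve-sum K (p ∷ ps) (p-prime ∷ ps-prime) = trans (lem (recip p) (sumℚ (map recip ps)) (sieveSum K []) (θ p * sieveSum K (p ∷ [])) (sumℚ (map (λ p → θ p * sieveSum K (p ∷ [])) ps)))
      (trans (cong₂ _+_ (sieve-sum K ps ps-prime) (trans (cong₂ (λ a b → θ p * b - recip p * a) (sieveSum≡ K []) (sieveSum≡ K (p ∷ [])))
          (trans (cong₂ _-_ (sym (∑-*ˡ (θ p) (λ ξ → expansion K ξ * (f (p ∷ []) ξ * τ₂ ξ)))) (sym (∑-*ˡ (recip p) (weight K))))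
            (sym (∑-- (λ ξ → θ p * (expansion K ξ * (f (p ∷ []) ξ * τ₂ ξ))) (λ ξ → recip p * weight K ξ))))))
        (trans (sym (∑-+ (λ ξ → (1ℚ - kernelCount ps ξ) * weight K ξ) (λ ξ → θ p * (expansion K ξ * (f (p ∷ []) ξ * τ₂ ξ)) - recip p * weight K ξ)))
          (∑-cong (λ ξ → trans (lem₂ (kernelCount ps ξ) (expansion K ξ) (nz ξ) (τ₂ ξ) (θ p) (g p ξ) (recip p))
            (trans (cong (λ u → (1ℚ - kernelCount ps ξ) * weight K ξ + (u - recip p) * weight K ξ) (θ*g p-prime ξ))
              (lem₃ (kernelCount ps ξ) (weight K ξ) (recip p) ⟦ inKernel? p ξ ⟧))))))
      where
      lem : ∀ c s a b t → (1ℚ - (c + s)) * a + (b + t) ≡ ((1ℚ - s) * a + t) + (b - c * a)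
      lem = solve-∀ ℚ-ring
      lem₂ : ∀ k e z t h g c → (1ℚ - k) * (e * (z * t)) + (h * (e * (g * z * t)) - c * (e * (z * t))) ≡ (1ℚ - k) * (e * (z * t)) + (h * g - c) * (e * (z * t))
      lem₂ = solve-∀ ℚ-ring
      lem₃ : ∀ k w c i → (1ℚ - k) * w + ((c - i) - c) * w ≡ (1ℚ - (i + k)) * w
      lem₃ = solve-∀ ℚ-ring

    A : List ℕ → ℚ
    A ps = sumℚ (map θ (filter (_∣? Q) ps))

    private
      -- The lists `p ∷ []` have no main term, so a prime loses at most `θ p` times its error bound,
      -- which is the cheaper `R * cost K` if it divides `Q`.
      contribution : ∀ {K} → Distinct K → ∀ {ps} → All PrimeDivisor ps → All (_∉ K) ps →
        - (R * (ℕ→ℚ 2 * pow2 K * sumℚ (map θ ps) - (ℕ→ℚ 2 - C) * pow2Q Q K * A ps)) ≤ sumℚ (map (λ p → θ p * sieveSum K (p ∷ [])) ps)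
      contribution {K} _ {[]} _ _ = ≤-reflexive (lem R (ℕ→ℚ 2 * pow2 K) ((ℕ→ℚ 2 - C) * pow2Q Q K))
        where
        lem : ∀ r a b → - (r * (a * 0ℚ - b * 0ℚ)) ≡ 0ℚ
        lem = solve-∀ ℚ-ring
      contribution {K} dK {p ∷ ps} (pd ∷ pds) (p∉K ∷ dis) with p ∣? Q
      ... | yes p∣Q = ≤-trans (≤-reflexive (lem R (ℕ→ℚ 2) (pow2 K) (ℕ→ℚ 2 - C) (pow2Q Q K) (θ p) (sumℚ (map θ ps)) (A ps)))
        (+-mono-≤ (*-monoˡ-≤ (0≤θ (proj₁ pd)) (≤-trans (proj₁ within) (≤-reflexive (lem₂ (sieveSum K (p ∷ [])))))) (contribution dK pds dis))
        where
        within = sieveSum-within-Q dK (pd ∷ [] , [] ∷ []) (p∣Q ∷ []) (All.map (λ { ne (here refl) → ne refl }) (Allₚ.¬Any⇒All¬ _ p∉K))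
        lem : ∀ r t k c w h s a → - (r * (t * k * (h + s) - c * w * (h + a))) ≡ h * - (r * (t * k - c * w)) + - (r * (t * k * s - c * w * a))
        lem = solve-∀ ℚ-ring
        lem₂ : ∀ a → a - 0ℚ ≡ a
        lem₂ = solve-∀ ℚ-ring
      ... | no _ = ≤-trans (≤-reflexive (lem R (ℕ→ℚ 2) (pow2 K) (ℕ→ℚ 2 - C) (pow2Q Q K) (θ p) (sumℚ (map θ ps)) (A ps)))
        (+-mono-≤ (*-monoˡ-≤ (0≤θ (proj₁ pd)) (proj₁ within)) (contribution dK pds dis))
        where
        within = sieveSum-within dK (pd ∷ [] , [] ∷ []) (All.map (λ { ne (here refl) → ne refl }) (Allₚ.¬Any⇒All¬ _ p∉K))
        lem : ∀ r t k c w h s a → - (r * (t * k * (h + s) - c * w * a)) ≡ h * - (t * r * k) + - (r * (t * k * s - c * w * a))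
        lem = solve-∀ ℚ-ring

    -- The main term is `R * R` and every error carries a factor `R`, so the nonpositive total can
    -- be divided by `R`.
    no-solution-bound : ∀ K ps → Distinct K → All PrimeDivisor ps → All (_∉ K) ps → 0ℚ ≤ δ ps → NoSolution (K ++ ps) →
      δ ps * R ≤ ℕ→ℚ 2 * pow2 K * (δ ps + sumℚ (map θ ps)) - (ℕ→ℚ 2 - C) * pow2Q Q K * (δ ps + A ps)
    no-solution-bound K ps dK pds dis 0≤δ none = *-cancel-≤ 0<R (≤-by (≤⇒0≤- (≤-trans lower total≤0))
        (trans (cong (λ m → 0ℚ - (δ ps * (m + - (R * cost K)) + - (R * (ℕ→ℚ 2 * pow2 K * Θ - (ℕ→ℚ 2 - C) * pow2Q Q K * A ps)))) (sym R²))
          (lem R (δ ps) (ℕ→ℚ 2) (pow2 K) (ℕ→ℚ 2 - C) (pow2Q Q K) Θ (A ps))))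
      where
      Θ = sumℚ (map θ ps)
      total≤0 : δ ps * sieveSum K [] + sumℚ (map (λ p → θ p * sieveSum K (p ∷ [])) ps) ≤ 0ℚ
      total≤0 = ≤-trans (≤-reflexive (sieve-sum K ps (All.map proj₁ pds))) (≤-trans (∑-mono (weighted-sieve≤0 K ps none)) (≤-reflexive ∑-zero))
      S≥ : Mℚ + - (R * cost K) ≤ sieveSum K []
      S≥ = ≤-by (≤⇒0≤- (proj₁ (sieveSum-within-Q dK ([] , []) [] (All.universal (λ _ ()) K)))) (lem₁ (sieveSum K []) Mℚ (- (R * cost K)))
        where
        lem₁ : ∀ s m c → (s - m) - c ≡ s - (m + c)
        lem₁ = solve-∀ ℚ-ring
      lower : δ ps * (Mℚ + - (R * cost K)) + - (R * (ℕ→ℚ 2 * pow2 K * Θ - (ℕ→ℚ 2 - C) * pow2Q Q K * A ps)) ≤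
        δ ps * sieveSum K [] + sumℚ (map (λ p → θ p * sieveSum K (p ∷ [])) ps)
      lower = +-mono-≤ (*-monoˡ-≤ 0≤δ S≥) (contribution dK pds dis)
      lem : ∀ r d t k c w s a → 0ℚ - (d * (r * r + - (r * (t * k - c * w))) + - (r * (t * k * s - c * w * a))) ≡
        r * (t * k * (d + s) - c * w * (d + a)) - r * (d * r)
      lem = solve-∀ ℚ-ring

open Arithmetic
open Estimates

open import Data.Nat using (_*_; _%_; _/_; _≥_)
open import Data.Integer using (+_)
open import Data.Rational using (_>_)
open ℚₚ using (≤-trans; ≤-refl; ≤-reflexive; <-irrefl; <-≤-trans; <⇒≤; ≰⇒>; +-mono-≤)

-- Comparison of the sieve with the numerical hypothesis

pow2≡ : ∀ K → pow2 K ≡ ℕ→ℚ (2 ^ length K)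
pow2≡ [] = refl
pow2≡ (p ∷ K) = trans (cong₂ ℚ._+_ (pow2≡ K) (trans (pow2≡ K) (cong ℕ→ℚ (sym (ℕₚ.+-identityʳ (2 ^ length K))))))
  (sym (ℕ→ℚ-+ (2 ^ length K) (2 ^ length K ℕ.+ 0)))

pow2Q≡ : ∀ Q K → pow2Q Q K ≡ ℕ→ℚ (2 ^ length (filter (_∣? Q) K))
pow2Q≡ Q [] = refl
pow2Q≡ Q (p ∷ K) with p ∣? Q
... | no _ = pow2Q≡ Q K
... | yes _ = trans (cong₂ ℚ._+_ (pow2Q≡ Q K) (trans (pow2Q≡ Q K) (cong ℕ→ℚ (sym (ℕₚ.+-identityʳ (2 ^ m))))))
  (sym (ℕ→ℚ-+ (2 ^ m) (2 ^ m ℕ.+ 0)))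
  where m = length (filter (_∣? Q) K)

pow2Q≤pow2 : ∀ Q K → pow2Q Q K ℚ.≤ pow2 K
pow2Q≤pow2 Q K = subst₂ ℚ._≤_ (sym (pow2Q≡ Q K)) (sym (pow2≡ K))
  (ℕ→ℚ-mono-≤ (ℕₚ.^-monoʳ-≤ 2 (Listₚ.length-filter (_∣? Q) K)))

2pow2Q≤pow2 : ∀ Q {p K} → p ∈ K → ¬ (p ∣ Q) → ℕ→ℚ 2 ℚ.* pow2Q Q K ℚ.≤ pow2 K
2pow2Q≤pow2 Q {p} {K} p∈K p∤Q = subst₂ ℚ._≤_ (trans (ℕ→ℚ-* 2 (2 ^ m)) (cong (ℕ→ℚ 2 ℚ.*_) (sym (pow2Q≡ Q K)))) (sym (pow2≡ K))
  (ℕ→ℚ-mono-≤ (ℕₚ.^-monoʳ-≤ 2 (Listₚ.filter-notAll (_∣? Q) K (lose p∈K p∤Q))))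
  where m = length (filter (_∣? Q) K)

0≤pow2Q : ∀ Q K → 0ℚ ℚ.≤ pow2Q Q K
0≤pow2Q Q K = subst (0ℚ ℚ.≤_) (sym (pow2Q≡ Q K)) (0≤ℕ→ℚ (2 ^ length (filter (_∣? Q) K)))

-- Links the losses of the sieve to the coefficients in `bound`: `δ + ∑ θ = s - 1 + 2δ`, which is
-- `δ` times `(s - 1)/δ + 2`.
sum-θ : ∀ ps → sumℚ (map θ ps) ≡ (ℕ→ℚ (length ps) ℚ.- 1ℚ) ℚ.+ δ ps
sum-θ [] = refl
sum-θ (p ∷ ps) = trans (cong (θ p ℚ.+_) (sum-θ ps)) (trans (lem (recip p) (ℕ→ℚ (length ps)) (sumℚ (map recip ps)))
  (cong (λ m → (m ℚ.- 1ℚ) ℚ.+ δ (p ∷ ps)) (sym (ℕ→ℚ-suc (length ps)))))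
  where
  lem : ∀ c l s → (1ℚ ℚ.- c) ℚ.+ ((l ℚ.- 1ℚ) ℚ.+ (1ℚ ℚ.- s)) ≡ ((1ℚ ℚ.+ l) ℚ.- 1ℚ) ℚ.+ (1ℚ ℚ.- (c ℚ.+ s))
  lem = solve-∀ ℚ-ring

0≤sum-recip : ∀ ps → 0ℚ ℚ.≤ sumℚ (map recip ps)
0≤sum-recip [] = ≤-refl
0≤sum-recip (p ∷ ps) = 0≤-+ (0≤recip p) (0≤sum-recip ps)

δ≤1 : ∀ ps → δ ps ℚ.≤ 1ℚ
δ≤1 ps = ≤-by (0≤sum-recip ps) (lem (sumℚ (map recip ps)))
  where
  lem : ∀ s → s ≡ 1ℚ ℚ.- (1ℚ ℚ.- s)
  lem = solve-∀ ℚ-ring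

sum-θ≤length : ∀ ps → sumℚ (map θ ps) ℚ.≤ ℕ→ℚ (length ps)
sum-θ≤length ps = ≤-trans (≤-reflexive (sum-θ ps)) (≤-by (0≤sum-recip ps) (lem (ℕ→ℚ (length ps)) (sumℚ (map recip ps))))
  where
  lem : ∀ l s → s ≡ l ℚ.- ((l ℚ.- 1ℚ) ℚ.+ (1ℚ ℚ.- s))
  lem = solve-∀ ℚ-ring

0≤sum-θ : ∀ {ps} → All Prime ps → 0ℚ ℚ.≤ sumℚ (map θ ps)
0≤sum-θ [] = ≤-refl
0≤sum-θ (h ∷ hs) = 0≤-+ (0≤θ h) (0≤sum-θ hs)

sum-θ-filter : ∀ Q {ps} → All Prime ps → sumℚ (map θ (filter (_∣? Q) ps)) ℚ.≤ sumℚ (map θ ps)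
sum-θ-filter Q [] = ≤-refl
sum-θ-filter Q {p ∷ ps} (h ∷ hs) with p ∣? Q
... | yes _ = ℚₚ.+-monoʳ-≤ (θ p) (sum-θ-filter Q hs)
... | no _ = ≤-trans (sum-θ-filter Q hs) (≤-trans (≤-reflexive (sym (ℚₚ.+-identityˡ (sumℚ (map θ ps))))) (ℚₚ.+-monoˡ-≤ (sumℚ (map θ ps)) (0≤θ h)))

sum-θ-filter-∈ : ∀ Q {a ps} → All Prime ps → a ∈ ps → ¬ (a ∣ Q) → θ a ℚ.+ sumℚ (map θ (filter (_∣? Q) ps)) ℚ.≤ sumℚ (map θ ps)
sum-θ-filter-∈ Q {a} {p ∷ ps} (h ∷ hs) a∈ a∤Q with p ∣? Q | a∈
... | yes p∣Q | here refl = ⊥-elim (a∤Q p∣Q)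
... | no _ | here refl = ℚₚ.+-monoʳ-≤ (θ p) (sum-θ-filter Q hs)
... | yes _ | there i = ≤-trans (≤-reflexive (lem (θ a) (θ p) (sumℚ (map θ (filter (_∣? Q) ps))))) (ℚₚ.+-monoʳ-≤ (θ p) (sum-θ-filter-∈ Q hs i a∤Q))
  where
  lem : ∀ a b c → a ℚ.+ (b ℚ.+ c) ≡ b ℚ.+ (a ℚ.+ c)
  lem = solve-∀ ℚ-ring
... | no _ | there i = ≤-trans (sum-θ-filter-∈ Q hs i a∤Q) (≤-trans (≤-reflexive (sym (ℚₚ.+-identityˡ (sumℚ (map θ ps))))) (ℚₚ.+-monoˡ-≤ (sumℚ (map θ ps)) (0≤θ h)))

divQ-* : ∀ a {d} → 0ℚ ℚ.< d → d ℚ.* divQ a d ≡ a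
divQ-* a {d} 0<d with d ℚₚ.≟ 0ℚ
... | yes d≡0 = ⊥-elim (<-irrefl (sym d≡0) 0<d)
... | no d≢0 = trans (lem d a (ℚ.1/_ d {{ℚ.≢-nonZero d≢0}})) (trans (cong (a ℚ.*_) (ℚₚ.*-inverseʳ d {{ℚ.≢-nonZero d≢0}})) (ℚₚ.*-identityʳ a))
  where
  lem : ∀ d a i → d ℚ.* (a ℚ.* i) ≡ a ℚ.* (d ℚ.* i)
  lem = solve-∀ ℚ-ring

-- 7/5 < √2 keeps the rest of the argument rational.
>√2*⇒ : ∀ {a Z} → 0ℚ ℚ.≤ a → a >√2* Z → ℕ→ℚ 7 ℚ.* Z ℚ.< ℕ→ℚ 5 ℚ.* a
>√2*⇒ {a} {Z} 0≤a (inj₁ (_ , inj₁ Z<0)) = <-≤-trans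
  (subst (ℕ→ℚ 7 ℚ.* Z ℚ.<_) (ℚₚ.*-zeroʳ (ℕ→ℚ 7)) (ℚₚ.*-monoʳ-<-pos (ℕ→ℚ 7) Z<0)) (0≤-* (0≤ℕ→ℚ 5) 0≤a)
>√2*⇒ {a} {Z} 0≤a (inj₁ (_ , inj₂ h)) = ≰⇒> (λ le → <-irrefl refl (<-≤-trans
  (ℚₚ.*-monoʳ-<-pos (ℕ→ℚ 25) h)
  (≤-trans (≤-reflexive (lem a)) (≤-trans (*-mono-≤ (0≤-* (0≤ℕ→ℚ 5) 0≤a) (≤-trans (0≤-* (0≤ℕ→ℚ 5) 0≤a) le) le le)
    (≤-by (0≤-sq Z) (lem₂ Z))))))
  where
  lem : ∀ a → ℕ→ℚ 25 ℚ.* (a ℚ.* a) ≡ (ℕ→ℚ 5 ℚ.* a) ℚ.* (ℕ→ℚ 5 ℚ.* a)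
  lem = solve-∀ ℚ-ring
  lem₂ : ∀ z → z ℚ.* z ≡ ℕ→ℚ 25 ℚ.* (ℕ→ℚ 2 ℚ.* (z ℚ.* z)) ℚ.- (ℕ→ℚ 7 ℚ.* z) ℚ.* (ℕ→ℚ 7 ℚ.* z)
  lem₂ = solve-∀ ℚ-ring
>√2*⇒ 0≤a (inj₂ (a<0 , _)) = ⊥-elim (<-irrefl refl (<-≤-trans a<0 0≤a))

-- Eliminating `d * R` gives `14 x w - 7 y w′ < 10 x w - 5 (2 - C) y
-- w′`. Passing from `W₁`, `W₂` to `w`, `w′` only lowers the left side.
combine : ∀ {d R x y w w′ W₁ W₂} C → 0ℚ ℚ.≤ x → 0ℚ ℚ.≤ y → w ℚ.≤ W₁ → W₂ ℚ.≤ w′ →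
  ℕ→ℚ 7 ℚ.* (ℕ→ℚ 2 ℚ.* x ℚ.* W₁ ℚ.- y ℚ.* W₂) ℚ.< ℕ→ℚ 5 ℚ.* (d ℚ.* R) →
  d ℚ.* R ℚ.≤ ℕ→ℚ 2 ℚ.* w ℚ.* x ℚ.- (ℕ→ℚ 2 ℚ.- C) ℚ.* w′ ℚ.* y →
  ℕ→ℚ 4 ℚ.* (x ℚ.* w) ℚ.< (ℕ→ℚ 5 ℚ.* C ℚ.- ℕ→ℚ 3) ℚ.* (y ℚ.* w′)
combine {d} {R} {x} {y} {w} {w′} {W₁} {W₂} C 0≤x 0≤y w≤ ≤w′ h₁ h₂ = 0<-⇒< (subst (0ℚ ℚ.<_) (lem (d ℚ.* R) x y w w′ W₁ W₂ C)
  (0<-+ˡ (<⇒0<- h₁) (0≤-+ (0≤-* (0≤ℕ→ℚ 5) (≤⇒0≤- h₂)) (0≤-+ (0≤-* (0≤-* (0≤ℕ→ℚ 14) 0≤x) (≤⇒0≤- w≤)) (0≤-* (0≤-* (0≤ℕ→ℚ 7) 0≤y) (≤⇒0≤- ≤w′))))))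
  where
  lem : ∀ e x y w v a b c →
    (ℕ→ℚ 5 ℚ.* e ℚ.- ℕ→ℚ 7 ℚ.* (ℕ→ℚ 2 ℚ.* x ℚ.* a ℚ.- y ℚ.* b)) ℚ.+ (ℕ→ℚ 5 ℚ.* ((ℕ→ℚ 2 ℚ.* w ℚ.* x ℚ.- (ℕ→ℚ 2 ℚ.- c) ℚ.* v ℚ.* y) ℚ.- e)
      ℚ.+ (ℕ→ℚ 14 ℚ.* x ℚ.* (a ℚ.- w) ℚ.+ ℕ→ℚ 7 ℚ.* y ℚ.* (v ℚ.- b)))
    ≡ (ℕ→ℚ 5 ℚ.* c ℚ.- ℕ→ℚ 3) ℚ.* (y ℚ.* v) ℚ.- ℕ→ℚ 4 ℚ.* (x ℚ.* w)
  lem = solve-∀ ℚ-ring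

5-or-9≤ : ∀ q → 2 ℕ.≤ q → q % 4 ≡ 1 → q ≡ 5 ⊎ 9 ℕ.≤ q
5-or-9≤ 0 () _
5-or-9≤ 1 (s≤s ()) _
5-or-9≤ 2 _ ()
5-or-9≤ 3 _ ()
5-or-9≤ 4 _ ()
5-or-9≤ 5 _ _ = inj₁ refl
5-or-9≤ 6 _ ()
5-or-9≤ 7 _ ()
5-or-9≤ 8 _ ()
5-or-9≤ (suc (suc (suc (suc (suc (suc (suc (suc (suc q))))))))) _ _ = inj₂ (ℕₚ.m≤m+n 9 q)

7≤prime : ∀ {p} → Prime p → p ≢ 2 → p ≢ 3 → p ≢ 5 → 7 ℕ.≤ p
7≤prime {0} h _ _ _ = ⊥-elim (¬prime[0] h)
7≤prime {1} h _ _ _ = ⊥-elim (¬prime[1] h)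
7≤prime {2} _ n _ _ = ⊥-elim (n refl)
7≤prime {3} _ _ n _ = ⊥-elim (n refl)
7≤prime {4} h _ _ _ = ⊥-elim (from-no (prime? 4) h)
7≤prime {5} _ _ _ n = ⊥-elim (n refl)
7≤prime {6} h _ _ _ = ⊥-elim (from-no (prime? 6) h)
7≤prime {suc (suc (suc (suc (suc (suc (suc p))))))} _ _ _ _ = ℕₚ.m≤m+n 7 p

∣1+m⇒∣1 : ∀ {d m} → d ∣ 1 ℕ.+ m → d ∣ m → d ∣ 1
∣1+m⇒∣1 {d} {m} h = Div.∣m+n∣m⇒∣n (subst (d ∣_) (ℕₚ.+-comm 1 m) h)

-- The cases `q ≥ 9` and `q = 5`

module Conclusion (F : FiniteField) (q n : ℕ) (q-primePower : IsPrimePower q) (q≡1[4] : q % 4 ≡ 1) (n-odd : n % 2 ≡ 1)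
  (card≡ : FiniteField.card F ≡ q ^ n) (β : FiniteField.Carrier F)
  (β-inSubfield : FiniteField._^F_ F β q ≡ β) (β≢0 : β ≢ FiniteField.0F F)
  (k : ℕ) (ps : List ℕ) (ps-prime : All Prime ps) (ps-unique : Unique ps) (ps∤k : All (λ p → ¬ (p ∣ k)) ps)
  (rad≡ : rad (q ^ n ∸ 1) ≡ k * product ps) (0<δ : δ ps > 0ℚ)
  (large : ℕ→ℚ (q ^ ((n ∸ 1) / 2)) >√2* bound q n k ps) where

  N₀ : ℕ
  N₀ = q ^ n ∸ 1

  Q : ℕ
  Q = Qof q n

  q≡ : q ≡ 1 ℕ.+ q / 4 * 4
  q≡ = trans (DivMod.m≡m%n+[m/n]*n q 4) (cong (ℕ._+ q / 4 * 4) q≡1[4])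

  n≡ : n ≡ 1 ℕ.+ n / 2 * 2
  n≡ = trans (DivMod.m≡m%n+[m/n]*n n 2) (cong (ℕ._+ n / 2 * 2) n-odd)

  1≤n : 1 ℕ.≤ n
  1≤n = subst (1 ℕ.≤_) (sym n≡) (s≤s z≤n)

  2≤q : 2 ℕ.≤ q
  2≤q = 2≤primePower q-primePower

  2∣4 : 2 ∣ 4
  2∣4 = divides 2 refl

  2∣q-1 : 2 ∣ q ∸ 1
  2∣q-1 = subst (λ m → 2 ∣ m ∸ 1) (sym q≡) (Div.∣n⇒∣m*n (q / 4) 2∣4)

  2∤q : ¬ (2 ∣ q)
  2∤q h = from-no (2 ∣? 1) (∣1+m⇒∣1 (subst (2 ∣_) q≡ h) (Div.∣n⇒∣m*n (q / 4) 2∣4))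

  2∣1+q : 2 ∣ 1 ℕ.+ q
  2∣1+q = subst (λ m → 2 ∣ 1 ℕ.+ m) (sym q≡) (Div.∣m∣n⇒∣m+n (from-yes (2 ∣? 2)) (Div.∣n⇒∣m*n (q / 4) 2∣4))

  Q-∤ : ∀ {p} → Prime p → p ∣ 1 ℕ.+ q → ¬ (p ∣ q) → ¬ (p ∣ Q)
  Q-∤ {p} hp p∣ p∤ h = ∤geometric hp p∣ p∤ (n / 2) (subst (p ∣_) (trans (Qof≡geometric q n 2≤q) (cong (geometric q) n≡)) h)

  Q-odd : ¬ (2 ∣ Q)
  Q-odd = Q-∤ prime[2] 2∣1+q 2∤q

  Q-*₀ : Q * (q ∸ 1) ≡ N₀
  Q-*₀ = Qof-* q n 2≤q

  N≡ : FiniteField.card F ∸ 1 ≡ N₀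
  N≡ = cong (_∸ 1) card≡

  ∣N₀⇒∣N : ∀ {p} → p ∣ N₀ → p ∣ FiniteField.card F ∸ 1
  ∣N₀⇒∣N {p} = subst (p ∣_) (sym N≡)

  ∣N⇒∣N₀ : ∀ {p} → p ∣ FiniteField.card F ∸ 1 → p ∣ N₀
  ∣N⇒∣N₀ {p} = subst (p ∣_) N≡

  2∣N₀ : 2 ∣ N₀
  2∣N₀ = subst (2 ∣_) Q-*₀ (Div.∣n⇒∣m*n Q 2∣q-1)

  h : ℕ
  h = (n ∸ 1) / 2

  R : ℚ
  R = ℕ→ℚ (q ^ h)

  -- Oddness of `n` gives `q ^ (n - 1)` the integral square root `q ^ h`, so the argument stays
  -- within `ℚ`.
  h+h≡ : h ℕ.+ h ≡ n ∸ 1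
  h+h≡ = trans (cong (h ℕ.+_) (sym (ℕₚ.+-identityʳ h))) (trans (ℕₚ.*-comm 2 h)
    (trans (cong (_* 2) h≡) (sym (cong (_∸ 1) n≡))))
    where
    h≡ : h ≡ n / 2
    h≡ = trans (cong (λ m → (m ∸ 1) / 2) n≡) (DivMod.m*n/n≡m (n / 2) 2)

  q^h*q^h : q ^ h * q ^ h ≡ q ^ (n ∸ 1)
  q^h*q^h = trans (sym (ℕₚ.^-distribˡ-+-* q h h)) (cong (q ^_) h+h≡)

  R² : R ℚ.* R ≡ ℕ→ℚ (q ^ (n ∸ 1))
  R² = trans (sym (ℕ→ℚ-* (q ^ h) (q ^ h))) (cong ℕ→ℚ q^h*q^h)

  0<R : 0ℚ ℚ.< R
  0<R = ℕ→ℚ-mono-< {0} (ℕₚ.m^n>0 q {{ℕ.>-nonZero (ℕₚ.≤-trans (s≤s z≤n) 2≤q)}} h)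

  N₀≢0 : N₀ ≢ 0
  N₀≢0 e = ℕₚ.<⇒≢ (ℕₚ.m<n⇒0<n∸m 1<q^n) (sym e)
    where
    1<q^n : 1 ℕ.< q ^ n
    1<q^n = ℕₚ.<-≤-trans 2≤q (ℕₚ.≤-trans (ℕₚ.≤-reflexive (sym (ℕₚ.^-identityʳ q)))
      (ℕₚ.^-monoʳ-≤ q {{ℕ.>-nonZero (ℕₚ.≤-trans (s≤s z≤n) 2≤q)}} 1≤n))

  ∣rad⇒∣N : ∀ {p} → Prime p → p ∣ rad N₀ → p ∣ N₀
  ∣rad⇒∣N hp d = proj₂ (∈-primeDivisors⁻ {N₀} (factorisationHasAllPrimeFactors hp d (All.tabulate (λ p∈ → proj₁ (∈-primeDivisors⁻ {N₀} p∈)))))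

  ∣N⇒∣rad : ∀ {p} → Prime p → p ∣ N₀ → p ∣ rad N₀
  ∣N⇒∣rad hp d = ∈⇒∣product (∈-primeDivisors⁺ N₀≢0 hp d)

  k≢0 : k ≢ 0
  k≢0 refl = ℕ.≢-nonZero⁻¹ (rad N₀) {{product≢0 (All.tabulate (λ p∈ → prime⇒nonZero (proj₁ (∈-primeDivisors⁻ {N₀} p∈))))}} rad≡

  K : List ℕ
  K = primeDivisors k

  p∈ps⇒∣N : ∀ {p} → p ∈ ps → p ∣ N₀
  p∈ps⇒∣N p∈ = ∣rad⇒∣N (All.lookup ps-prime p∈) (subst (_ ∣_) (sym rad≡) (Div.∣n⇒∣m*n k (∈⇒∣product p∈)))

  p∈K⇒∣N : ∀ {p} → p ∈ K → p ∣ N₀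
  p∈K⇒∣N p∈ = ∣rad⇒∣N (proj₁ (∈-primeDivisors⁻ {k} p∈)) (subst (_ ∣_) (sym rad≡) (Div.∣m⇒∣m*n (product ps) (proj₂ (∈-primeDivisors⁻ {k} p∈))))

  prime-∣N : ∀ {p} → Prime p → p ∣ N₀ → p ∈ K ⊎ p ∈ ps
  prime-∣N {p} hp d with euclidsLemma k (product ps) hp (subst (p ∣_) rad≡ (∣N⇒∣rad hp d))
  ... | inj₁ d′ = inj₁ (∈-primeDivisors⁺ k≢0 hp d′)
  ... | inj₂ d′ = inj₂ (factorisationHasAllPrimeFactors hp d′ ps-prime)

  ps∉K : All (_∉ K) ps
  ps∉K = All.map (λ p∤k p∈ → p∤k (proj₂ (∈-primeDivisors⁻ {k} p∈))) ps∤k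

  K-prime : All Prime K
  K-prime = All.tabulate (λ p∈ → proj₁ (∈-primeDivisors⁻ {k} p∈))

  -- `x` and `y` are `δ ps` times the two brackets in `bound`; `w` and `w′` are the powers of 2 that
  -- the sieve produces where the hypothesis has `W₁` and `W₂`.
  Θ A x y w w′ W₁ W₂ : ℚ
  Θ = sumℚ (map θ ps)
  A = sumℚ (map θ (filter (_∣? Q) ps))
  x = δ ps ℚ.+ Θ
  y = δ ps ℚ.+ A
  w = pow2 K
  w′ = pow2Q Q K
  W₁ = ℕ→ℚ (W k)
  W₂ = ℕ→ℚ (W (radBoth k Q))

  y≤x : y ℚ.≤ x
  y≤x = ℚₚ.+-monoʳ-≤ (δ ps) (sum-θ-filter Q ps-prime)

  0≤y : 0ℚ ℚ.≤ y
  0≤y = 0≤-+ (<⇒≤ 0<δ) (0≤sum-θ (Allₚ.filter⁺ (_∣? Q) ps-prime))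

  0≤x : 0ℚ ℚ.≤ x
  0≤x = ≤-trans 0≤y y≤x

  w≤W₁ : w ℚ.≤ W₁
  w≤W₁ = ≤-trans (≤-reflexive (pow2≡ K)) (ℕ→ℚ-mono-≤ (2^length≤W k≢0 K-prime (primeDivisors-unique k) (All.tabulate (λ p∈ → proj₂ (∈-primeDivisors⁻ {k} p∈)))))

  W₂≤w′ : W₂ ℚ.≤ w′
  W₂≤w′ = ≤-trans (ℕ→ℚ-mono-≤ (W-radBoth≤ k Q)) (≤-reflexive (sym (pow2Q≡ Q K)))

  0≤w′ : 0ℚ ℚ.≤ w′
  0≤w′ = 0≤pow2Q Q K

  δ*bound : δ ps ℚ.* bound q n k ps ≡ ℕ→ℚ 2 ℚ.* x ℚ.* W₁ ℚ.- y ℚ.* W₂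
  δ*bound = trans (lem (δ ps) (divQ a (δ ps)) (divQ b (δ ps)) W₁ W₂)
    (trans (cong₂ (λ u v → ℕ→ℚ 2 ℚ.* (u ℚ.+ ℕ→ℚ 2 ℚ.* δ ps) ℚ.* W₁ ℚ.- (v ℚ.+ δ ps) ℚ.* W₂) (divQ-* a 0<δ) (divQ-* b 0<δ))
      (trans (lem₂ a (δ ps) b W₁ W₂) (cong₂ (λ u v → ℕ→ℚ 2 ℚ.* (δ ps ℚ.+ u) ℚ.* W₁ ℚ.- (δ ps ℚ.+ v) ℚ.* W₂)
        (sym (sum-θ ps)) (sym (sum-θ (filter (_∣? Q) ps))))))
    where
    a b : ℚ
    a = ℕ→ℚ (length ps) ℚ.- 1ℚ
    b = (ℕ→ℚ (length (psQ q n ps)) ℚ.- 1ℚ) ℚ.+ δQ q n ps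
    lem : ∀ d s t u v → d ℚ.* (ℕ→ℚ 2 ℚ.* (s ℚ.+ ℕ→ℚ 2) ℚ.* u ℚ.- (t ℚ.+ 1ℚ) ℚ.* v) ≡
      ℕ→ℚ 2 ℚ.* (d ℚ.* s ℚ.+ ℕ→ℚ 2 ℚ.* d) ℚ.* u ℚ.- (d ℚ.* t ℚ.+ d) ℚ.* v
    lem = solve-∀ ℚ-ring
    lem₂ : ∀ a d b u v → ℕ→ℚ 2 ℚ.* (a ℚ.+ ℕ→ℚ 2 ℚ.* d) ℚ.* u ℚ.- (b ℚ.+ d) ℚ.* v ≡
      ℕ→ℚ 2 ℚ.* (d ℚ.+ (a ℚ.+ d)) ℚ.* u ℚ.- (d ℚ.+ b) ℚ.* v
    lem₂ = solve-∀ ℚ-ring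

  large′ : ℕ→ℚ 7 ℚ.* (ℕ→ℚ 2 ℚ.* x ℚ.* W₁ ℚ.- y ℚ.* W₂) ℚ.< ℕ→ℚ 5 ℚ.* (δ ps ℚ.* R)
  large′ = subst₂ ℚ._<_ (trans (lem (δ ps) (ℕ→ℚ 7) (bound q n k ps)) (cong (ℕ→ℚ 7 ℚ.*_) δ*bound)) (lem (δ ps) (ℕ→ℚ 5) R)
    (ℚₚ.*-monoʳ-<-pos (δ ps) {{ℚ.positive 0<δ}} (>√2*⇒ (<⇒≤ 0<R) large))
    where
    lem : ∀ a b c → a ℚ.* (b ℚ.* c) ≡ b ℚ.* (a ℚ.* c)
    lem = solve-∀ ℚ-ring

  Q-* : Q * (q ∸ 1) ≡ FiniteField.card F ∸ 1
  Q-* = trans Q-*₀ (sym N≡)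

  2∣N : 2 ∣ FiniteField.card F ∸ 1
  2∣N = subst (2 ∣_) (sym N≡) 2∣N₀

  module SieveWith (C : ℚ) (1≤C : 1ℚ ℚ.≤ C)
    (C-bound : ℕ→ℚ 3 ℚ.* ℕ→ℚ q ℚ.+ ℕ→ℚ 6 ℚ.≤ (ℕ→ℚ 2 ℚ.* ℕ→ℚ q) ℚ.* (C ℚ.* C)) where

    open Sieve F q n q-primePower 1≤n card≡ β β-inSubfield β≢0 Q Q-* Q-odd 2∣N R C R² 0<R 1≤C C-bound public
      hiding (A; 2≤q)

    K-distinct : Distinct K
    K-distinct = All.tabulate (λ p∈ → proj₁ (∈-primeDivisors⁻ {k} p∈) , ∣N₀⇒∣N (p∈K⇒∣N p∈)) , primeDivisors-unique k

    ps-primeDivisors : All PrimeDivisor ps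
    ps-primeDivisors = All.tabulate (λ p∈ → All.lookup ps-prime p∈ , ∣N₀⇒∣N (p∈ps⇒∣N p∈))

    core : NoSolution (K ++ ps) → ℕ→ℚ 4 ℚ.* (x ℚ.* w) ℚ.< (ℕ→ℚ 5 ℚ.* C ℚ.- ℕ→ℚ 3) ℚ.* (y ℚ.* w′)
    core none = combine {δ ps} {R} {x} {y} {w} {w′} {W₁} {W₂} C 0≤x 0≤y w≤W₁ W₂≤w′ large′ (no-solution-bound K ps K-distinct ps-primeDivisors ps∉K (<⇒≤ 0<δ) none)

    -- The field is finite and the conditions are decidable, so a search turns the refutation into a
    -- witness. It is free because every prime dividing `N` lies in `K ++ ps`.
    conclude : ¬ NoSolution (K ++ ps) → FiniteField.NPositive F q n N₀ β
    conclude some = found (any? candidate?)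
      where
      Candidate : Carrier → Set
      Candidate ξ = ξ ≢ 0F × All (λ p → ξ ^F cofactor p ≢ 1F) (K ++ ps) × tr (ξ *F ξ) ≡ β
      candidate? : ∀ ξ → Dec (Candidate ξ)
      candidate? ξ = ¬? (ξ ≟F 0F) ×-dec (All.all? (λ p → ¬? (inKernel? p ξ)) (K ++ ps) ×-dec (tr (ξ *F ξ) ≟F β))
      member : ∀ {p} → p ∈ K ⊎ p ∈ ps → p ∈ K ++ ps
      member (inj₁ p∈K) = ∈-++⁺ˡ p∈K
      member (inj₂ p∈ps) = ∈-++⁺ʳ K p∈ps
      found : Dec (Σ Carrier Candidate) → FiniteField.NPositive F q n N₀ β
      found (no none) = ⊥-elim (some (λ ξ ξ≢0 free e → none (ξ , ξ≢0 , free , e)))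
      found (yes (ξ , ξ≢0 , free , e)) = ξ , ξ≢0 , subst (λ m → IsFree m ξ) N≡
        (nonResidues⇒free (λ (p-prime , p∣N) → All.lookup free (member (prime-∣N p-prime (∣N⇒∣N₀ p∣N))))) , e

  yw′≤xw : y ℚ.* w′ ℚ.≤ x ℚ.* w
  yw′≤xw = *-mono-≤ 0≤y (≤-trans 0≤w′ (pow2Q≤pow2 Q K)) y≤x (pow2Q≤pow2 Q K)

  0≤yw′ : 0ℚ ℚ.≤ y ℚ.* w′
  0≤yw′ = 0≤-* 0≤y 0≤w′

  -- 3/2 + 3/q ≤ (7/5)² holds from q = 9 on; for q = 5 the constant grows to 29/20, and the loss against 7/5 is made up by the prime 2.
  case-9≤q : 9 ℕ.≤ q → FiniteField.NPositive F q n N₀ β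
  case-9≤q 9≤q = conclude (λ none → <-irrefl refl (<-≤-trans (core none) (≤-by (0≤-* (0≤ℕ→ℚ 4) (≤⇒0≤- yw′≤xw)) (lem (x ℚ.* w) (y ℚ.* w′)))))
    where
    -- For `C = 7/5` the factor `5 C - 3` is exactly 4, so `core` would give `x w < y w′`.
    lem : ∀ a b → ℕ→ℚ 4 ℚ.* (a ℚ.- b) ≡ ℕ→ℚ 4 ℚ.* a ℚ.- (ℕ→ℚ 5 ℚ.* (+ 7 ℚ./ 5) ℚ.- ℕ→ℚ 3) ℚ.* b
    lem = solve-∀ ℚ-ring
    -- The constants are `2 * (7/5)² - 3 = 23/25` and `9 * 23/25 - 6 = 57/25`.
    lem₂ : ∀ q → (+ 23 ℚ./ 25) ℚ.* (q ℚ.- ℕ→ℚ 9) ℚ.+ (+ 57 ℚ./ 25) ≡ (ℕ→ℚ 2 ℚ.* q) ℚ.* ((+ 7 ℚ./ 5) ℚ.* (+ 7 ℚ./ 5)) ℚ.- (ℕ→ℚ 3 ℚ.* q ℚ.+ ℕ→ℚ 6)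
    lem₂ = solve-∀ ℚ-ring
    open SieveWith (+ 7 ℚ./ 5) (from-yes (1ℚ ℚₚ.≤? (+ 7 ℚ./ 5)))
      (≤-by (0≤-+ (0≤-* (from-yes (0ℚ ℚₚ.≤? (+ 23 ℚ./ 25))) (≤⇒0≤- (ℕ→ℚ-mono-≤ 9≤q))) (from-yes (0ℚ ℚₚ.≤? (+ 57 ℚ./ 25)))) (lem₂ (ℕ→ℚ q)))

  module Case5 (q≡5 : q ≡ 5) where

    -- `(29/20)² = 2.1025` just exceeds `3/2 + 3/5 = 2.1`.
    open SieveWith (+ 29 ℚ./ 20) (from-yes (1ℚ ℚₚ.≤? (+ 29 ℚ./ 20)))
      (subst (λ m → ℕ→ℚ 3 ℚ.* ℕ→ℚ m ℚ.+ ℕ→ℚ 6 ℚ.≤ (ℕ→ℚ 2 ℚ.* ℕ→ℚ m) ℚ.* ((+ 29 ℚ./ 20) ℚ.* (+ 29 ℚ./ 20))) (sym q≡5)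
        (from-yes (ℕ→ℚ 3 ℚ.* ℕ→ℚ 5 ℚ.+ ℕ→ℚ 6 ℚₚ.≤? (ℕ→ℚ 2 ℚ.* ℕ→ℚ 5) ℚ.* ((+ 29 ℚ./ 20) ℚ.* (+ 29 ℚ./ 20)))))

    -- Here `5 C - 3 = 17/4`, so the prime 2 has to make up for the ratio `17/16`.
    core5 : NoSolution (K ++ ps) → ℕ→ℚ 16 ℚ.* (x ℚ.* w) ℚ.< ℕ→ℚ 17 ℚ.* (y ℚ.* w′)
    core5 none = subst₂ ℚ._<_ (lem (x ℚ.* w)) (lem₂ (y ℚ.* w′)) (ℚₚ.*-monoʳ-<-pos (ℕ→ℚ 4) (core none))
      where
      lem : ∀ a → ℕ→ℚ 4 ℚ.* (ℕ→ℚ 4 ℚ.* a) ≡ ℕ→ℚ 16 ℚ.* a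
      lem = solve-∀ ℚ-ring
      lem₂ : ∀ a → ℕ→ℚ 4 ℚ.* ((ℕ→ℚ 5 ℚ.* (+ 29 ℚ./ 20) ℚ.- ℕ→ℚ 3) ℚ.* a) ≡ ℕ→ℚ 17 ℚ.* a
      lem₂ = solve-∀ ℚ-ring

    -- As 2 does not divide `Q`, it doubles `w` but not `w′`, and 32 exceeds 17.
    2∈K⇒ : 2 ∈ K → ¬ NoSolution (K ++ ps)
    2∈K⇒ 2∈K none = <-irrefl refl (<-≤-trans (core5 none) (≤-by (0≤-+ (0≤-* (0≤ℕ→ℚ 16) (≤⇒0≤- double)) (0≤-* (0≤ℕ→ℚ 15) 0≤yw′)) (lem (x ℚ.* w) y w′)))
      where
      double : y ℚ.* (ℕ→ℚ 2 ℚ.* w′) ℚ.≤ x ℚ.* w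
      double = *-mono-≤ 0≤y (≤-trans 0≤w′ (pow2Q≤pow2 Q K)) y≤x (2pow2Q≤pow2 Q 2∈K Q-odd)
      lem : ∀ a y v → ℕ→ℚ 16 ℚ.* (a ℚ.- y ℚ.* (ℕ→ℚ 2 ℚ.* v)) ℚ.+ ℕ→ℚ 15 ℚ.* (y ℚ.* v) ≡ ℕ→ℚ 16 ℚ.* a ℚ.- ℕ→ℚ 17 ℚ.* (y ℚ.* v)
      lem = solve-∀ ℚ-ring

    -- The prime 2 contributes `θ 2 = 1/2` to `x` but nothing to `A`, so `x ≥ y + 1/2`; and
    -- `16 (y + 1/2) ≥ 17 y` means `y ≤ 8`.
    2∈ps-small : 2 ∈ ps → y ℚ.≤ ℕ→ℚ 8 → ¬ NoSolution (K ++ ps)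
    2∈ps-small 2∈ps y≤8 none = <-irrefl refl (<-≤-trans (core5 none)
      (≤-by (0≤-+ (0≤-* (0≤ℕ→ℚ 16) (≤⇒0≤- product≤)) (0≤-* (≤⇒0≤- y≤8) 0≤w′)) (lem (x ℚ.* w) y w′)))
      where
      half+y≤x : θ 2 ℚ.+ y ℚ.≤ x
      half+y≤x = ≤-trans (≤-reflexive (lem₁ (θ 2) (δ ps) A)) (ℚₚ.+-monoʳ-≤ (δ ps) (sum-θ-filter-∈ Q ps-prime 2∈ps Q-odd))
        where
        lem₁ : ∀ a b c → a ℚ.+ (b ℚ.+ c) ≡ b ℚ.+ (a ℚ.+ c)
        lem₁ = solve-∀ ℚ-ring
      product≤ : (θ 2 ℚ.+ y) ℚ.* w′ ℚ.≤ x ℚ.* w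
      product≤ = *-mono-≤ (0≤-+ (0≤θ prime[2]) 0≤y) (≤-trans 0≤w′ (pow2Q≤pow2 Q K)) half+y≤x (pow2Q≤pow2 Q K)
      lem : ∀ a y v → ℕ→ℚ 16 ℚ.* (a ℚ.- (θ 2 ℚ.+ y) ℚ.* v) ℚ.+ (ℕ→ℚ 8 ℚ.- y) ℚ.* v ≡ ℕ→ℚ 16 ℚ.* a ℚ.- ℕ→ℚ 17 ℚ.* (y ℚ.* v)
      lem = solve-∀ ℚ-ring

    L : List ℕ
    L = K ++ ps

    L-distinct : Distinct L
    L-distinct = Allₚ.++⁺ (proj₁ K-distinct) ps-primeDivisors ,
      Uniqueₚ.++⁺ (primeDivisors-unique k) ps-unique (λ (p∈K , p∈ps) → All.lookup ps∉K p∈ps p∈K)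

    -- `q = 5` is `-1` modulo 3, and `Q` is 1 modulo `q`. With `Q` odd, the primes dividing it
    -- therefore start at 7.
    3∤Q : ¬ (3 ∣ Q)
    3∤Q = Q-∤ (from-yes (prime? 3)) (subst (λ m → 3 ∣ 1 ℕ.+ m) (sym q≡5) (divides 2 refl))
      (λ d → from-no (3 ∣? 5) (subst (3 ∣_) q≡5 d))

    5∤Q : ¬ (5 ∣ Q)
    5∤Q d = from-no (5 ∣? 1) (∣1+m⇒∣1 (subst (5 ∣_) (trans (Qof≡geometric q n 2≤q) (cong (geometric q) n≡)) d)
      (Div.∣m⇒∣m*n (geometric q (n / 2 * 2)) (subst (5 ∣_) (sym q≡5) (divides 1 refl))))

    Q*4≡ : Q * 4 ≡ FiniteField.card F ∸ 1
    Q*4≡ = trans (cong (λ t → Q * (t ∸ 1)) (sym q≡5)) Q-*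

    LQ : List ℕ
    LQ = filter (_∣? Q) L

    LQ⁻ : ∀ {p} → p ∈ LQ → p ∈ L × p ∣ Q
    LQ⁻ = ∈-filter⁻ (_∣? Q) {xs = L}

    L-prime : ∀ {p} → p ∈ L → Prime p
    L-prime p∈ = proj₁ (All.lookup (proj₁ L-distinct) p∈)

    7^≤Q : 7 ^ length LQ ℕ.≤ Q
    7^≤Q = ℕₚ.≤-trans (product≥7^length (All.tabulate (λ p∈ → 7≤ (L-prime (proj₁ (LQ⁻ p∈))) (proj₂ (LQ⁻ p∈)))))
      (Div.∣⇒≤ {{ℕ.≢-nonZero Q≢0}} (product-unique-primes-∣ (All.tabulate (λ p∈ → L-prime (proj₁ (LQ⁻ p∈))))
        (Uniqueₚ.filter⁺ (_∣? Q) (proj₂ L-distinct)) (All.tabulate (λ p∈ → proj₂ (LQ⁻ p∈)))))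
      where
      Q≢0 : Q ≢ 0
      Q≢0 e = N₀≢0 (trans (sym Q-*₀) (cong (_* (q ∸ 1)) e))
      7≤ : ∀ {p} → Prime p → p ∣ Q → 7 ℕ.≤ p
      7≤ hp d = 7≤prime hp (λ { refl → Q-odd d }) (λ { refl → 3∤Q d }) (λ { refl → 5∤Q d })

    -- Here `q - 1 = 4`, so `N = 4 Q`, and 2 is the only prime divisor of `N` missing from `Q`.
    length-L : length L ℕ.≤ suc (length LQ)
    length-L = length-filter-all-but-one (_∣? Q) 2 (proj₂ L-distinct) (All.tabulate only2)
      where
      only2 : ∀ {p} → p ∈ L → ¬ (p ∣ Q) → p ≡ 2
      only2 {p} p∈ p∤Q = fromInj₂ (λ p∣Q → ⊥-elim (p∤Q p∣Q)) (prime-∣*4 Q (L-prime p∈)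
        (subst (p ∣_) (sym Q*4≡) (proj₂ (All.lookup (proj₁ L-distinct) p∈))))

    -- `y` is at most 1 plus the number of primes of `ps` that divide `Q`.
    8≤length-LQ : ℕ→ℚ 8 ℚ.< y → 8 ℕ.≤ length LQ
    8≤length-LQ 8<y = ℕₚ.≤-trans (ℕₚ.≤-pred (ℕ→ℚ-cancel-< (<-≤-trans 8<y (≤-trans (+-mono-≤ (δ≤1 ps) (sum-θ≤length (filter (_∣? Q) ps)))
        (≤-reflexive (sym (ℕ→ℚ-suc (length (filter (_∣? Q) ps)))))))))
      (ℕₚ.≤-trans (Listₚ.length-++-≤ʳ (filter (_∣? Q) ps) {filter (_∣? Q) K}) (ℕₚ.≤-reflexive (cong length (sym (Listₚ.filter-++ (_∣? Q) K ps)))))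

    -- The sieve with an empty second list, where `δ [] = 1`; the negative term, with factor
    -- `2 - 29/20 = 11/20`, is discarded.
    R≤2pow2 : NoSolution L → R ℚ.≤ ℕ→ℚ 2 ℚ.* pow2 L
    R≤2pow2 none = ≤-trans (≤-reflexive (lem₁ R)) (≤-trans (no-solution-bound L [] L-distinct [] [] 0≤1
      (subst NoSolution (sym (Listₚ.++-identityʳ L)) none))
      (≤-by (0≤-* (from-yes (0ℚ ℚₚ.≤? (+ 11 ℚ./ 20))) (0≤pow2Q Q L)) (lem₂ (pow2 L) (pow2Q Q L))))
      where
      lem₁ : ∀ r → r ≡ (1ℚ ℚ.- 0ℚ) ℚ.* r
      lem₁ = solve-∀ ℚ-ring
      lem₂ : ∀ a b → (+ 11 ℚ./ 20) ℚ.* b ≡ ℕ→ℚ 2 ℚ.* a ℚ.- (ℕ→ℚ 2 ℚ.* a ℚ.* ((1ℚ ℚ.- 0ℚ) ℚ.+ 0ℚ) ℚ.- (ℕ→ℚ 2 ℚ.- (+ 29 ℚ./ 20)) ℚ.* b ℚ.* ((1ℚ ℚ.- 0ℚ) ℚ.+ 0ℚ))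
      lem₂ = solve-∀ ℚ-ring

    -- One factor 2 is that of the general bound, the other accounts for the prime 2, which `LQ`
    -- lacks.
    q^h≤ : NoSolution L → q ^ h ℕ.≤ 4 * 2 ^ length LQ
    q^h≤ none = ℕₚ.≮⇒≥ (λ l → <-irrefl refl (<-≤-trans (ℕ→ℚ-mono-< l) (≤-trans (R≤2pow2 none) (≤-trans
      (≤-reflexive (trans (cong (ℕ→ℚ 2 ℚ.*_) (pow2≡ L)) (sym (ℕ→ℚ-* 2 (2 ^ length L)))))
      (ℕ→ℚ-mono-≤ (ℕₚ.≤-trans (ℕₚ.*-monoʳ-≤ 2 (ℕₚ.^-monoʳ-≤ 2 length-L)) (ℕₚ.≤-reflexive (sym (ℕₚ.*-assoc 2 2 (2 ^ length LQ))))))))))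

    -- With all primes in the core the sieve loses only 2 · 2 ^ length L, and eight primes ≥ 7 dividing Q make R far larger.
    2∈ps-large : ℕ→ℚ 8 ℚ.< y → ¬ NoSolution L
    2∈ps-large 8<y none = ℕₚ.<⇒≱
      (16*4^<5^ (8≤length-LQ 8<y) 7^≤Q (trans Q*4≡ (trans N≡ (cong (_∸ 1) q^n≡))) (ℕₚ.m^n>0 q {{ℕ.>-nonZero (ℕₚ.≤-trans (s≤s z≤n) 2≤q)}} (n ∸ 1)))
      (subst (ℕ._≤ 16 * 4 ^ length LQ) q^h*q^h (square≤16*4^ {m = length LQ} (q^h≤ none)))
      where
      q^n≡ : q ^ n ≡ 5 * q ^ (n ∸ 1)
      q^n≡ = trans (cong (q ^_) (sym (ℕₚ.m+[n∸m]≡n 1≤n))) (cong (_* q ^ (n ∸ 1)) q≡5)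

    case-5 : FiniteField.NPositive F q n N₀ β
    case-5 = conclude ([ 2∈K⇒ , (λ 2∈ps → 2∈ps-case 2∈ps (y ℚₚ.≤? ℕ→ℚ 8)) ]′ (prime-∣N prime[2] 2∣N₀))
      where
      2∈ps-case : 2 ∈ ps → Dec (y ℚ.≤ ℕ→ℚ 8) → ¬ NoSolution L
      2∈ps-case 2∈ps (yes y≤8) = 2∈ps-small 2∈ps y≤8
      2∈ps-case 2∈ps (no y≰8) = 2∈ps-large (≰⇒> y≰8)

  conclusion : FiniteField.NPositive F q n N₀ β
  conclusion = [ Case5.case-5 , case-9≤q ]′ (5-or-9≤ q 2≤q q≡1[4])

theorem5p14 : (F : FiniteField) (q n : ℕ) →
    IsPrimePower q → q % 4 ≡ 1 → n ≥ 3 → n % 2 ≡ 1 →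
    FiniteField.card F ≡ q ^ n →
    (β : FiniteField.Carrier F) → FiniteField._^F_ F β q ≡ β → β ≢ FiniteField.0F F →
    (k : ℕ) (ps : List ℕ) → All Prime ps → Unique ps → All (λ p → ¬ (p ∣ k)) ps →
    rad (q ^ n ∸ 1) ≡ k * product ps →
    δ ps > 0ℚ →
    ℕ→ℚ (q ^ ((n ∸ 1) / 2)) >√2* bound q n k ps →
    FiniteField.NPositive F q n (q ^ n ∸ 1) β
theorem5p14 F q n q-primePower q≡1[4] _ n-odd card≡ β β-inSubfield β≢0 k ps ps-prime ps-unique ps∤k rad≡ 0<δ large =
  Conclusion.conclusion F q n q-primePower q≡1[4] n-odd card≡ β β-inSubfield β≢0 k ps ps-prime ps-unique ps∤k rad≡ 0<δ large
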